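{- Let $n,k,\ell$ be positive integers and $r$ an integer with $0<r<k$. Let $b,b_1,\dots,b_n$ and $s_1,\dots,s_{\ell+1}$ be nonnegative integers with $\sum_{i=1}^n b_i=b$, $\sum_{i=1}^n i\,b_i\le n$, $\sum_{i=1}^{\ell+1}s_i=n$ and $s_1=n-b$. Then the number of multichains $\pi_1\le\cdots\le\pi_\ell$ in $\mathrm{NC}^{(k)}(n;r)$ with rank jump vector $(s_1,\dots,s_{\ell+1})$ and $\mathrm{type}^{(k)}(\pi_1)=(b;b_1,\dots,b_n)$ equals $$\binom{b}{b_1,b_2,\dots,b_n}\binom{kn+r}{s_2}\cdots\binom{kn+r}{s_{\ell+1}}.$$
   Context: A partition $\pi$ of $[N]$ is noncrossing if there are no $a<b<c<d$ with $a,c$ in a block $B$ and $b,d$ in a block $B'\ne B$; $\mathrm{NC}(N)$ is the poset of noncrossing partitions of $[N]$ ordered by refinement. For $0<r<k$, $\mathrm{NC}^{(k)}(n;r)$ is the subposet of $\mathrm{NC}(kn+r)$ consisting of partitions all but one of whose blocks have size divisible by $k$. It is graded with rank function $\mathrm{rank}(\pi)=n-\mathrm{bk}'(\pi)$, where $\mathrm{bk}'(\pi)$ is the number of blocks of size divisible by $k$; the maximum element has rank $n$. $\mathrm{type}^{(k)}(\pi)=(b;b_1,\dots,b_n)$, where $b_i$ is the number of blocks of size $ki$ and $b=\sum b_i$. For a multichain (chain with repetitions allowed) $\pi_1\le\cdots\le\pi_\ell$ its rank jump vector is $(s_1,\dots,s_{\ell+1})$ with $s_1=\mathrm{rank}(\pi_1)$,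 $s_i=\mathrm{rank}(\pi_i)-\mathrm{rank}(\pi_{i-1})$ for $2\le i\le\ell$, $s_{\ell+1}=n-\mathrm{rank}(\pi_\ell)$. -}

module Defs where

open import Data.Nat as ℕ using (ℕ; zero; suc; _+_; _*_; _∸_; NonZero; _!)
open import Data.Nat.Properties using (_!≢0; m*n≢0)
open import Data.Nat.DivMod using (_/_)
open import Data.Nat.Divisibility using (_∣_; _∣?_)
open import Data.Fin as Fin using (Fin; toℕ; fromℕ<)
open import Data.List as List using (List; length; filter; allFin)
open import Data.Vec as Vec using (Vec; []; _∷_; tabulate; _∷ʳ_)
open import Data.Product using (Σ; _×_; _,_; proj₁)
open import Relation.Nullary using (¬_; Dec)
open import Relation.Nullary.Decidable using (_×-dec_; ¬?)
open import Relation.Unary using (Pred; Decidable)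
open import Relation.Binary.PropositionalEquality using (_≡_)
open import Level using (0ℓ)

countFin : ∀ {N} (P : Pred (Fin N) 0ℓ) → Decidable P → ℕ
countFin {N} P P? = length (filter P? (allFin N))

HasCount : (A : Set) → (A → A → Set) → ℕ → Set
HasCount A _≈_ m =
  Σ (Fin m → A) λ e →
    (∀ i j → e i ≈ e j → i ≡ j) × (∀ x → Σ (Fin m) λ i → x ≈ e i)

-- Set partitions of [N] = Fin N.
-- A partition is encoded by the map sending every element to the
-- minimum of its block (canonical representative).  Two encodings are
-- equal as partitions iff they agree pointwise.

record Partition (N : ℕ) : Set where
  field
    blk   : Fin N → Fin N
    blk≤  : ∀ i → blk i Fin.≤ i
    blk-idem : ∀ i → blk (blk i) ≡ blk i
open Partition public

_≈P_ : ∀ {N} → Partition N → Partition N → Set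
π ≈P σ = ∀ i → blk π i ≡ blk σ i

SameBlock : ∀ {N} → Partition N → Fin N → Fin N → Set
SameBlock π i j = blk π i ≡ blk π j

_⊑_ : ∀ {N} → Partition N → Partition N → Set
π ⊑ σ = ∀ i j → SameBlock π i j → SameBlock σ i j

Noncrossing : ∀ {N} → Partition N → Set
Noncrossing π = ∀ a b c d → a Fin.< b → b Fin.< c → c Fin.< d →
  SameBlock π a c → SameBlock π b d → SameBlock π a b

blockSize : ∀ {N} → Partition N → Fin N → ℕ
blockSize {N} π m = countFin (λ i → blk π i ≡ m) (λ i → blk π i Fin.≟ m)

-- number of blocks whose size satisfies a decidable predicate
-- (blocks are counted via their minima m, i.e. blk π m ≡ m)
numBlocks : ∀ {N} → Partition N → (P : Pred ℕ 0ℓ) → Decidable P → ℕ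
numBlocks π P P? =
  countFin (λ m → (blk π m ≡ m) × P (blockSize π m))
           (λ m → (blk π m Fin.≟ m) ×-dec P? (blockSize π m))

module _ (k : ℕ) where

  bk′ : ∀ {N} → Partition N → ℕ
  bk′ π = numBlocks π (k ∣_) (k ∣?_)

  bkNot : ∀ {N} → Partition N → ℕ
  bkNot π = numBlocks π (λ x → ¬ (k ∣ x)) (λ x → ¬? (k ∣? x))

  bkOfSize : ∀ {N} → Partition N → ℕ → ℕ
  bkOfSize π i = numBlocks π (_≡ k * i) (ℕ._≟ k * i)

module _ (n k r : ℕ) where

  N : ℕ
  N = k * n + r

  InNCk : Partition N → Set
  InNCk π = Noncrossing π × bkNot k π ≡ 1

  rank : Partition N → ℕ
  rank π = n ∸ bk′ k π

  -- type^(k)(π) = (b; b_1,...,b_n), with bs = (b_1,...,b_n) (entry j is b_{j+1})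
  HasType : Partition N → ℕ → Vec ℕ n → Set
  HasType π b bs =
    bk′ k π ≡ b × (∀ (j : Fin n) → bkOfSize k π (suc (toℕ j)) ≡ Vec.lookup bs j)

  -- multichains π_1 ≤ ... ≤ π_ℓ in NC^(k)(n;r) (index i : Fin ℓ is π_{i+1})
  IsMultichain : (ℓ : ℕ) → (Fin ℓ → Partition N) → Set
  IsMultichain ℓ c = (∀ i → InNCk (c i)) × (∀ i j → i Fin.≤ j → c i ⊑ c j)

  diffs : ∀ {m} → Vec ℕ (suc m) → Vec ℕ m
  diffs (x ∷ []) = []
  diffs (x ∷ y ∷ xs) = (y ∸ x) ∷ diffs (y ∷ xs)

  rankJump : (ℓ : ℕ) → (Fin ℓ → Partition N) → Vec ℕ (suc ℓ)
  rankJump ℓ c = diffs (0 ∷ (tabulate (λ i → rank (c i)) ∷ʳ n))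

  _≈C_ : ∀ {ℓ} → (Fin ℓ → Partition N) → (Fin ℓ → Partition N) → Set
  c ≈C c′ = ∀ i → c i ≈P c′ i

  CountedChains : (ℓ : ℕ) → ℕ.zero ℕ.< ℓ → ℕ → Vec ℕ n → Vec ℕ (suc ℓ) → Set
  CountedChains ℓ 0<ℓ b bs s =
    Σ (Fin ℓ → Partition N) λ c →
      IsMultichain ℓ c × rankJump ℓ c ≡ s × HasType (c (fromℕ< 0<ℓ)) b bs

  SameChain : ∀ ℓ 0<ℓ b bs s → CountedChains ℓ 0<ℓ b bs s → CountedChains ℓ 0<ℓ b bs s → Set
  SameChain ℓ 0<ℓ b bs s x y = proj₁ x ≈C proj₁ y

factProd : ∀ {m} → Vec ℕ m → ℕ
factProd [] = 1
factProd (x ∷ xs) = x ! * factProd xs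

factProd≢0 : ∀ {m} (xs : Vec ℕ m) → NonZero (factProd xs)
factProd≢0 [] = _
factProd≢0 (x ∷ xs) = m*n≢0 (x !) (factProd xs) {{x !≢0}} {{factProd≢0 xs}}

multinomial : ∀ {m} → ℕ → Vec ℕ m → ℕ
multinomial b bs = (b ! / factProd bs) {{factProd≢0 bs}}

prod : ∀ {m} → Vec ℕ m → ℕ
prod = Vec.foldr _ _*_ 1

{-# OPTIONS --safe #-}
-- A chain is encoded by a table of block sizes: the entry in row t and column q is the size, divided by k,
-- of a block opened at the position q of the circle [kn+r] and still visible in π₁, …, πₜ but not beyond;
-- entry 0 means that no block is opened.  Walking round the circle, every position joins the block that was
-- opened last and is not yet full (at one position lower levels are opened later, hence are innermost).  In πⱼ it
-- belongs to the innermost unfinished block of level ≥ j, and to the special block if there is none.  The sizes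
-- add up to less than kn+r, so some position is left over (cycle lemma); cut open there, the walk becomes linear.
-- Conversely a block of π₁ is identified by its last element l, the coarsest level t at which l is still the last
-- element of its block, and the first element of that block of πₜ; this recovers the table.  A table is a choice of
-- sₜ₊₁ columns in each row t together with a word in the sizes with bᵢ letters i.
module Submission where

open import Defs
open import Data.Nat using (ℕ; zero; suc; _+_; _*_; _∸_; _≤_; _<_; z≤n; s≤s; z<s; s<s; _!; NonZero; >-nonZero; _≟_; _<?_; _≤?_)
open import Data.Nat.Properties
open import Data.Nat.Combinatorics using (_C_; nCk+nC[k+1]≡[n+1]C[k+1]; k>n⇒nCk≡0; nCk≡n!/k![n-k]!; k![n∸k]!∣n!)
open import Data.Nat.Divisibility using (_∣_; _∣?_; ∣m∣n⇒∣m+n; ∣m+n∣m⇒∣n; ∣⇒≤; _∣0; m∣m*n; n∣m*n)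
open import Data.Nat.DivMod using (_/_; _%_; _mod_; m%n<n; [m+n]%n≡m%n; [m+kn]%n≡m%n; m<n⇒m%n≡m; m≡m%n+[m/n]*n; m*n/n≡m; m/n*n≡m; +-distrib-/-∣ʳ; m<n*o⇒m/o<n)
open import Algebra.Properties.CommutativeSemigroup +-commutativeSemigroup using (interchange)
open import Data.Fin as Fin using (Fin; zero; suc; toℕ; fromℕ<)
open import Data.Fin.Properties as Fin using (toℕ-injective; toℕ<n; toℕ-fromℕ<; fromℕ<-cong; +↔⊎; *↔×; 1↔⊤)
open import Data.List as List using (List)
open import Data.Vec using (Vec; []; _∷_; sum; map; lookup; count; head; tail; zipWith; tabulate; _∷ʳ_; _++_; take; drop)
open import Data.Vec.Properties using (map-∘; map-id; map-cong; take++drop≡id; ++-injective; ∷-injective; lookup-map; lookup-zipWith; lookup∘tabulate; tabulate-cong)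
open import Data.Maybe as Maybe using (Maybe; just; nothing; fromMaybe; maybe)
open import Data.Maybe.Properties using (just-injective; ≡-dec)
open import Data.Product using (Σ; ∃; ∃-syntax; _×_; _,_; proj₁; proj₂)
open import Data.Product.Function.NonDependent.Propositional using (_×-cong_)
open import Data.Sum using (_⊎_; inj₁; inj₂)
open import Data.Sum.Function.Propositional using (_⊎-cong_)
open import Data.Unit using (⊤; tt)
open import Data.Bool using (if_then_else_; true; false)
open import Data.Empty using (⊥)
open import Function using (_∘_; id)
open import Function.Bundles using (_↔_; mk↔ₛ′; Inverse)
open import Function.Properties.Inverse using (↔-refl; ↔-sym; ↔-trans)
open import Relation.Nullary using (¬_; Dec; yes; no; does; contradiction)
open import Relation.Nullary.Decidable using (_×-dec_; ¬?; dec-true; dec-false; decidable-stable)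
open import Relation.Unary using (Pred; Decidable)
open import Relation.Binary.Definitions using (tri<; tri≈; tri>; DecidableEquality)
open import Relation.Binary.PropositionalEquality
open import Level using (0ℓ)

-- Masks, words and tables

-- The sizes in a table demand k Σ i bᵢ ≤ kn places in all, and kn < kn+r, so some position is
-- always left over. The table is repeated along ℕ and the run starts empty at 0. The first lap
-- misses the blocks that wrap around, so the partitions are read off the second lap; a leftover
-- position there separates what precedes it from what follows. No leftover position is preferred,
-- so the chain is defined without naming one and a cut enters only the proofs. For injectivity two
-- tables with the same chain need a common cut: the leftover positions form the special block of
-- π₁, recognised by its size. Blocks are identified by last elements because many slots may open at
-- one position, whereas a position is charged to only one slot. Where a slot receives its final
-- charge it is innermost for all the levels at which it is visible, so that position ends its block
-- in each of those partitions.

data Sel : ℕ → ℕ → Set where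
  []   : Sel 0 0
  omit : ∀ {m c} → Sel m c → Sel (suc m) c
  pick : ∀ {m c} → Sel m c → Sel (suc m) (suc c)

Sel-suc : ∀ m c → Sel (suc m) (suc c) ↔ (Sel m c ⊎ Sel m (suc c))
Sel-suc m c = mk↔ₛ′
  (λ { (omit s) → inj₂ s ; (pick s) → inj₁ s })
  (λ { (inj₁ s) → pick s ; (inj₂ s) → omit s })
  (λ { (inj₁ s) → refl ; (inj₂ s) → refl })
  (λ { (omit s) → refl ; (pick s) → refl })

fin-cong : ∀ {a b} → a ≡ b → Fin a ↔ Fin b
fin-cong refl = ↔-refl

-- `omit` and `pick` are the two summands of Pascal's rule, so masks are enumerated by the recursion
-- of the binomial coefficient.
Sel-enum : ∀ m c → Fin (m C c) ↔ Sel m c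
Sel-enum zero zero = mk↔ₛ′ (λ _ → []) (λ _ → zero) (λ { [] → refl }) (λ { zero → refl })
Sel-enum zero (suc c) = ↔-trans (fin-cong (k>n⇒nCk≡0 {0} {suc c} z<s))
  (mk↔ₛ′ (λ ()) (λ ()) (λ ()) (λ ()))
Sel-enum (suc m) zero = ↔-trans (Sel-enum m zero)
  (mk↔ₛ′ omit (λ { (omit s) → s }) (λ { (omit s) → refl }) (λ _ → refl))
Sel-enum (suc m) (suc c) =
  ↔-trans (fin-cong (sym (nCk+nC[k+1]≡[n+1]C[k+1] m c)))
  (↔-trans +↔⊎ (↔-trans (Sel-enum m c ⊎-cong Sel-enum m (suc c)) (↔-sym (Sel-suc m c))))

module _ {A : Set} where

  fill : ∀ {m c} → Sel m c → Vec A c → Vec (Maybe A) m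
  fill []       []       = []
  fill (omit s) w        = nothing ∷ fill s w
  fill (pick s) (x ∷ w)  = just x ∷ fill s w

  justs : ∀ {m} → Vec (Maybe A) m → ℕ
  justs []            = 0
  justs (nothing ∷ v) = justs v
  justs (just x ∷ v)  = suc (justs v)

  fill-injective : ∀ {m c} (s s′ : Sel m c) w w′ → fill s w ≡ fill s′ w′ → s ≡ s′ × w ≡ w′
  fill-injective [] [] [] [] _ = refl , refl
  fill-injective (omit s) (omit s′) w w′ eq
    with refl , refl ← fill-injective s s′ w w′ (proj₂ (∷-injective eq)) = refl , refl
  fill-injective (omit s) (pick s′) w (x ∷ w′) ()
  fill-injective (pick s) (omit s′) (x ∷ w) w′ ()
  fill-injective (pick s) (pick s′) (x ∷ w) (x′ ∷ w′) eq
    with refl ← just-injective (proj₁ (∷-injective eq))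
    with refl , refl ← fill-injective s s′ w w′ (proj₂ (∷-injective eq)) = refl , refl

  fill-surjective : ∀ {m} (v : Vec (Maybe A) m) →
    Σ (Sel m (justs v)) λ s → Σ (Vec A (justs v)) λ w → fill s w ≡ v
  fill-surjective [] = [] , [] , refl
  fill-surjective (nothing ∷ v) with s , w , eq ← fill-surjective v =
    omit s , w , cong (nothing ∷_) eq
  fill-surjective (just x ∷ v) with s , w , eq ← fill-surjective v =
    pick s , x ∷ w , cong (just x ∷_) eq

  fill-surjective′ : ∀ {m c} (v : Vec (Maybe A) m) → justs v ≡ c →
    Σ (Sel m c) λ s → Σ (Vec A c) λ w → fill s w ≡ v
  fill-surjective′ v refl = fill-surjective v

val : ∀ {n} → Maybe (Fin n) → ℕ
val nothing  = 0
val (just i) = suc (toℕ i)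

module _ {Q : Pred ℕ 0ℓ} (Q? : Decidable Q) (¬Q0 : ¬ Q 0) where

  count-fill : ∀ {n m c} (s : Sel m c) (w : Vec (Fin n) c) →
    count (Q? ∘ val) (fill s w) ≡ count (Q? ∘ suc ∘ toℕ) w
  count-fill [] [] = refl
  count-fill (omit s) w rewrite dec-false (Q? 0) ¬Q0 = count-fill s w
  count-fill (pick s) (x ∷ w) with does (Q? (suc (toℕ x)))
  ... | true  = cong suc (count-fill s w)
  ... | false = count-fill s w

count-cong : ∀ {A : Set} {P Q : Pred A 0ℓ} (P? : Decidable P) (Q? : Decidable Q) →
  (∀ x → does (P? x) ≡ does (Q? x)) → ∀ {m} (v : Vec A m) → count P? v ≡ count Q? v
count-cong P? Q? e [] = refl
count-cong P? Q? e (x ∷ v) rewrite e x = cong (if does (Q? x) then suc else id) (count-cong P? Q? e v)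

count-always : ∀ {A : Set} {P : Pred A 0ℓ} (P? : Decidable P) → (∀ x → P x) →
  ∀ {m} (v : Vec A m) → count P? v ≡ m
count-always P? p [] = refl
count-always P? p (x ∷ v) rewrite dec-true (P? x) (p x) = cong suc (count-always P? p v)

count-positive : ∀ {n m c} (s : Sel m c) (w : Vec (Fin n) c) →
  count (λ y → 0 <? val y) (fill s w) ≡ c
count-positive s w = trans (count-fill (0 <?_) (λ ()) s w) (count-always (λ x → 0 <? suc (toℕ x)) (λ _ → z<s) w)

count-zero : ∀ {n m c} (s : Sel m c) (w : Vec (Fin n) c) →
  count (λ y → val y ≟ 0) (fill s w) + c ≡ m
count-zero [] [] = refl
count-zero (omit s) w = cong suc (count-zero s w)
count-zero (pick s) (x ∷ w) = trans (+-suc _ _) (cong suc (count-zero s w))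

justs-positive : ∀ {n m} (v : Vec (Maybe (Fin n)) m) → justs v ≡ count (λ y → 0 <? val y) v
justs-positive [] = refl
justs-positive (nothing ∷ v) = justs-positive v
justs-positive (just x ∷ v) = cong suc (justs-positive v)

-- A multiset permutation, peeled one letter at a time: the mask picks the places that do not hold
-- the smallest letter, and the word in the other letters goes there. The multinomial coefficient
-- becomes a product of binomials.
Word : ∀ {n} → Vec ℕ n → Set
Word []       = ⊤
Word (b ∷ bs) = Sel (b + sum bs) (sum bs) × Word bs

#words : ∀ {n} → Vec ℕ n → ℕ
#words []       = 1
#words (b ∷ bs) = ((b + sum bs) C sum bs) * #words bs

Word-enum : ∀ {n} (bs : Vec ℕ n) → Fin (#words bs) ↔ Word bs
Word-enum []       = 1↔⊤
Word-enum (b ∷ bs) = ↔-trans *↔× (Sel-enum _ _ ×-cong Word-enum bs)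

ext : ∀ {n} → Maybe (Fin n) → Fin (suc n)
ext nothing  = zero
ext (just i) = suc i

unext : ∀ {n} → Fin (suc n) → Maybe (Fin n)
unext zero    = nothing
unext (suc i) = just i

ext-unext : ∀ {n} (i : Fin (suc n)) → ext (unext i) ≡ i
ext-unext zero    = refl
ext-unext (suc i) = refl

unext-ext : ∀ {n} (y : Maybe (Fin n)) → unext (ext y) ≡ y
unext-ext nothing  = refl
unext-ext (just i) = refl

letters : ∀ {n} {bs : Vec ℕ n} → Word bs → Vec (Fin n) (sum bs)
letters {bs = []}     _       = []
letters {bs = b ∷ bs} (s , w) = map ext (fill s (letters w))

letters-injective : ∀ {n} {bs : Vec ℕ n} (w w′ : Word bs) → letters w ≡ letters w′ → w ≡ w′
letters-injective {bs = []} tt tt _ = refl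
letters-injective {bs = b ∷ bs} (s , w) (s′ , w′) eq
  with fill-injective s s′ (letters w) (letters w′) fills≡
  where
  unmap : ∀ {n m} (v : Vec (Maybe (Fin n)) m) → map unext (map ext v) ≡ v
  unmap v = trans (sym (map-∘ unext ext v)) (trans (map-cong unext-ext v) (map-id v))
  fills≡ : fill s (letters w) ≡ fill s′ (letters w′)
  fills≡ = trans (sym (unmap _)) (trans (cong (map unext) eq) (unmap _))
... | refl , eq′ with refl ← letters-injective w w′ eq′ = refl

occurrences : ∀ {n m} → ℕ → Vec (Fin n) m → ℕ
occurrences j = count (λ x → toℕ x ≟ j)

occurrences-ext : ∀ {n m} j (v : Vec (Maybe (Fin n)) m) →
  occurrences j (map ext v) ≡ count (λ y → val y ≟ j) v
occurrences-ext j [] = refl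
occurrences-ext j (nothing ∷ v) with does (0 ≟ j)
... | true = cong suc (occurrences-ext j v)
... | false = occurrences-ext j v
occurrences-ext j (just x ∷ v) with does (suc (toℕ x) ≟ j)
... | true = cong suc (occurrences-ext j v)
... | false = occurrences-ext j v

occurrences-suc : ∀ {n m c} j (s : Sel m c) (w : Vec (Fin n) c) →
  occurrences (suc j) (map ext (fill s w)) ≡ occurrences j w
occurrences-suc j s w = trans (occurrences-ext (suc j) (fill s w)) (trans (count-fill (_≟ suc j) (λ ()) s w) (count-cong (λ x → suc (toℕ x) ≟ suc j) (λ x → toℕ x ≟ j) (λ _ → refl) w))

occurrences-zero : ∀ {n m c} (s : Sel m c) (w : Vec (Fin n) c) →
  occurrences 0 (map ext (fill s w)) + c ≡ m
occurrences-zero s w = trans (cong (_+ _) (occurrences-ext 0 (fill s w))) (count-zero s w)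

letters-occurrences : ∀ {n} {bs : Vec ℕ n} (w : Word bs) i → occurrences (toℕ i) (letters w) ≡ lookup bs i
letters-occurrences {bs = b ∷ bs} (s , w) zero = +-cancelʳ-≡ (sum bs) _ _ (occurrences-zero s (letters w))
letters-occurrences {bs = b ∷ bs} (s , w) (suc i) =
  trans (occurrences-suc (toℕ i) s (letters w)) (letters-occurrences w i)

letters-surjective : ∀ {n} (bs : Vec ℕ n) (v : Vec (Fin n) (sum bs)) →
  (∀ i → occurrences (toℕ i) v ≡ lookup bs i) → Σ (Word bs) λ w → letters w ≡ v
letters-surjective [] [] _ = tt , refl
letters-surjective (b ∷ bs) v occ
  with s , w , eq ← fill-surjective (map unext v) = go s w eq
       -- The length of the remaining word is known only as the number of nonblank places.
       -- Cancelling the `b` occurrences of the smallest letter identifies it with `sum bs`.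
       (+-cancelˡ-≡ b _ _ (trans (cong (_+ justs (map unext v)) (sym (occ zero)))
          (trans (cong (λ z → occurrences 0 z + justs (map unext v)) (sym (back s w eq))) (occurrences-zero s w))))
  where
  remap : ∀ {n m} (v : Vec (Fin (suc n)) m) → map ext (map unext v) ≡ v
  remap v = trans (sym (map-∘ ext unext v)) (trans (map-cong ext-unext v) (map-id v))
  back : ∀ {c} (s : Sel _ c) (w : Vec _ c) → fill s w ≡ map unext v → map ext (fill s w) ≡ v
  back s w eq = trans (cong (map ext) eq) (remap v)
  go : ∀ {c} (s : Sel _ c) (w : Vec _ c) → fill s w ≡ map unext v → c ≡ sum bs →
    Σ (Word (b ∷ bs)) λ w → letters w ≡ v
  go s w eq refl
    with w′ , refl ← letters-surjective bs w (λ i →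
           trans (sym (occurrences-suc (toℕ i) s w)) (trans (cong (occurrences (suc (toℕ i))) (back s w eq)) (occ (suc i))))
    = (s , w′) , back s _ eq

choose-factorials : ∀ b m → ((b + m) C m) * (b ! * m !) ≡ (b + m) !
choose-factorials b m = begin
  ((b + m) C m) * (b ! * m !)                ≡⟨ cong (((b + m) C m) *_) (*-comm (b !) (m !)) ⟩
  ((b + m) C m) * (m ! * b !)                ≡⟨ cong (λ z → ((b + m) C m) * (m ! * z !)) (sym (m+n∸n≡m b m)) ⟩
  ((b + m) C m) * (m ! * (b + m ∸ m) !)      ≡⟨ cong (_* (m ! * (b + m ∸ m) !)) (nCk≡n!/k![n-k]! m≤b+m) ⟩
  ((b + m) ! / (m ! * (b + m ∸ m) !)) * (m ! * (b + m ∸ m) !) ≡⟨ m/n*n≡m (k![n∸k]!∣n! m≤b+m) ⟩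
  (b + m) ! ∎
  where
  open ≡-Reasoning
  m≤b+m : m ≤ b + m
  m≤b+m = m≤n+m m b
  instance
    _ : NonZero (m ! * (b + m ∸ m) !)
    _ = m*n≢0 (m !) ((b + m ∸ m) !) {{m !≢0}} {{(b + m ∸ m) !≢0}}

#words-factProd : ∀ {n} (bs : Vec ℕ n) → #words bs * factProd bs ≡ sum bs !
#words-factProd [] = refl
#words-factProd (b ∷ bs) = begin
  c * w * (b ! * f)   ≡⟨ [m*n]*[o*p]≡[m*o]*[n*p] c w (b !) f ⟩
  c * b ! * (w * f)   ≡⟨ cong (c * b ! *_) (#words-factProd bs) ⟩
  c * b ! * sum bs !  ≡⟨ *-assoc c (b !) (sum bs !) ⟩
  c * (b ! * sum bs !) ≡⟨ choose-factorials b (sum bs) ⟩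
  (b + sum bs) ! ∎
  where
  open ≡-Reasoning
  c = (b + sum bs) C sum bs
  w = #words bs
  f = factProd bs

-- The quotient in `multinomial` is rounded down; it is exact because `#words bs` times the divisor
-- is the factorial.
#words≡multinomial : ∀ {n} (bs : Vec ℕ n) → #words bs ≡ multinomial (sum bs) bs
#words≡multinomial bs = trans (sym (m*n/n≡m (#words bs) (factProd bs) {{nz}}))
  (cong (λ z → (z / factProd bs) {{nz}}) (#words-factProd bs))
  where nz = factProd≢0 bs

module _ (N : ℕ) where

  Sels : ∀ {l} → Vec ℕ l → Set
  Sels []       = ⊤
  Sels (c ∷ cs) = Sel N c × Sels cs

  Sels-enum : ∀ {l} (cs : Vec ℕ l) → Fin (prod (map (N C_) cs)) ↔ Sels cs
  Sels-enum []       = 1↔⊤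
  Sels-enum (c ∷ cs) = ↔-trans *↔× (Sel-enum N c ×-cong Sels-enum cs)

module _ {N : ℕ} {A : Set} where

  -- A single word runs through all the rows, cut into pieces of lengths `cs`. The distribution of
  -- the sizes is thus independent of the choice of columns, which gives the count the form of a
  -- product.
  fills : ∀ {l} (cs : Vec ℕ l) → Sels N cs → Vec A (sum cs) → Vec (Vec (Maybe A) N) l
  fills []       _        w = []
  fills (c ∷ cs) (s , ss) w = fill s (take c w) ∷ fills cs ss (drop c w)

  fills-injective : ∀ {l} (cs : Vec ℕ l) ss ss′ w w′ → fills cs ss w ≡ fills cs ss′ w′ → ss ≡ ss′ × w ≡ w′
  fills-injective [] tt tt [] [] _ = refl , refl
  fills-injective (c ∷ cs) (s , ss) (s′ , ss′) w w′ eq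
    with eq₁ , eq₂ ← ∷-injective eq
    with refl , eq₃ ← fill-injective s s′ (take c w) (take c w′) eq₁
    with refl , eq₄ ← fills-injective cs ss ss′ (drop c w) (drop c w′) eq₂
    = refl , trans (sym (take++drop≡id c w)) (trans (cong₂ _++_ eq₃ eq₄) (take++drop≡id c w′))

  fills-surjective : ∀ {l} (cs : Vec ℕ l) (f : Vec (Vec (Maybe A) N) l) → map justs f ≡ cs →
    Σ (Sels N cs) λ ss → Σ (Vec A (sum cs)) λ w → fills cs ss w ≡ f
  fills-surjective [] [] _ = tt , [] , refl
  fills-surjective (c ∷ cs) (v ∷ f) eq
    with eq₁ , eq₂ ← ∷-injective eq
    with s , w , refl ← fill-surjective′ {c = c} v eq₁
    with ss , w′ , refl ← fills-surjective cs f eq₂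
    = (s , ss) , w ++ w′ , cong₂ _∷_ (cong (fill s) (proj₁ parts)) (cong (fills cs ss) (proj₂ parts))
    where
    parts = ++-injective (take c (w ++ w′)) w (take++drop≡id c (w ++ w′))

-- Tables with prescribed row counts and size counts

Table : ℕ → ℕ → ℕ → Set
Table n l N = Vec (Vec (Maybe (Fin n)) N) l

tableCount : ∀ {n l N} {Q : Pred ℕ 0ℓ} → Decidable Q → Table n l N → ℕ
tableCount Q? f = sum (map (count (Q? ∘ val)) f)

count-++ : ∀ {A : Set} {P : Pred A 0ℓ} (P? : Decidable P) {a b} (v : Vec A a) (w : Vec A b) →
  count P? (v ++ w) ≡ count P? v + count P? w
count-++ P? [] w = refl
count-++ P? (x ∷ v) w with does (P? x)
... | true  = cong suc (count-++ P? v w)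
... | false = count-++ P? v w

module _ {Q : Pred ℕ 0ℓ} (Q? : Decidable Q) (¬Q0 : ¬ Q 0) where

  tableCount-fills : ∀ {n l N} (cs : Vec ℕ l) (ss : Sels N cs) (w : Vec (Fin n) (sum cs)) →
    tableCount Q? (fills cs ss w) ≡ count (Q? ∘ suc ∘ toℕ) w
  tableCount-fills [] ss [] = refl
  tableCount-fills (c ∷ cs) (s , ss) w = begin
    count (Q? ∘ val) (fill s (take c w)) + tableCount Q? (fills cs ss (drop c w))
      ≡⟨ cong₂ _+_ (count-fill Q? ¬Q0 s (take c w)) (tableCount-fills cs ss (drop c w)) ⟩
    count P? (take c w) + count P? (drop c w) ≡⟨ count-++ P? (take c w) (drop c w) ⟨
    count P? (take c w ++ drop c w)           ≡⟨ cong (count P?) (take++drop≡id c w) ⟩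
    count P? w ∎
    where
    open ≡-Reasoning
    P? = Q? ∘ suc ∘ toℕ

positives : ∀ {n l N} → Table n l N → Vec ℕ l
positives = map (count (λ y → 0 <? val y))

positives-fills : ∀ {n l N} (cs : Vec ℕ l) (ss : Sels N cs) (w : Vec (Fin n) (sum cs)) →
  positives (fills cs ss w) ≡ cs
positives-fills [] _ _ = refl
positives-fills (c ∷ cs) (s , ss) w = cong₂ _∷_ (count-positive s (take c w)) (positives-fills cs ss (drop c w))

module _ {n l N : ℕ} (bs : Vec ℕ n) (cs : Vec ℕ l) (eq : sum bs ≡ sum cs) where

  Code : Set
  Code = Word bs × Sels N cs

  Code-enum : Fin (multinomial (sum bs) bs * prod (map (N C_) cs)) ↔ Code
  Code-enum = ↔-trans (fin-cong (cong (_* _) (sym (#words≡multinomial bs))))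
    (↔-trans *↔× (Word-enum bs ×-cong Sels-enum N cs))

  table : Code → Table n l N
  table (w , ss) = fills cs ss (subst (Vec (Fin n)) eq (letters w))

  table-injective : ∀ x y → table x ≡ table y → x ≡ y
  table-injective (w , ss) (w′ , ss′) t≡
    with refl , eq′ ← fills-injective cs ss ss′ _ _ t≡
    with refl ← letters-injective w w′ (subst-injective eq eq′) = refl

  HasCounts : Table n l N → Set
  HasCounts f = positives f ≡ cs × (∀ i → tableCount (_≟ suc (toℕ i)) f ≡ lookup bs i)

  subst-count : ∀ {A : Set} {P : Pred A 0ℓ} (P? : Decidable P) {a b} (a≡b : a ≡ b) (v : Vec A a) →
    count P? (subst (Vec A) a≡b v) ≡ count P? v
  subst-count P? refl v = refl

  suc-count : ∀ {m} i (v : Vec (Fin n) m) →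
    count (λ x → suc (toℕ x) ≟ suc (toℕ i)) v ≡ occurrences (toℕ {n} i) v
  suc-count i v = count-cong (λ x → suc (toℕ x) ≟ suc (toℕ i)) (λ x → toℕ x ≟ toℕ i) (λ _ → refl) v

  table-counts : ∀ x → HasCounts (table x)
  table-counts (w , ss) = positives-fills cs ss _ ,
    λ i → trans (tableCount-fills (_≟ suc (toℕ i)) (λ ()) cs ss (subst (Vec (Fin n)) eq (letters w)))
            (trans (suc-count i (subst (Vec (Fin n)) eq (letters w))) (trans (subst-count (λ x → toℕ x ≟ toℕ i) eq (letters w)) (letters-occurrences w i)))

  table-surjective : ∀ f → HasCounts f → Σ Code λ x → table x ≡ f
  table-surjective f (pos , occ)
    with ss , w , refl ← fills-surjective cs f (trans (map-cong justs-positive f) pos)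
    with w′ , eq′ ← letters-surjective bs (subst (Vec (Fin n)) (sym eq) w) (λ i →
           trans (subst-count (λ x → toℕ x ≟ toℕ i) (sym eq) w)
            (trans (sym (suc-count i w)) (trans (sym (tableCount-fills (_≟ suc (toℕ i)) (λ ()) cs ss w)) (occ i))))
    = (w′ , ss) , cong (fills cs ss) (trans (cong (subst (Vec (Fin n)) eq) eq′) (subst-subst-sym eq))

-- The labelling machine

_≟ᴹ_ : (a b : Maybe ℕ) → Dec (a ≡ b)
_≟ᴹ_ = ≡-dec _≟_

𝟙 : ∀ {P : Set} → Dec P → ℕ
𝟙 P? = if does P? then 1 else 0

𝟙-yes : ∀ {P : Set} (P? : Dec P) → P → 𝟙 P? ≡ 1
𝟙-yes P? p rewrite dec-true P? p = refl

𝟙-no : ∀ {P : Set} (P? : Dec P) → ¬ P → 𝟙 P? ≡ 0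
𝟙-no P? ¬p rewrite dec-false P? ¬p = refl

𝟙-cong : ∀ {P Q : Set} (P? : Dec P) (Q? : Dec Q) → (P → Q) → (Q → P) → 𝟙 P? ≡ 𝟙 Q?
𝟙-cong P? (yes q) f g = 𝟙-yes P? (g q)
𝟙-cong P? (no ¬q) f g = 𝟙-no P? (¬q ∘ f)

rangeSum : (ℕ → ℕ) → ℕ → ℕ → ℕ
rangeSum f lo zero    = 0
rangeSum f lo (suc n) = f lo + rangeSum f (suc lo) n

rangeSum-cong : ∀ {f g} lo n → (∀ x → lo ≤ x → x < lo + n → f x ≡ g x) → rangeSum f lo n ≡ rangeSum g lo n
rangeSum-cong lo zero    f≗g = refl
rangeSum-cong lo (suc n) f≗g = cong₂ _+_ (f≗g lo ≤-refl (m<m+n lo z<s))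
  (rangeSum-cong (suc lo) n λ x lo<x x< → f≗g x (<⇒≤ lo<x) (subst (x <_) (sym (+-suc lo n)) x<))

rangeSum-+ : ∀ f g lo n → rangeSum (λ x → f x + g x) lo n ≡ rangeSum f lo n + rangeSum g lo n
rangeSum-+ f g lo zero    = refl
rangeSum-+ f g lo (suc n) rewrite rangeSum-+ f g (suc lo) n =
  interchange (f lo) (g lo) _ _

rangeSum-∷ʳ : ∀ f lo n → rangeSum f lo (suc n) ≡ rangeSum f lo n + f (lo + n)
rangeSum-∷ʳ f lo zero = trans (+-identityʳ (f lo)) (cong f (sym (+-identityʳ lo)))
rangeSum-∷ʳ f lo (suc n) = begin
  f lo + rangeSum f (suc lo) (suc n)              ≡⟨ cong (f lo +_) (rangeSum-∷ʳ f (suc lo) n) ⟩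
  f lo + (rangeSum f (suc lo) n + f (suc lo + n)) ≡⟨ +-assoc (f lo) _ _ ⟨
  f lo + rangeSum f (suc lo) n + f (suc lo + n)   ≡⟨ cong (λ z → rangeSum f lo (suc n) + f z) (+-suc lo n) ⟨
  rangeSum f lo (suc n) + f (lo + suc n) ∎
  where open ≡-Reasoning

-- Moving the window by one place loses `f lo` and gains `f (lo + p)`, which are equal.
rangeSum-rotate : ∀ {f p} → (∀ x → f (x + p) ≡ f x) → ∀ lo → rangeSum f lo p ≡ rangeSum f 0 p
rangeSum-rotate per zero = refl
rangeSum-rotate {f} {p} per (suc lo) = trans (+-cancelˡ-≡ (f lo) _ _ (begin
  f lo + rangeSum f (suc lo) p   ≡⟨ rangeSum-∷ʳ f lo p ⟩
  rangeSum f lo p + f (lo + p)   ≡⟨ cong (rangeSum f lo p +_) (per lo) ⟩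
  rangeSum f lo p + f lo         ≡⟨ +-comm (rangeSum f lo p) (f lo) ⟩
  f lo + rangeSum f lo p ∎)) (rangeSum-rotate per lo)
  where open ≡-Reasoning

rangeSum-zero : ∀ {f} lo n → (∀ x → lo ≤ x → x < lo + n → f x ≡ 0) → rangeSum f lo n ≡ 0
rangeSum-zero lo zero    f≡0 = refl
rangeSum-zero lo (suc n) f≡0 rewrite f≡0 lo ≤-refl (m<m+n lo z<s) =
  rangeSum-zero (suc lo) n λ x lo<x x< → f≡0 x (<⇒≤ lo<x) (subst (x <_) (sym (+-suc lo n)) x<)

rangeSum-𝟙 : ∀ e lo n → lo ≤ e → e < lo + n → rangeSum (λ x → 𝟙 (just e ≟ᴹ just x)) lo n ≡ 1
rangeSum-𝟙 e lo zero    lo≤e e<lo = contradiction (subst (e <_) (+-identityʳ lo) e<lo) (≤⇒≯ lo≤e)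
rangeSum-𝟙 e lo (suc n) lo≤e e< with e ≟ lo
... | yes refl rewrite 𝟙-yes (just e ≟ᴹ just e) refl =
  cong suc (rangeSum-zero (suc e) n λ x e<x _ → 𝟙-no (just e ≟ᴹ just x) λ { refl → <-irrefl refl e<x })
... | no e≢lo rewrite 𝟙-no (just e ≟ᴹ just lo) (e≢lo ∘ just-injective) =
  rangeSum-𝟙 e (suc lo) n (≤∧≢⇒< lo≤e (e≢lo ∘ sym)) (subst (e <_) (+-suc lo n) e<)

rangeSum-pos : ∀ {P : Pred ℕ 0ℓ} (P? : Decidable P) lo n → 0 < rangeSum (𝟙 ∘ P?) lo n →
  ∃[ x ] lo ≤ x × x < lo + n × P x
rangeSum-pos P? lo (suc n) pos with P? lo
... | yes p = lo , ≤-refl , m<m+n lo z<s , p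
... | no _ with x , lo<x , x< , p ← rangeSum-pos P? (suc lo) n pos =
  x , <⇒≤ lo<x , subst (x <_) (sym (+-suc lo n)) x< , p

pos-rangeSum : ∀ {P : Pred ℕ 0ℓ} (P? : Decidable P) lo n {x} → lo ≤ x → x < lo + n → P x →
  0 < rangeSum (𝟙 ∘ P?) lo n
pos-rangeSum P? lo zero lo≤x x< p = contradiction (subst (_ <_) (+-identityʳ lo) x<) (≤⇒≯ lo≤x)
pos-rangeSum P? lo (suc n) {x} lo≤x x< p with lo ≟ x
... | yes refl rewrite 𝟙-yes (P? lo) p = z<s
... | no lo≢x = <-≤-trans (pos-rangeSum P? (suc lo) n (≤∧≢⇒< lo≤x lo≢x) (subst (x <_) (+-suc lo n) x<) p) (m≤n+m _ _)

module _ {P : Pred ℕ 0ℓ} (P? : Decidable P) where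

  greatest : ℕ → Maybe ℕ
  greatest zero    = nothing
  greatest (suc b) = if does (P? b) then just b else greatest b

  greatest-just : ∀ b {e} → greatest b ≡ just e →
    e < b × P e × (∀ e′ → e < e′ → e′ < b → ¬ P e′)
  greatest-just (suc b) eq with P? b
  greatest-just (suc b) refl | yes p = ≤-refl , p , λ e′ b<e′ e′≤b → contradiction e′≤b (<⇒≱ (s<s b<e′))
  greatest-just (suc b) {e} eq | no ¬p with e<b , p , max ← greatest-just b eq =
    m<n⇒m<1+n e<b , p , max′ max
    where
    max′ : (∀ e′ → e < e′ → e′ < b → ¬ P e′) → ∀ e′ → e < e′ → e′ < suc b → ¬ P e′
    max′ max e′ e<e′ e′<1+b with m<1+n⇒m<n∨m≡n e′<1+b
    ... | inj₁ e′<b = max e′ e<e′ e′<b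
    ... | inj₂ refl = ¬p

  greatest-nothing : ∀ b → greatest b ≡ nothing → ∀ e → e < b → ¬ P e
  greatest-nothing (suc b) eq e e<1+b with P? b
  ... | no ¬p with m<1+n⇒m<n∨m≡n e<1+b
  ...   | inj₁ e<b = greatest-nothing b eq e e<b
  ...   | inj₂ refl = ¬p

  greatest-complete : ∀ b {e} → e < b → P e → ∃[ e′ ] e ≤ e′ × greatest b ≡ just e′
  greatest-complete b {e} e<b p with greatest b in eq
  ... | nothing = contradiction p (greatest-nothing b eq e e<b)
  ... | just e′ with <-cmp e e′
  ...   | tri< e<e′ _ _ = e′ , <⇒≤ e<e′ , refl
  ...   | tri≈ _ refl _ = e′ , ≤-refl , refl
  ...   | tri> _ _ e′<e = contradiction p (proj₂ (proj₂ (greatest-just b eq)) e e′<e e<b)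

  greatest-intro : ∀ b {e} → e < b → P e → (∀ e′ → e < e′ → e′ < b → ¬ P e′) → greatest b ≡ just e
  greatest-intro b e<b p max with greatest-complete b e<b p
  ... | e′ , e≤e′ , eq with m≤n⇒m<n∨m≡n e≤e′
  ...   | inj₂ refl = eq
  ...   | inj₁ e<e′ with e′<b , p′ , _ ← greatest-just b eq = contradiction p′ (max e′ e<e′ e′<b)

-- Slot e belongs to position e / ℓ and initially holds h e; S x e is what it still holds when position x is
-- reached, and lab j x is the last slot of level ≥ j that is open there.  Position x is charged to lab 0 x.
module Machine (ℓ : ℕ) (lvl : ℕ → ℕ) (h : ℕ → ℕ) where

  opaque
    open-at : (ℕ → ℕ) → ℕ → ℕ → Maybe ℕ
    open-at s j x = greatest (λ e → (0 <? s e) ×-dec (j ≤? lvl e)) (suc x * ℓ)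

  S : ℕ → ℕ → ℕ
  S zero    e = h e
  S (suc x) e = S x e ∸ 𝟙 (open-at (S x) 0 x ≟ᴹ just e)

  lab : ℕ → ℕ → Maybe ℕ
  lab j x = open-at (S x) j x

  opaque
    unfolding open-at

    lab-just : ∀ {j x e} → lab j x ≡ just e → e < suc x * ℓ × 0 < S x e × j ≤ lvl e
    lab-just {j} {x} eq with e< , (pos , j≤) , _ ← greatest-just (λ e → (0 <? S x e) ×-dec (j ≤? lvl e)) (suc x * ℓ) eq = e< , pos , j≤

    lab-max : ∀ {j x e} → lab j x ≡ just e → ∀ {e′} → e < e′ → e′ < suc x * ℓ → j ≤ lvl e′ → S x e′ ≡ 0
    lab-max {j} {x} eq {e′} e<e′ e′< j≤ with S x e′ in s≡
    ... | zero  = refl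
    ... | suc _ = contradiction (subst (0 <_) (sym s≡) z<s , j≤)
      (proj₂ (proj₂ (greatest-just (λ e → (0 <? S x e) ×-dec (j ≤? lvl e)) (suc x * ℓ) eq)) e′ e<e′ e′<)

    lab-nothing : ∀ {j x} → lab j x ≡ nothing → ∀ {e} → e < suc x * ℓ → j ≤ lvl e → S x e ≡ 0
    lab-nothing {j} {x} eq {e} e< j≤ with S x e in s≡
    ... | zero  = refl
    ... | suc _ = contradiction (subst (0 <_) (sym s≡) z<s , j≤)
      (greatest-nothing (λ e → (0 <? S x e) ×-dec (j ≤? lvl e)) (suc x * ℓ) eq e e<)

    lab-complete : ∀ {j x e} → e < suc x * ℓ → 0 < S x e → j ≤ lvl e → ∃[ e′ ] e ≤ e′ × lab j x ≡ just e′
    lab-complete {j} {x} e< pos j≤ = greatest-complete (λ e → (0 <? S x e) ×-dec (j ≤? lvl e)) (suc x * ℓ) e< (pos , j≤)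

    lab-intro : ∀ {j x e} → e < suc x * ℓ → 0 < S x e → j ≤ lvl e →
      (∀ {e′} → e < e′ → e′ < suc x * ℓ → j ≤ lvl e′ → S x e′ ≡ 0) → lab j x ≡ just e
    lab-intro {j} {x} e< pos j≤ max = greatest-intro (λ e → (0 <? S x e) ×-dec (j ≤? lvl e)) (suc x * ℓ) e< (pos , j≤)
      λ e′ e<e′ e′< (pos′ , j≤′) → m<n⇒n≢0 pos′ (max e<e′ e′< j≤′)

  lab-none : ∀ {j x} → lab 0 x ≡ nothing → lab j x ≡ nothing
  lab-none {j} {x} eq with lab j x in eqⱼ
  ... | nothing = refl
  ... | just e with e< , pos , _ ← lab-just {j} eqⱼ = contradiction (lab-nothing {0} {x} eq e< z≤n) (m<n⇒n≢0 pos)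

  S-step : ∀ x e → S x e ≡ S (suc x) e + 𝟙 (lab 0 x ≟ᴹ just e)
  S-step x e with lab 0 x ≟ᴹ just e
  ... | no _   = sym (+-identityʳ _)
  ... | yes eq = sym (m∸n+n≡m (proj₁ (proj₂ (lab-just {0} {x} eq))))

  S-stay : ∀ {x e} → ¬ lab 0 x ≡ just e → S (suc x) e ≡ S x e
  S-stay {x} {e} ≢ rewrite 𝟙-no (lab 0 x ≟ᴹ just e) ≢ = refl

  S-suc : ∀ x e → S (suc x) e ≤ S x e
  S-suc x e = m∸n≤m (S x e) (𝟙 (lab 0 x ≟ᴹ just e))

  S-anti : ∀ {x y} e → x ≤ y → S y e ≤ S x e
  S-anti {x} {y} e x≤y with d , refl ← m≤n⇒∃[o]m+o≡n x≤y = go d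
    where
    go : ∀ d → S (x + d) e ≤ S x e
    go zero    = ≤-reflexive (cong (λ z → S z e) (+-identityʳ x))
    go (suc d) rewrite +-suc x d = ≤-trans (S-suc (x + d) e) (go d)

  S-pos : ∀ {x y e} → x ≤ y → 0 < S y e → 0 < S x e
  S-pos x≤y pos = <-≤-trans pos (S-anti _ x≤y)

  S-zero : ∀ {x y e} → x ≤ y → S x e ≡ 0 → S y e ≡ 0
  S-zero {e = e} x≤y eq = n≤0⇒n≡0 (subst (_ ≤_) eq (S-anti e x≤y))

  S-keep : ∀ {x y e} → x ≤ y → (∀ {z} → x ≤ z → z < y → ¬ lab 0 z ≡ just e) → S y e ≡ S x e
  S-keep {x} {y} {e} x≤y ≢ with d , refl ← m≤n⇒∃[o]m+o≡n x≤y = go d ≢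
    where
    go : ∀ d → (∀ {z} → x ≤ z → z < x + d → ¬ lab 0 z ≡ just e) → S (x + d) e ≡ S x e
    go zero    _ = cong (λ z → S z e) (+-identityʳ x)
    go (suc d) ≢ rewrite +-suc x d =
      trans (S-stay (≢ (m≤m+n x d) ≤-refl)) (go d λ x≤z z< → ≢ x≤z (m<n⇒m<1+n z<))

  -- Before position `x` only slots of earlier positions can be charged.
  S-untouched : ∀ x {e} → x * ℓ ≤ e → S x e ≡ h e
  S-untouched x {e} x≤e = S-keep {0} {x} {e} z≤n λ {z} _ z<x eq →
    <⇒≱ (proj₁ (lab-just {0} {z} eq)) (≤-trans (*-monoˡ-≤ ℓ z<x) x≤e)

  -- `S-step` telescopes. Over a stretch that contains the whole life of a slot, this turns its
  -- initial content into the size of its block in the finest partition.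
  S-count : ∀ e x n → rangeSum (λ y → 𝟙 (lab 0 y ≟ᴹ just e)) x n + S (x + n) e ≡ S x e
  S-count e x zero    = cong (λ z → S z e) (+-identityʳ x)
  S-count e x (suc n) = begin
    𝟙 d + r + S (x + suc n) e   ≡⟨ cong (λ z → 𝟙 d + r + S z e) (+-suc x n) ⟩
    𝟙 d + r + S (suc x + n) e   ≡⟨ +-assoc (𝟙 d) r _ ⟩
    𝟙 d + (r + S (suc x + n) e) ≡⟨ cong (𝟙 d +_) (S-count e (suc x) n) ⟩
    𝟙 d + S (suc x) e           ≡⟨ +-comm (𝟙 d) _ ⟩
    S (suc x) e + 𝟙 d           ≡⟨ S-step x e ⟨
    S x e ∎
    where
    open ≡-Reasoning
    d = lab 0 x ≟ᴹ just e
    r = rangeSum (λ y → 𝟙 (lab 0 y ≟ᴹ just e)) (suc x) n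

  slots-≤ : ∀ {x y e} → x ≤ y → e < suc x * ℓ → e < suc y * ℓ
  slots-≤ x≤y e< = <-≤-trans e< (*-monoˡ-≤ ℓ (s≤s x≤y))

  -- The open slots of level ≥ j behave like a stack. A slot that is a label again later was open
  -- throughout in between; if the label of `b` and `d` is the later slot it takes precedence at
  -- `c`, and if that of `a` and `c` is the later one it takes precedence at `b`.
  lab-noncrossing : ∀ j {a b c d} → a ≤ b → b ≤ c → c ≤ d →
    lab j a ≡ lab j c → lab j b ≡ lab j d → lab j a ≡ lab j b
  lab-noncrossing j {a} {b} {c} {d} a≤b b≤c c≤d ac bd with lab j a in ea | lab j b in eb
  ... | nothing | nothing = refl
  ... | just β  | nothing
    with β< , _ , j≤ ← lab-just {j} {a} ea | _ , pos , _ ← lab-just {j} {c} (sym ac)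
    = contradiction (lab-nothing {j} {b} eb (slots-≤ a≤b β<) j≤) (m<n⇒n≢0 (S-pos b≤c pos))
  ... | nothing | just δ
    with δ< , _ , j≤ ← lab-just {j} {b} eb | _ , pos , _ ← lab-just {j} {d} (sym bd)
    = contradiction (lab-nothing {j} {c} (sym ac) (slots-≤ b≤c δ<) j≤) (m<n⇒n≢0 (S-pos c≤d pos))
  ... | just β  | just δ
    with β< , _ , j≤β ← lab-just {j} {a} ea | _ , posβ , _ ← lab-just {j} {c} (sym ac)
       | δ< , _ , j≤δ ← lab-just {j} {b} eb | _ , posδ , _ ← lab-just {j} {d} (sym bd)
    with <-cmp β δ
  ...   | tri≈ _ refl _ = refl
  ...   | tri< β<δ _ _ = contradiction (lab-max {j} {c} (sym ac) β<δ (slots-≤ b≤c δ<) j≤δ) (m<n⇒n≢0 (S-pos c≤d posδ))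
  ...   | tri> _ _ δ<β = contradiction (lab-max {j} {b} eb δ<β (slots-≤ a≤b β<) j≤β) (m<n⇒n≢0 (S-pos b≤c posβ))

  -- Let `β` be the common label. A `j′`-label cannot come after `β`, since it would be visible at
  -- level `j` as well. While `β` is unfinished no slot before it is charged, so those open at `x`
  -- are still open at `y`, and the choice at level `j′` is the same.
  lab-coarsen : ∀ {j j′ x y} → j ≤ j′ → x ≤ y → lab j x ≡ lab j y → lab j′ x ≡ lab j′ y
  lab-coarsen {j} {j′} {x} {y} j≤j′ x≤y eq with lab j x in ex | lab j′ x in ex′ | lab j′ y in ey′
  ... | _ | nothing | nothing = refl
  ... | nothing | just γ | _ with γ< , pos , j′≤ ← lab-just {j′} ex′ =
    contradiction (lab-nothing {j} ex γ< (≤-trans j≤j′ j′≤)) (m<n⇒n≢0 pos)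
  ... | nothing | nothing | just γ with γ< , pos , j′≤ ← lab-just {j′} ey′ =
    contradiction (lab-nothing {j} (sym eq) γ< (≤-trans j≤j′ j′≤)) (m<n⇒n≢0 pos)
  ... | just β | exγ | eyγ
    with β<x , _ , _ ← lab-just {j} {x} ex | _ , posβ , _ ← lab-just {j} {y} (sym eq) = go exγ eyγ ex′ ey′
    where
    below : ∀ {γ} → ¬ β < γ → 0 < S x γ → 0 < S y γ
    below {γ} ≯ pos with m≤n⇒m<n∨m≡n (≮⇒≥ ≯)
    ... | inj₂ refl = posβ
    ... | inj₁ γ<β = subst (0 <_) (sym (S-keep x≤y stays)) pos
      where
      stays : ∀ {z} → x ≤ z → z < y → ¬ lab 0 z ≡ just γ
      stays x≤z z<y eqz
        with e′ , β≤e′ , eqz′ ← lab-complete {0} (slots-≤ x≤z β<x) (S-pos (<⇒≤ z<y) posβ) z≤n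
        with refl ← trans (sym eqz) eqz′ = <⇒≱ γ<β β≤e′
    notAboveˣ : ∀ {γ} → lab j′ x ≡ just γ → ¬ β < γ
    notAboveˣ ex′ β<γ with γ< , pos , j′≤ ← lab-just {j′} ex′ =
      m<n⇒n≢0 pos (lab-max {j} ex β<γ γ< (≤-trans j≤j′ j′≤))
    notAboveʸ : ∀ {γ} → lab j′ y ≡ just γ → ¬ β < γ
    notAboveʸ ey′ β<γ with γ< , pos , j′≤ ← lab-just {j′} ey′ =
      m<n⇒n≢0 pos (lab-max {j} (sym eq) β<γ γ< (≤-trans j≤j′ j′≤))
    go : ∀ m m′ → lab j′ x ≡ m → lab j′ y ≡ m′ → m ≡ m′
    go nothing nothing _ _ = refl
    go nothing (just γ) ex′ ey′ with _ , pos , j′≤ ← lab-just {j′} ey′ =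
      contradiction (lab-nothing {j′} ex′ (≤-<-trans (≮⇒≥ (notAboveʸ ey′)) β<x) j′≤) (m<n⇒n≢0 (S-pos x≤y pos))
    go (just γ) nothing ex′ ey′ with γ< , pos , j′≤ ← lab-just {j′} ex′ =
      contradiction (lab-nothing {j′} ey′ (slots-≤ x≤y γ<) j′≤) (m<n⇒n≢0 (below (notAboveˣ ex′) pos))
    go (just γ) (just γ′) ex′ ey′
      with γ< , pos , j′≤ ← lab-just {j′} ex′ | _ , pos′ , j′≤′ ← lab-just {j′} ey′
      with <-cmp γ γ′
    ... | tri≈ _ refl _ = refl
    ... | tri< γ<γ′ _ _ = contradiction
      (lab-max {j′} ex′ γ<γ′ (≤-<-trans (≮⇒≥ (notAboveʸ ey′)) β<x) j′≤′) (m<n⇒n≢0 (S-pos x≤y pos′))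
    ... | tri> _ _ γ′<γ = contradiction
      (lab-max {j′} ey′ γ′<γ (slots-≤ x≤y γ<) j′≤) (m<n⇒n≢0 (below (notAboveˣ ex′) pos))

  Clean : ℕ → Set
  Clean A = ∀ {e} → e < A * ℓ → S A e ≡ 0

  nothing⇒Clean : ∀ {z} → lab 0 z ≡ nothing → Clean (suc z)
  nothing⇒Clean {z} eq e< = S-zero (n≤1+n z) (lab-nothing {0} {z} eq e< z≤n)

  Clean-lab : ∀ {A j x e} → Clean A → A ≤ x → lab j x ≡ just e → A * ℓ ≤ e
  Clean-lab {A} {j} {x} {e} clean A≤x eq = ≮⇒≥ λ e< →
    m<n⇒n≢0 (proj₁ (proj₂ (lab-just {j} eq))) (S-zero A≤x (clean e<))

  -- The position where `e` receives its final charge. By `anchor-lab` and `past-anchor` it is the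
  -- last position labelled `e` at every level up to that of `e`, which ties the slot to an element
  -- visible in the partitions.
  anchor : ∀ {x y e} → x ≤ y → 0 < S x e → S y e ≡ 0 → ∃[ l ] x ≤ l × l < y × S (suc l) e ≡ 0 × lab 0 l ≡ just e
  anchor {x} {y} {e} x≤y pos zer with d , refl ← m≤n⇒∃[o]m+o≡n x≤y = go d zer
    where
    go : ∀ d → S (x + d) e ≡ 0 → ∃[ l ] x ≤ l × l < x + d × S (suc l) e ≡ 0 × lab 0 l ≡ just e
    go zero zer = contradiction (trans (cong (λ z → S z e) (sym (+-identityʳ x))) zer) (m<n⇒n≢0 pos)
    go (suc d) zer rewrite +-suc x d with S (x + d) e in eq
    ... | zero with l , x≤l , l< , r ← go d eq = l , x≤l , m<n⇒m<1+n l< , r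
    ... | suc s with lab 0 (x + d) ≟ᴹ just e
    ...   | yes le = x + d , m≤m+n x d , ≤-refl ,
             trans (cong₂ _∸_ eq (𝟙-yes (lab 0 (x + d) ≟ᴹ just e) le)) zer , le
    ...   | no _ with () ← zer

  anchor-lab : ∀ {j l e} → lab 0 l ≡ just e → j ≤ lvl e → lab j l ≡ just e
  anchor-lab {j} eq j≤ with e< , pos , _ ← lab-just {0} eq =
    lab-intro {j} e< pos j≤ λ e<e′ e′< _ → lab-max {0} eq e<e′ e′< z≤n

  past-anchor : ∀ {j l x e} → S (suc l) e ≡ 0 → lab j x ≡ just e → x ≤ l
  past-anchor {j} {l} zer eq = ≮⇒≥ λ l<x → m<n⇒n≢0 (proj₁ (proj₂ (lab-just {j} eq))) (S-zero l<x zer)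

  -- The content of the slots of the window is a potential that drops by one at every labelled
  -- position. The charged slot does lie in the window: a clean start leaves nothing open to its
  -- left, and `i ≤ N` bounds it on the right.
  pigeonhole : ∀ {A N} → Clean A → ∀ i → i ≤ N →
    (∃[ z ] A ≤ z × z < A + i × lab 0 z ≡ nothing) ⊎
    (rangeSum (S (A + i)) (A * ℓ) (N * ℓ) + i ≡ rangeSum (S A) (A * ℓ) (N * ℓ))
  pigeonhole {A} {N} clean zero _ =
    inj₂ (trans (+-identityʳ _) (cong (λ z → rangeSum (S z) (A * ℓ) (N * ℓ)) (+-identityʳ A)))
  pigeonhole {A} {N} clean (suc i) i<N rewrite +-suc A i with pigeonhole clean i (<⇒≤ i<N)
  ... | inj₁ (z , A≤z , z< , eq) = inj₁ (z , A≤z , m<n⇒m<1+n z< , eq)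
  ... | inj₂ total = step (lab 0 (A + i)) refl
    where
    open ≡-Reasoning
    sumS = λ x → rangeSum (S x) (A * ℓ) (N * ℓ)
    step : ∀ m → lab 0 (A + i) ≡ m →
      (∃[ z ] A ≤ z × z < suc (A + i) × lab 0 z ≡ nothing) ⊎ (sumS (suc (A + i)) + suc i ≡ sumS A)
    step nothing eq = inj₁ (A + i , m≤m+n A i , ≤-refl , eq)
    step (just e) eq = inj₂ (begin
      sumS (suc (A + i)) + suc i                  ≡⟨ +-assoc (sumS (suc (A + i))) 1 i ⟨
      sumS (suc (A + i)) + 1 + i
        ≡⟨ cong (λ z → sumS (suc (A + i)) + z + i) (rangeSum-𝟙 e (A * ℓ) (N * ℓ) (Clean-lab clean (m≤m+n A i) eq) e<) ⟨
      sumS (suc (A + i)) + rangeSum hit (A * ℓ) (N * ℓ) + i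
        ≡⟨ cong (_+ i) (rangeSum-+ (S (suc (A + i))) hit (A * ℓ) (N * ℓ)) ⟨
      rangeSum (λ e′ → S (suc (A + i)) e′ + hit e′) (A * ℓ) (N * ℓ) + i
        ≡⟨ cong (_+ i) (rangeSum-cong (A * ℓ) (N * ℓ) λ e′ _ _ →
             trans (cong (λ m → S (suc (A + i)) e′ + 𝟙 (m ≟ᴹ just e′)) (sym eq)) (sym (S-step (A + i) e′))) ⟩
      sumS (A + i) + i                            ≡⟨ total ⟩
      sumS A ∎)
      where
      hit = λ e′ → 𝟙 (just e ≟ᴹ just e′)
      e< : e < A * ℓ + N * ℓ
      e< = <-≤-trans (proj₁ (lab-just eq)) (≤-trans (*-monoˡ-≤ ℓ (≤-trans (≤-reflexive (sym (+-suc A i))) (+-monoʳ-≤ A i<N)))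
             (≤-reflexive (*-distribʳ-+ ℓ A N)))

  module Periodic (N : ℕ) (h-per : ∀ e → h (e + N * ℓ) ≡ h e) (lvl-per : ∀ e → lvl (e + N * ℓ) ≡ lvl e) where

    M = N * ℓ

    slots-shift : ∀ x → suc (x + N) * ℓ ≡ suc x * ℓ + M
    slots-shift x = *-distribʳ-+ ℓ (suc x) N

    slot-split : ∀ {e b} → b + M ≤ e → ∃[ d ] d + M ≡ e × b ≤ d
    slot-split {e} {b} le with d , refl ← m≤n⇒∃[o]m+o≡n le =
      b + d , trans (+-assoc b d M) (trans (cong (b +_) (+-comm d M)) (sym (+-assoc b M d))) , m≤m+n b d

    private
      Shifted : ℕ → Set
      Shifted x = ∀ e → S (x + N) (e + M) ≡ S x e

      lab-up : ∀ {x} → Shifted x → ∀ {j e} → lab j x ≡ just e → lab j (x + N) ≡ just (e + M)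
      lab-up {x} sh {j} {e} eq with e< , pos , j≤ ← lab-just eq =
        lab-intro (subst (e + M <_) (sym (slots-shift x)) (+-monoˡ-< M e<)) (subst (0 <_) (sym (sh e)) pos)
          (subst (j ≤_) (sym (lvl-per e)) j≤) max
        where
        max : ∀ {e′} → e + M < e′ → e′ < suc (x + N) * ℓ → j ≤ lvl e′ → S (x + N) e′ ≡ 0
        max lt e′< j≤′ with d , refl , e<d ← slot-split {b = suc e} lt =
          trans (sh d) (lab-max eq e<d (+-cancelʳ-< M d _ (subst (d + M <_) (slots-shift x) e′<)) (subst (j ≤_) (lvl-per d) j≤′))

      lab-down : ∀ {x} → Shifted x → ∀ {j e} → lab j (x + N) ≡ just (e + M) → lab j x ≡ just e
      lab-down {x} sh {j} {e} eq with e< , pos , j≤ ← lab-just eq =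
        lab-intro (+-cancelʳ-< M e _ (subst (e + M <_) (slots-shift x) e<)) (subst (0 <_) (sh e) pos)
          (subst (j ≤_) (lvl-per e) j≤) λ {e′} e<e′ e′< j≤′ →
            trans (sym (sh e′)) (lab-max eq (+-monoˡ-< M e<e′) (subst (e′ + M <_) (sym (slots-shift x)) (+-monoˡ-< M e′<))
              (subst (j ≤_) (sym (lvl-per e′)) j≤′))

    -- Slots of position ≥ N take precedence over all earlier ones, so they evolve as if the run started at N.
    S-shift : ∀ x e → S (x + N) (e + M) ≡ S x e
    S-shift zero e = trans (S-untouched N (m≤n+m M e)) (h-per e)
    S-shift (suc x) e = cong₂ _∸_ (S-shift x e)
      (𝟙-cong (lab 0 (x + N) ≟ᴹ just (e + M)) (lab 0 x ≟ᴹ just e) (lab-down (S-shift x)) (lab-up (S-shift x)))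

    lab-shift : ∀ {j x e} → lab j x ≡ just e → lab j (x + N) ≡ just (e + M)
    lab-shift {x = x} = lab-up (S-shift x)

    lab-unshift : ∀ {j x e} → lab j (x + N) ≡ just (e + M) → lab j x ≡ just e
    lab-unshift {x = x} = lab-down (S-shift x)

    nothing-unshift : ∀ {j x} → lab j (x + N) ≡ nothing → lab j x ≡ nothing
    nothing-unshift {j} {x} eq with lab j x in eqx
    ... | nothing = refl
    ... | just e with () ← trans (sym eq) (lab-shift eqx)

    -- Labels always move up by a lap, but an unlabelled `x` may meet at `x + N` a slot left open
    -- from the previous lap. Cleanness at `A + N` excludes this.
    lab-shift-clean : ∀ {A} → Clean (A + N) → ∀ {j x} → A ≤ x → lab j (x + N) ≡ Maybe.map (_+ M) (lab j x)
    lab-shift-clean {A} clean {j} {x} A≤x with lab j x in eqx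
    ... | just e = lab-shift eqx
    ... | nothing with lab j (x + N) in eq
    ...   | nothing = refl
    ...   | just e with d , refl , _ ← slot-split {b = 0} (≤-trans (≤-trans (m≤n+m M (A * ℓ)) (≤-reflexive (sym (*-distribʳ-+ ℓ A N))))
                                          (Clean-lab clean (+-monoˡ-≤ N A≤x) eq))
      with () ← trans (sym eqx) (lab-unshift {j} {x} eq)

    module _ (demand< : rangeSum h 0 M < N) where

      next-nothing : ∀ {A} → Clean A → ∃[ z ] A ≤ z × z < A + N × lab 0 z ≡ nothing
      next-nothing {A} clean with pigeonhole {A} {N} clean N ≤-refl
      ... | inj₁ found = found
      -- Otherwise all `N` positions were served, while the slots of the window hold the demand of
      -- one period, which is less than `N`.
      ... | inj₂ total = contradiction demand< (≤⇒≯ (≤-trans (m≤n+m N _) (≤-reflexive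
        (trans total (trans (rangeSum-cong (A * ℓ) M λ e A≤e _ → S-untouched A A≤e) (rangeSum-rotate h-per (A * ℓ)))))))

      -- If the position found is `m` itself, then all earlier slots are used up, and the pigeonhole
      -- argument starts afresh at `suc m`.
      nothing-from : ∀ m → ∃[ z ] m ≤ z × z < m + N × lab 0 z ≡ nothing
      nothing-from zero = next-nothing {0} λ ()
      nothing-from (suc m) with z , m≤z , z< , eq ← nothing-from m with m≤n⇒m<n∨m≡n m≤z
      ... | inj₁ m<z  = z , m<z , m<n⇒m<1+n z< , eq
      ... | inj₂ refl = next-nothing (nothing⇒Clean eq)

-- Recovering the sizes from the labels

module _ {ℓ : ℕ} {lvl : ℕ → ℕ}
  (lvl-anti : ∀ q {e e′} → q * ℓ ≤ e → e < e′ → e′ < suc q * ℓ → lvl e′ < lvl e) where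

  slot-unique : ∀ q {e e′} → q * ℓ ≤ e → e < suc q * ℓ → q * ℓ ≤ e′ → e′ < suc q * ℓ → lvl e ≡ lvl e′ → e ≡ e′
  slot-unique q {e} {e′} q≤e e< q≤e′ e′< lvl≡ with <-cmp e e′
  ... | tri≈ _ e≡e′ _ = e≡e′
  ... | tri< e<e′ _ _ = contradiction (sym lvl≡) (<⇒≢ (lvl-anti q q≤e e<e′ e′<))
  ... | tri> _ _ e′<e = contradiction lvl≡ (<⇒≢ (lvl-anti q q≤e′ e′<e e<))

  module _ (h : ℕ → ℕ) where
    open Machine ℓ lvl h

    -- The slots that follow `e` at its own position have smaller levels, so none of them hides `e`
    -- from level `lvl e`. This makes the position of a nonempty slot visible in the chain.
    lab-first : ∀ q {e} → q * ℓ ≤ e → e < suc q * ℓ → 0 < h e → lab (lvl e) q ≡ just e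
    lab-first q q≤e e< pos = lab-intro e< (subst (0 <_) (sym (S-untouched q q≤e)) pos) ≤-refl
      λ e<e′ e′< lvl≤ → contradiction lvl≤ (<⇒≱ (lvl-anti q q≤e e<e′ e′<))

  -- The slot of a block is read off the chain: its position is the first element at the
  -- level of the slot, and that level is the coarsest one with the same last element.
  module _ (pos-of : ∀ e → ∃[ q ] q * ℓ ≤ e × e < suc q * ℓ) {J : ℕ} (lvl≤J : ∀ e → lvl e ≤ J) (h h′ : ℕ → ℕ) where
    private
      module H = Machine ℓ lvl h
      module H′ = Machine ℓ lvl h′

    demand-unique : ∀ {A N} → H.Clean A → H′.Clean A → H.Clean (A + suc N) → H′.Clean (A + suc N) →
      H.lab 0 (A + N) ≡ nothing → H′.lab 0 (A + N) ≡ nothing →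
      (∀ {j x y} → j ≤ J → A ≤ x → x < A + suc N → A ≤ y → y < A + suc N → H.lab j x ≡ H.lab j y → H′.lab j x ≡ H′.lab j y) →
      (∀ {j x y} → j ≤ J → A ≤ x → x < A + suc N → A ≤ y → y < A + suc N → H′.lab j x ≡ H′.lab j y → H.lab j x ≡ H.lab j y) →
      ∀ {e} → A * ℓ ≤ e → e < (A + suc N) * ℓ → 0 < h e → h′ e ≡ h e
    demand-unique {A} {N} clA clA′ clB clB′ nz nz′ to from {e} A≤e e<B pos = result
      where
      B = A + suc N
      z<B : A + N < B
      z<B = +-monoʳ-< A ≤-refl
      A≤z = m≤m+n A N
      q = proj₁ (pos-of e)
      q≤e : q * ℓ ≤ e
      q≤e = proj₁ (proj₂ (pos-of e))
      e<q : e < suc q * ℓ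
      e<q = proj₂ (proj₂ (pos-of e))
      A≤q : A ≤ q
      A≤q = ≮⇒≥ λ q<A → <⇒≱ e<q (≤-trans (*-monoˡ-≤ ℓ q<A) A≤e)
      q<B : q < B
      q<B = ≰⇒> λ B≤q → <⇒≱ e<B (≤-trans (*-monoˡ-≤ ℓ B≤q) q≤e)
      t = lvl e
      lq : H.lab t q ≡ just e
      lq = lab-first h q q≤e e<q pos
      Sq : 0 < H.S q e
      Sq = proj₁ (proj₂ (H.lab-just lq))
      anc = H.anchor (<⇒≤ q<B) Sq (clB e<B)
      l = proj₁ anc
      q≤l = proj₁ (proj₂ anc)
      l<B = proj₁ (proj₂ (proj₂ anc))
      A≤l = ≤-trans A≤q q≤l
      end-l = proj₁ (proj₂ (proj₂ (proj₂ anc)))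
      l0 : H.lab 0 l ≡ just e
      l0 = proj₂ (proj₂ (proj₂ (proj₂ anc)))
      lt : H.lab t l ≡ just e
      lt = H.anchor-lab l0 ≤-refl

      -- `e′` names in the second run the level-`t` block of `q`. Both runs agree on the last
      -- element of this block, so `l` receives the final charge of `e` in one run and of `e′` in
      -- the other.
      after : ∀ e′ → H′.lab t q ≡ just e′ → h′ e ≡ h e
      after e′ lq′ = sizes
        where
        e′-lab = H′.lab-just lq′
        t≤ : t ≤ lvl e′
        t≤ = proj₂ (proj₂ e′-lab)
        Sq′ = proj₁ (proj₂ e′-lab)
        A≤e′ : A * ℓ ≤ e′
        A≤e′ = H′.Clean-lab clA′ A≤q lq′
        e′<B : e′ < B * ℓ
        e′<B = <-≤-trans (proj₁ e′-lab) (*-monoˡ-≤ ℓ q<B)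
        q′ = proj₁ (pos-of e′)
        q′≤e′ = proj₁ (proj₂ (pos-of e′))
        e′<q′ = proj₂ (proj₂ (pos-of e′))
        q′≤q : q′ ≤ q
        q′≤q = ≮⇒≥ λ q<q′ → <⇒≱ (proj₁ e′-lab) (≤-trans (*-monoˡ-≤ ℓ q<q′) q′≤e′)
        A≤q′ : A ≤ q′
        A≤q′ = ≮⇒≥ λ q′<A → <⇒≱ e′<q′ (≤-trans (*-monoˡ-≤ ℓ q′<A) A≤e′)
        anc′ = H′.anchor (<⇒≤ q<B) Sq′ (clB′ e′<B)
        l′ = proj₁ anc′
        l′<B = proj₁ (proj₂ (proj₂ anc′))
        A≤l′ = ≤-trans A≤q (proj₁ (proj₂ anc′))
        end-l′ = proj₁ (proj₂ (proj₂ (proj₂ anc′)))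
        l0′ : H′.lab 0 l′ ≡ just e′
        l0′ = proj₂ (proj₂ (proj₂ (proj₂ anc′)))
        l′≤l : l′ ≤ l
        l′≤l = H.past-anchor end-l (trans (from (lvl≤J e) A≤l′ l′<B A≤q q<B
          (trans (H′.anchor-lab l0′ t≤) (sym lq′))) lq)
        l≤l′ : l ≤ l′
        l≤l′ = H′.past-anchor end-l′ (trans (to (lvl≤J e) A≤l l<B A≤q q<B (trans lt (sym lq))) lq′)
        l≡l′ : l′ ≡ l
        l≡l′ = ≤-antisym l′≤l l≤l′
        ll′ : H′.lab 0 l ≡ just e′
        ll′ = subst (λ x → H′.lab 0 x ≡ just e′) l≡l′ l0′

        -- If `e′` had a coarser level, then `l` would end its block at that level too. In the first
        -- run the slot of that block would also have its final charge at `l`; but the slot charged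
        -- there is `e`, which is not visible at that level.
        not-above : ¬ t < lvl e′
        not-above t<t′ = go (H.lab (lvl e′) l) refl
          where
          same : H′.lab (lvl e′) l ≡ just e′
          same = H′.anchor-lab ll′ ≤-refl
          go : ∀ m → H.lab (lvl e′) l ≡ m → ⊥
          go nothing eq with () ← trans (sym same) (trans (to (lvl≤J e′) A≤l l<B A≤z z<B
            (trans eq (sym (H.lab-none nz)))) (H′.lab-none nz′))
          go (just e″) eq = <⇒≱ (<-≤-trans t<t′ (proj₂ (proj₂ (H.lab-just eq)))) (≤-reflexive (cong lvl e″≡e))
            where
            anc″ = H.anchor {l} {B} {e″} (<⇒≤ l<B) (proj₁ (proj₂ (H.lab-just eq)))
              (clB (<-≤-trans (proj₁ (H.lab-just eq)) (*-monoˡ-≤ ℓ l<B)))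
            l″ = proj₁ anc″
            l≤l″ = proj₁ (proj₂ anc″)
            l0″ : H.lab 0 l″ ≡ just e″
            l0″ = proj₂ (proj₂ (proj₂ (proj₂ anc″)))
            l″≤l : l″ ≤ l
            l″≤l = subst (l″ ≤_) l≡l′ (H′.past-anchor end-l′ (trans
              (to (lvl≤J e′) (≤-trans A≤l l≤l″) (proj₁ (proj₂ (proj₂ anc″))) A≤l l<B
                (trans (H.anchor-lab l0″ (proj₂ (proj₂ (H.lab-just eq)))) (sym eq))) same))
            e″≡e : e″ ≡ e
            e″≡e = just-injective (trans (sym l0″) (trans (cong (H.lab 0) (≤-antisym l″≤l l≤l″)) l0))

        t≡ : lvl e ≡ lvl e′
        t≡ = ≤-antisym t≤ (≮⇒≥ not-above)
        -- `q′` belongs to the level-`t` block of `q`, so it has label `e` in the first run, and `e`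
        -- is not open before `q`.
        q≤q′ : q ≤ q′
        q≤q′ = ≮⇒≥ λ q′<q → <⇒≱ (proj₁ (H.lab-just first-e′)) (≤-trans (*-monoˡ-≤ ℓ q′<q) q≤e)
          where
          h′pos : 0 < h′ e′
          h′pos = subst (0 <_) (H′.S-untouched q′ q′≤e′) (H′.S-pos q′≤q Sq′)
          first-e′ : H.lab t q′ ≡ just e
          first-e′ = trans (from (lvl≤J e) A≤q′ (≤-<-trans q′≤q q<B) A≤q q<B
            (trans (subst (λ j → H′.lab j q′ ≡ just e′) (sym t≡) (lab-first h′ q′ q′≤e′ e′<q′ h′pos)) (sym lq′))) lq
        e≡e′ : e ≡ e′
        e≡e′ = slot-unique q q≤e e<q (subst (λ z → z * ℓ ≤ e′) (≤-antisym q′≤q q≤q′) q′≤e′)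
          (subst (λ z → e′ < suc z * ℓ) (≤-antisym q′≤q q≤q′) e′<q′) t≡
        l0e : H′.lab 0 l ≡ just e
        l0e = trans ll′ (cong just (sym e≡e′))

        -- The window contains the whole life of `e`, so the content of `e` is a number of positions
        -- of the window, namely those in the finest block of `l`.
        size : ∀ g → Machine.Clean ℓ lvl g B → g e ≡ rangeSum (λ x → 𝟙 (Machine.lab ℓ lvl g 0 x ≟ᴹ just e)) A (suc N)
        size g clean = trans (sym (G.S-untouched A A≤e)) (trans (sym (G.S-count e A (suc N)))
          (trans (cong (rangeSum (λ x → 𝟙 (G.lab 0 x ≟ᴹ just e)) A (suc N) +_) (clean e<B)) (+-identityʳ _)))
          where module G = Machine ℓ lvl g
        sizes : h′ e ≡ h e
        sizes = trans (size h′ clB′) (trans (rangeSum-cong A (suc N) λ x A≤x x<B →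
          𝟙-cong (H′.lab 0 x ≟ᴹ just e) (H.lab 0 x ≟ᴹ just e)
            (λ eq → trans (from z≤n A≤x x<B A≤l l<B (trans eq (sym l0e))) l0)
            (λ eq → trans (to z≤n A≤x x<B A≤l l<B (trans eq (sym l0))) l0e)) (sym (size h clB)))

      result : h′ e ≡ h e
      result with H′.lab t q in eq
      ... | just e′ = after e′ eq
      -- Without a label in the second run, `q` would share its block with the leftover position.
      ... | nothing with () ← trans (sym lq) (trans (from (lvl≤J e) A≤q q<B A≤z z<B
              (trans eq (sym (H′.lab-none nz′)))) (H.lab-none nz))

-- Recognising a labelling as a run of the machine

module Labelling (ℓ : ℕ) (lvl : ℕ → ℕ) (A N : ℕ) (ident : ℕ → ℕ → Maybe ℕ) where

  Alive : ℕ → ℕ → Set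
  Alive x e = ∃[ y ] x ≤ y × y < A + N × ident 0 y ≡ just e

  -- The rule of the machine, with "still holds something" replaced by "still occurs at or after
  -- `x`". It makes no reference to contents, so it can be checked on labels that come from a chain.
  record GreatestAlive (j x : ℕ) : Set where
    field
      on-just : ∀ {e} → ident j x ≡ just e → A * ℓ ≤ e × e < suc x * ℓ × j ≤ lvl e × Alive x e ×
        (∀ {e′} → e < e′ → e′ < suc x * ℓ → j ≤ lvl e′ → ¬ Alive x e′)
      on-nothing : ident j x ≡ nothing → ∀ {e} → A * ℓ ≤ e → e < suc x * ℓ → j ≤ lvl e → ¬ Alive x e
  open GreatestAlive

  occurs : ℕ → ℕ → ℕ
  occurs e y = 𝟙 (ident 0 y ≟ᴹ just e)

  module _ {J : ℕ} (spec : ∀ {j x} → j ≤ J → A ≤ x → x < A + N → GreatestAlive j x)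
    (h : ℕ → ℕ) (h≡ : ∀ {e} → A * ℓ ≤ e → e < (A + N) * ℓ → h e ≡ rangeSum (occurs e) A N) where

    open Machine ℓ lvl h

    private
      Agree : ℕ → ℕ → Set
      Agree x n = ∀ {e} → A * ℓ ≤ e → e < (A + N) * ℓ → S x e ≡ rangeSum (occurs e) x n

      module _ {x n} (A≤x : A ≤ x) (x<B : x < A + N) (x+n : x + n ≡ A + N) (agree : Agree x n) where

        in-window : ∀ {e} → e < suc x * ℓ → e < (A + N) * ℓ
        in-window e< = <-≤-trans e< (*-monoˡ-≤ ℓ x<B)

        alive⇒pos : ∀ {e} → A * ℓ ≤ e → e < suc x * ℓ → Alive x e → 0 < S x e
        alive⇒pos {e} A≤e e< (y , x≤y , y< , eq) = subst (0 <_) (sym (agree A≤e (in-window e<)))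
          (pos-rangeSum (λ y → ident 0 y ≟ᴹ just e) x n x≤y (subst (y <_) (sym x+n) y<) eq)

        pos⇒alive : ∀ {e} → A * ℓ ≤ e → e < suc x * ℓ → 0 < S x e → Alive x e
        pos⇒alive {e} A≤e e< pos
          with y , x≤y , y< , eq ← rangeSum-pos (λ y → ident 0 y ≟ᴹ just e) x n (subst (0 <_) (agree A≤e (in-window e<)) pos)
          = y , x≤y , subst (y <_) x+n y< , eq

        ident⇒lab : ∀ {j e} → j ≤ J → ident j x ≡ just e → lab j x ≡ just e
        ident⇒lab {j} {e} j≤J eq with A≤e , e< , j≤ , alive , max ← on-just (spec j≤J A≤x x<B) eq =
          lab-intro e< (alive⇒pos A≤e e< alive) j≤ λ {e′} e<e′ e′< j≤′ →
            n≤0⇒n≡0 (≮⇒≥ λ pos → max e<e′ e′< j≤′ (pos⇒alive (≤-trans A≤e (<⇒≤ e<e′)) e′< pos))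

        lab⇒ident : ∀ {j e} → j ≤ J → A * ℓ ≤ e → lab j x ≡ just e → ident j x ≡ just e
        lab⇒ident {j} {e} j≤J A≤e eq with ident j x in eqi
        ... | just e′ = trans (sym (ident⇒lab j≤J eqi)) eq
        ... | nothing with e< , pos , j≤ ← lab-just eq =
          contradiction (pos⇒alive A≤e e< pos) (on-nothing (spec j≤J A≤x x<B) eqi A≤e e< j≤)

      -- As long as contents count future occurrences, positive means alive; then machine and
      -- labelling choose the same slot of the window at `x`, and both counts drop together.
      agrees : ∀ i n → i + n ≡ N → Agree (A + i) n
      agrees zero n refl {e} A≤e e< = trans (cong (λ z → S z e) (+-identityʳ A))
        (trans (S-untouched A A≤e) (trans (h≡ A≤e e<) (cong (λ z → rangeSum (occurs e) z n) (sym (+-identityʳ A)))))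
      agrees (suc i) n 1+i+n {e} A≤e e< rewrite +-suc A i = +-cancelʳ-≡ (𝟙 (lab 0 x ≟ᴹ just e)) _ _ (begin
        S (suc x) e + 𝟙 (lab 0 x ≟ᴹ just e)                 ≡⟨ S-step x e ⟨
        S x e                                               ≡⟨ agree A≤e e< ⟩
        occurs e x + rangeSum (occurs e) (suc x) n          ≡⟨ +-comm (occurs e x) _ ⟩
        rangeSum (occurs e) (suc x) n + occurs e x
          ≡⟨ cong (rangeSum (occurs e) (suc x) n +_) (𝟙-cong (ident 0 x ≟ᴹ just e) (lab 0 x ≟ᴹ just e)
               (ident⇒lab A≤x x<B x+n agree z≤n) (lab⇒ident A≤x x<B x+n agree z≤n A≤e)) ⟩
        rangeSum (occurs e) (suc x) n + 𝟙 (lab 0 x ≟ᴹ just e) ∎)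
        where
        open ≡-Reasoning
        x = A + i
        i+1+n : i + suc n ≡ N
        i+1+n = trans (+-suc i n) 1+i+n
        x+n : x + suc n ≡ A + N
        x+n = trans (+-assoc A i (suc n)) (cong (A +_) i+1+n)
        x<B : x < A + N
        x<B = subst (x <_) x+n (m<m+n x z<s)
        A≤x = m≤m+n A i
        agree : Agree x (suc n)
        agree = agrees i (suc n) i+1+n

    module _ {x} (A≤x : A ≤ x) (x<B : x < A + N) where
      private
        i = proj₁ (m≤n⇒∃[o]m+o≡n A≤x)
        n = proj₁ (m≤n⇒∃[o]m+o≡n (<⇒≤ x<B))
        x+n : x + n ≡ A + N
        x+n = proj₂ (m≤n⇒∃[o]m+o≡n (<⇒≤ x<B))
        A+i : A + i ≡ x
        A+i = proj₂ (m≤n⇒∃[o]m+o≡n A≤x)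
        agree : Agree x n
        agree = subst (λ z → Agree z n) A+i (agrees i n
          (+-cancelˡ-≡ A _ _ (trans (sym (+-assoc A i n)) (trans (cong (_+ n) A+i) x+n))))

      -- `Clean A` is not assumed: slots opened before `A` rank below those of the window and cannot
      -- disturb the contents of the latter. This form is available before `A` is known to be clean,
      -- and serves to prove that it is.
      label≥⇒ident : ∀ {j e} → j ≤ J → A * ℓ ≤ e → lab j x ≡ just e → ident j x ≡ just e
      label≥⇒ident = lab⇒ident A≤x x<B x+n agree

      label≡ident : Clean A → ∀ {j} → j ≤ J → lab j x ≡ ident j x
      label≡ident clean {j} j≤J with ident j x in eqi
      ... | just e = ident⇒lab A≤x x<B x+n agree j≤J eqi
      ... | nothing with lab j x in eq
      ...   | nothing = refl
      ...   | just e with () ← trans (sym eqi) (label≥⇒ident j≤J (Clean-lab clean A≤x eq) eq)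

-- From chains to labels

module _ {P : Pred ℕ 0ℓ} (P? : Decidable P) where

  leastFrom : ℕ → ℕ → ℕ
  leastFrom lo zero    = lo
  leastFrom lo (suc n) = if does (P? lo) then lo else leastFrom (suc lo) n

  leastFrom-spec : ∀ lo n {x} → lo ≤ x → x < lo + n → P x →
    lo ≤ leastFrom lo n × leastFrom lo n ≤ x × P (leastFrom lo n) × (∀ {y} → lo ≤ y → y < leastFrom lo n → ¬ P y)
  leastFrom-spec lo zero lo≤x x< p = contradiction (subst (_ <_) (+-identityʳ lo) x<) (≤⇒≯ lo≤x)
  leastFrom-spec lo (suc n) {x} lo≤x x< p with P? lo
  ... | yes p₀ = ≤-refl , lo≤x , p₀ , λ lo≤y y<lo → contradiction y<lo (≤⇒≯ lo≤y)
  ... | no ¬p₀ with 1+lo≤ , ≤x , p′ , min ← leastFrom-spec (suc lo) n (≤∧≢⇒< lo≤x λ { refl → ¬p₀ p }) (subst (x <_) (+-suc lo n) x<) p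
    = <⇒≤ 1+lo≤ , ≤x , p′ , min′ min
    where
    min′ : (∀ {y} → suc lo ≤ y → y < leastFrom (suc lo) n → ¬ P y) → ∀ {y} → lo ≤ y → y < leastFrom (suc lo) n → ¬ P y
    min′ min lo≤y y< with m≤n⇒m<n∨m≡n lo≤y
    ... | inj₁ lo<y = min lo<y y<
    ... | inj₂ refl = ¬p₀

module _ {P A : Set} where

  unless : Dec P → A → Maybe A
  unless P? a = if does P? then nothing else just a

  unless-nothing : ∀ (P? : Dec P) {a} → unless P? a ≡ nothing → P
  unless-nothing (yes p) _ = p

  unless-just : ∀ (P? : Dec P) {a b} → unless P? a ≡ just b → ¬ P × a ≡ b
  unless-just (no ¬p) refl = ¬p , refl

  unless-true : ∀ (P? : Dec P) {a} → P → unless P? a ≡ nothing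
  unless-true (yes _) _ = refl
  unless-true (no ¬p) p = contradiction p ¬p

module Slots (V : ℕ) where

  ℓ : ℕ
  ℓ = suc V

  -- Within one position, coarser levels come first.
  slot : ℕ → ℕ → ℕ
  slot q t = q * ℓ + (V ∸ t)

  lvl : ℕ → ℕ
  lvl e = V ∸ e % ℓ

  lvl≤V : ∀ e → lvl e ≤ V
  lvl≤V e = m∸n≤m V (e % ℓ)

  slot< : ∀ q t → slot q t < suc q * ℓ
  slot< q t = <-≤-trans (+-monoʳ-< (q * ℓ) (s≤s (m∸n≤m V t))) (≤-reflexive (+-comm (q * ℓ) ℓ))

  slot≥ : ∀ q t → q * ℓ ≤ slot q t
  slot≥ q t = m≤m+n (q * ℓ) (V ∸ t)

  slot<⇒≤ : ∀ {q t x} → slot q t < suc x * ℓ → q ≤ x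
  slot<⇒≤ {q} {t} {x} lt = ≮⇒≥ λ x<q → <⇒≱ lt (≤-trans (*-monoˡ-≤ ℓ x<q) (slot≥ q t))

  ≤⇒slot< : ∀ {q t x} → q ≤ x → slot q t < suc x * ℓ
  ≤⇒slot< {q} {t} q≤x = <-≤-trans (slot< q t) (*-monoˡ-≤ ℓ (s≤s q≤x))

  ≤⇒slot≥ : ∀ {q t x} → x ≤ q → x * ℓ ≤ slot q t
  ≤⇒slot≥ {q} {t} x≤q = ≤-trans (*-monoˡ-≤ ℓ x≤q) (slot≥ q t)

  slot-% : ∀ q t → slot q t % ℓ ≡ V ∸ t
  slot-% q t = trans (cong (_% ℓ) (+-comm (q * ℓ) (V ∸ t)))
    (trans ([m+kn]%n≡m%n (V ∸ t) q ℓ) (m<n⇒m%n≡m (s≤s (m∸n≤m V t))))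

  lvl-slot : ∀ q {t} → t ≤ V → lvl (slot q t) ≡ t
  lvl-slot q {t} t≤V = trans (cong (V ∸_) (slot-% q t)) (m∸[m∸n]≡n t≤V)

  slot-pos-lvl : ∀ e → slot (e / ℓ) (lvl e) ≡ e
  slot-pos-lvl e = trans (cong ((e / ℓ) * ℓ +_) (m∸[m∸n]≡n (≤-pred (m%n<n e ℓ))))
    (trans (+-comm _ (e % ℓ)) (sym (m≡m%n+[m/n]*n e ℓ)))

  slot-lex : ∀ {q t q′ t′} → slot q t < slot q′ t′ → q < q′ ⊎ (q ≡ q′ × t′ < t)
  slot-lex {q} {t} {q′} {t′} lt with m≤n⇒m<n∨m≡n (slot<⇒≤ {q} {t} {q′} (<-trans lt (slot< q′ t′)))
  ... | inj₁ q<q′ = inj₁ q<q′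
  ... | inj₂ refl = inj₂ (refl , ≰⇒> λ t≤t′ →
    <⇒≱ (+-cancelˡ-< (q * ℓ) (V ∸ t) (V ∸ t′) lt) (∸-monoʳ-≤ V t≤t′))

  pos-of : ∀ e → ∃[ q ] q * ℓ ≤ e × e < suc q * ℓ
  pos-of e = e / ℓ , subst (e / ℓ * ℓ ≤_) (slot-pos-lvl e) (slot≥ (e / ℓ) (lvl e)) ,
    subst (_< suc (e / ℓ) * ℓ) (slot-pos-lvl e) (slot< (e / ℓ) (lvl e))

  pos-unique : ∀ q q′ {e} → q * ℓ ≤ e → e < suc q * ℓ → q′ * ℓ ≤ e → e < suc q′ * ℓ → q ≡ q′
  pos-unique q q′ {e} q≤ <q q′≤ <q′ = ≤-antisym (half q q′ q≤ <q′) (half q′ q q′≤ <q)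
    where
    half : ∀ a b → a * ℓ ≤ e → e < suc b * ℓ → a ≤ b
    half a b a≤ <b = ≮⇒≥ λ b<a → <⇒≱ <b (≤-trans (*-monoˡ-≤ ℓ b<a) a≤)

  slot-injective : ∀ {q t q′ t′} → t ≤ V → t′ ≤ V → slot q t ≡ slot q′ t′ → q ≡ q′ × t ≡ t′
  slot-injective {q} {t} {q′} {t′} t≤ t′≤ eq =
    pos-unique q q′ (slot≥ q t) (slot< q t) (subst (q′ * ℓ ≤_) (sym eq) (slot≥ q′ t′)) (subst (_< suc q′ * ℓ) (sym eq) (slot< q′ t′)) ,
    trans (sym (lvl-slot q t≤)) (trans (cong lvl eq) (lvl-slot q′ t′≤))

  lvl-anti : ∀ q {e e′} → q * ℓ ≤ e → e < e′ → e′ < suc q * ℓ → lvl e′ < lvl e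
  lvl-anti q {e} {e′} q≤e e<e′ e′<
    with slot-lex {q} {_} {q} (subst₂ _<_ (sym (at e q≤e (<-trans e<e′ e′<))) (sym (at e′ (≤-trans q≤e (<⇒≤ e<e′)) e′<)) e<e′)
    where
    at : ∀ e → q * ℓ ≤ e → e < suc q * ℓ → slot q (lvl e) ≡ e
    at e q≤e e< = trans (cong (λ z → slot z (lvl e)) (pos-unique q (e / ℓ) q≤e e< (proj₁ (proj₂ (pos-of e))) (proj₂ (proj₂ (pos-of e)))))
      (slot-pos-lvl e)
  ... | inj₁ q<q = contradiction q<q (<-irrefl refl)
  ... | inj₂ (_ , lt) = lt

module ChainLabels (V A N′ : ℕ) (κ : ℕ → ℕ → ℕ) where
  open Slots V

  period B z : ℕ
  period = suc N′
  B = A + period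
  z = A + N′

  infix 4 _∼[_]_
  _∼[_]_ : ℕ → ℕ → ℕ → Set
  x ∼[ j ] y = κ j x ≡ κ j y

  In : ℕ → Set
  In x = A ≤ x × x < B

  module Labels (coarsen : ∀ {j j′ x y} → j ≤ j′ → j′ ≤ V → x ∼[ j ] y → x ∼[ j′ ] y)
    (noncrossing : ∀ {j a b c d} → j ≤ V → A ≤ a → a < b → b < c → c < d → d < B → a ∼[ j ] c → b ∼[ j ] d → a ∼[ j ] b) where

    weakly-noncrossing : ∀ {j a b c d} → j ≤ V → A ≤ a → a ≤ b → b ≤ c → c ≤ d → d < B →
      a ∼[ j ] c → b ∼[ j ] d → a ∼[ j ] b
    weakly-noncrossing j≤V A≤a a≤b b≤c c≤d d<B ac bd
      with m≤n⇒m<n∨m≡n a≤b | m≤n⇒m<n∨m≡n b≤c | m≤n⇒m<n∨m≡n c≤d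
    ... | inj₂ refl | _         | _         = refl
    ... | inj₁ _    | inj₂ refl | _         = ac
    ... | inj₁ _    | inj₁ _    | inj₂ refl = trans ac (sym bd)
    ... | inj₁ a<b  | inj₁ b<c  | inj₁ c<d  = noncrossing j≤V A≤a a<b b<c c<d d<B ac bd

    opaque
     last : ℕ → ℕ → ℕ
     last j x = fromMaybe x (greatest (λ y → κ j y ≟ κ j x) B)

     last-spec : ∀ j {x} → x < B → x ≤ last j x × last j x < B × last j x ∼[ j ] x ×
       (∀ {y} → last j x < y → y < B → ¬ y ∼[ j ] x)
     last-spec j {x} x<B with greatest-complete (λ y → κ j y ≟ κ j x) B x<B refl
     ... | y , x≤y , eq rewrite eq with y<B , y∼x , max ← greatest-just (λ y → κ j y ≟ κ j x) B eq =
       x≤y , y<B , y∼x , λ {y′} y<y′ y′<B → max y′ y<y′ y′<B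

    Last : ℕ → ℕ → Set
    Last j l = ∀ {y} → l < y → y < B → ¬ y ∼[ j ] l

    Last-unique : ∀ {j l l′} → l < B → l′ < B → Last j l → Last j l′ → l ∼[ j ] l′ → l ≡ l′
    Last-unique {j} {l} {l′} l<B l′<B Ll Ll′ l∼l′ with <-cmp l l′
    ... | tri< l<l′ _ _ = contradiction (sym l∼l′) (Ll l<l′ l′<B)
    ... | tri≈ _ eq _   = eq
    ... | tri> _ _ l′<l = contradiction l∼l′ (Ll′ l′<l l<B)

    last-Last : ∀ j {x} → x < B → Last j (last j x)
    last-Last j x<B l<y y<B y∼l with _ , _ , l∼x , max ← last-spec j x<B = max l<y y<B (trans y∼l l∼x)

    last-cong : ∀ j {x y} → x < B → y < B → x ∼[ j ] y → last j x ≡ last j y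
    last-cong j x<B y<B x∼y with _ , lx<B , lx∼x , _ ← last-spec j x<B | _ , ly<B , ly∼y , _ ← last-spec j y<B =
      Last-unique lx<B ly<B (last-Last j x<B) (last-Last j y<B) (trans lx∼x (trans x∼y (sym ly∼y)))

    Last-last : ∀ {j l} → l < B → Last j l → last j l ≡ l
    Last-last {j} l<B Ll with _ , l′<B , l′∼l , _ ← last-spec j l<B = Last-unique l′<B l<B (last-Last j l<B) Ll l′∼l

    last-Last′ : ∀ {j l} → l < B → last j l ≡ l → Last j l
    last-Last′ {j} l<B eq = subst (Last j) eq (last-Last j l<B)

    Last-finer : ∀ {j j′ l} → j ≤ j′ → j′ ≤ V → Last j′ l → Last j l
    Last-finer j≤j′ j′≤V Ll l<y y<B y∼l = Ll l<y y<B (coarsen j≤j′ j′≤V y∼l)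

    opaque
     top : ℕ → ℕ
     top l = fromMaybe 0 (greatest (λ j → last j l ≟ l) ℓ)

     top-spec : ∀ {j l} → l < B → j ≤ V → Last j l → j ≤ top l × top l ≤ V × Last (top l) l
     top-spec {j} {l} l<B j≤V Ll with greatest-complete (λ j → last j l ≟ l) ℓ (s≤s j≤V) (Last-last l<B Ll)
     ... | j′ , j≤j′ , eq rewrite eq with j′<ℓ , lt , _ ← greatest-just (λ j → last j l ≟ l) ℓ eq =
       j≤j′ , ≤-pred j′<ℓ , last-Last′ l<B lt

    opaque
     first : ℕ → ℕ
     first l = leastFrom (λ y → κ (top l) y ≟ κ (top l) l) A period

     first-spec : ∀ {l} → In l → A ≤ first l × first l ≤ l × first l ∼[ top l ] l ×
       (∀ {y} → A ≤ y → y < first l → ¬ y ∼[ top l ] l)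
     first-spec {l} (A≤l , l<B) = leastFrom-spec (λ y → κ (top l) y ≟ κ (top l) l) A period A≤l l<B refl

    code : ℕ → ℕ
    code l = slot (first l) (top l)

    -- The window ends at the leftover position `z`, so at every level the special block is the one
    -- whose last element is `z`; it receives no slot.
    label : ℕ → Maybe ℕ
    label l = unless (l ≟ z) (code l)

    ident : ℕ → ℕ → Maybe ℕ
    ident j x = label (last j x)

    label-nothing : ∀ l → label l ≡ nothing → l ≡ z
    label-nothing l = unless-nothing (l ≟ z)

    label-just : ∀ l {e} → label l ≡ just e → ¬ l ≡ z × code l ≡ e
    label-just l = unless-just (l ≟ z)

    z<B : z < B
    z<B = +-monoʳ-< A ≤-refl

    ≤z : ∀ {x} → x < B → x ≤ z
    ≤z {x} x<B = ≤-pred (subst (x <_) (+-suc A N′) x<B)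

    ident-z : ∀ j → ident j z ≡ nothing
    ident-z j with z≤l , l<B , _ ← last-spec j z<B = unless-true (last j z ≟ z) (≤-antisym (≤z l<B) z≤l)

    open Labelling ℓ lvl A period ident public

    module _ {j x} (j≤V : j ≤ V) (In-x : In x) where
      private
        A≤x = proj₁ In-x
        x<B = proj₂ In-x
        l = last j x
        x≤l = proj₁ (last-spec j x<B)
        l<B = proj₁ (proj₂ (last-spec j x<B))
        l∼x : l ∼[ j ] x
        l∼x = proj₁ (proj₂ (proj₂ (last-spec j x<B)))

        -- An alive slot of level ≥ j comes from an arc, from `first l′` to `l′` at level `top l′`,
        -- that spans `x`. The noncrossing condition is applied to this arc and to the block of `x`.
        record Open (e′ : ℕ) : Set where
          field
            l′ : ℕ
            l′≢z : ¬ l′ ≡ z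
            l′<B : l′ < B
            x≤l′ : x ≤ l′
            code-l′ : code l′ ≡ e′
            t′≤V : top l′ ≤ V
            j≤t′ : j ≤ top l′
            Ll′ : Last (top l′) l′
            A≤q′ : A ≤ first l′
            q′≤x : first l′ ≤ x
            q′∼l′ : first l′ ∼[ top l′ ] l′
            min′ : ∀ {y} → A ≤ y → y < first l′ → ¬ y ∼[ top l′ ] l′

        alive⇒Open : ∀ {e′} → e′ < suc x * ℓ → j ≤ lvl e′ → Alive x e′ → Open e′
        alive⇒Open {e′} e′< j≤ (y , x≤y , y<B , eq)
          with y≤l′ , l′<B , _ ← last-spec 0 y<B
          with l′≢z , code≡ ← label-just (last 0 y) eq
          with _ , t′≤V , Ll′ ← top-spec l′<B z≤n (last-Last 0 y<B)
          with A≤q′ , q′≤l′ , q′∼l′ , min′ ← first-spec (≤-trans A≤x (≤-trans x≤y y≤l′) , l′<B)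
          = record
          { l′ = last 0 y ; l′≢z = l′≢z ; l′<B = l′<B ; x≤l′ = ≤-trans x≤y y≤l′ ; code-l′ = code≡ ; t′≤V = t′≤V
          ; j≤t′ = subst (j ≤_) (trans (cong lvl (sym code≡)) (lvl-slot (first (last 0 y)) t′≤V)) j≤
          ; Ll′ = Ll′ ; A≤q′ = A≤q′ ; q′≤x = slot<⇒≤ {t = top (last 0 y)} (subst (_< suc x * ℓ) (sym code≡) e′<) ; q′∼l′ = q′∼l′ ; min′ = min′ }

        -- If `l′ < l`, the arc from `first l′` to `l′` and the pair `x`, `l` interlace at level
        -- `top l′`, which puts `l` into the block that `l′` should end.
        not-inner : ∀ {e′} (o : Open e′) → ¬ Open.l′ o < l
        not-inner o l′<l = Ll′ l′<l l<B (trans (sym x∼l) (trans (sym q′∼x) q′∼l′))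
          where
          open Open o
          x∼l : x ∼[ top l′ ] l
          x∼l = coarsen j≤t′ t′≤V (sym l∼x)
          q′∼x : first l′ ∼[ top l′ ] x
          q′∼x = weakly-noncrossing t′≤V A≤q′ q′≤x x≤l′ (<⇒≤ l′<l) l<B q′∼l′ x∼l

        -- If `l < l′`, the arcs of `l` and `l′` interlace and therefore merge at the coarser of
        -- their two levels. If that is `top l`, then `l` is not last in its block; if it is
        -- `top l′` and `first l` is to the left of `first l′`, then `first l′` is not first. The
        -- order of the slots rules out everything else.
        not-outer : ∀ {e′} (o : Open e′) → code l < e′ → ¬ l < Open.l′ o
        not-outer {e′} o e<e′ l<l′ = by-level (≤-total (top l) (top l′))
          where
          open Open o
          tl = top-spec {j} l<B j≤V (last-Last j x<B)
          t≤V = proj₁ (proj₂ tl)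
          Ll = proj₂ (proj₂ tl)
          fl = first-spec {l} (≤-trans A≤x x≤l , l<B)
          A≤q = proj₁ fl
          q∼l : first l ∼[ top l ] l
          q∼l = proj₁ (proj₂ (proj₂ fl))
          lex = slot-lex {first l} {top l} {first l′} {top l′} (subst (code l <_) (sym code-l′) e<e′)
          q≤q′ : first l ≤ first l′
          q≤q′ with lex
          ... | inj₁ q<q′ = <⇒≤ q<q′
          ... | inj₂ (q≡q′ , _) = ≤-reflexive q≡q′
          coarser : top l′ ≤ top l → ⊥
          coarser t′≤t = Ll l<l′ l′<B (trans (sym q′∼l′-t) (trans (sym q∼q′) q∼l))
            where
            q′∼l′-t : first l′ ∼[ top l ] l′
            q′∼l′-t = coarsen t′≤t t≤V q′∼l′
            q∼q′ : first l ∼[ top l ] first l′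
            q∼q′ = weakly-noncrossing t≤V A≤q q≤q′ (≤-trans q′≤x x≤l) (<⇒≤ l<l′) l′<B q∼l q′∼l′-t
          finer : top l ≤ top l′ → first l < first l′ → ⊥
          finer t≤t′ q<q′ = min′ A≤q q<q′ (trans (weakly-noncrossing t′≤V A≤q q≤q′ (≤-trans q′≤x x≤l) (<⇒≤ l<l′) l′<B
            (coarsen t≤t′ t′≤V q∼l) q′∼l′) q′∼l′)
          by-level : top l ≤ top l′ ⊎ top l′ ≤ top l → ⊥
          by-level (inj₂ t′≤t) = coarser t′≤t
          by-level (inj₁ t≤t′) with lex
          ... | inj₁ q<q′ = finer t≤t′ q<q′
          ... | inj₂ (_ , t′<t) = <⇒≱ t′<t t≤t′

      ident-greatest : GreatestAlive j x
      ident-greatest = record { on-just = on-just ; on-nothing = on-nothing }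
        where
        on-just : ∀ {e} → ident j x ≡ just e → A * ℓ ≤ e × e < suc x * ℓ × j ≤ lvl e × Alive x e ×
          (∀ {e′} → e < e′ → e′ < suc x * ℓ → j ≤ lvl e′ → ¬ Alive x e′)
        on-just {e} eq with l≢z , refl ← label-just l eq
          with j≤t , t≤V , Ll ← top-spec {j} l<B j≤V (last-Last j x<B)
          with A≤q , q≤l , q∼l , min ← first-spec {l} (≤-trans A≤x x≤l , l<B) =
          ≤⇒slot≥ {t = top l} A≤q , ≤⇒slot< {t = top l} q≤x , subst (j ≤_) (sym (lvl-slot (first l) t≤V)) j≤t ,
          -- `l` itself shows that its slot is alive: the last element of a coarse block is also the
          -- last of its finest block.
          (l , x≤l , l<B , trans (cong label (Last-last l<B (Last-finer z≤n t≤V Ll))) eq) , max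
          where
          q≤x : first l ≤ x
          q≤x = ≮⇒≥ λ x<q → proj₂ (proj₂ (proj₂ (first-spec {l} (≤-trans A≤x x≤l , l<B)))) A≤x x<q
            (coarsen (proj₁ (top-spec {j} l<B j≤V (last-Last j x<B))) (proj₁ (proj₂ (top-spec {j} l<B j≤V (last-Last j x<B)))) (sym l∼x))
          max : ∀ {e′} → code l < e′ → e′ < suc x * ℓ → j ≤ lvl e′ → ¬ Alive x e′
          max e<e′ e′< j≤ alive with o ← alive⇒Open e′< j≤ alive with <-cmp (Open.l′ o) l
          ... | tri< l′<l _ _ = not-inner o l′<l
          ... | tri≈ _ refl _ = <-irrefl (Open.code-l′ o) e<e′
          ... | tri> _ _ l<l′ = not-outer o e<e′ l<l′

        on-nothing : ident j x ≡ nothing → ∀ {e} → A * ℓ ≤ e → e < suc x * ℓ → j ≤ lvl e → ¬ Alive x e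
        -- Here `l` is `z`, the end of the window, so any other last element is to its left.
        on-nothing eq _ e< j≤ alive with o ← alive⇒Open e< j≤ alive =
          not-inner o (≤∧≢⇒< (subst (Open.l′ o ≤_) (sym l≡z) (≤z (Open.l′<B o))) λ l′≡l → Open.l′≢z o (trans l′≡l l≡z))
          where
          l≡z = label-nothing l eq

    ident-cong : ∀ {j x y} → x < B → y < B → x ∼[ j ] y → ident j x ≡ ident j y
    ident-cong {j} x<B y<B x∼y = cong label (last-cong j x<B y<B x∼y)

    -- A code determines its block: two last elements with the same code have the same level and the
    -- same first element, so both end the same block of that level.
    ident-reflects : ∀ {j x y} → j ≤ V → In x → In y → ident j x ≡ ident j y → x ∼[ j ] y
    ident-reflects {j} {x} {y} j≤V (A≤x , x<B) (A≤y , y<B) eq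
      with x≤l , l<B , l∼x , _ ← last-spec j x<B | y≤l′ , l′<B , l′∼y , _ ← last-spec j y<B
      with label (last j x) in el | label (last j y) in el′
    ... | nothing | nothing =
      trans (sym l∼x) (trans (cong (κ j) (trans (label-nothing _ el) (sym (label-nothing _ el′)))) l′∼y)
    ... | just e | just e′ with refl ← eq
      with _ , refl ← label-just _ el | _ , code≡ ← label-just _ el′
      with _ , t≤V , Ll ← top-spec {j} l<B j≤V (last-Last j x<B) | _ , t′≤V , Ll′ ← top-spec {j} l′<B j≤V (last-Last j y<B)
      with _ , _ , q∼l , _ ← first-spec {last j x} (≤-trans A≤x x≤l , l<B) | _ , _ , q′∼l′ , _ ← first-spec {last j y} (≤-trans A≤y y≤l′ , l′<B)
      with q≡ , t≡ ← slot-injective t′≤V t≤V code≡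
      = trans (sym l∼x) (trans (cong (κ j) l≡l′) l′∼y)
      where
      l≡l′ : last j x ≡ last j y
      l≡l′ = Last-unique l<B l′<B Ll (subst (λ t → Last t (last j y)) t≡ Ll′)
        (trans (sym q∼l) (trans (cong (κ (top (last j x))) (sym q≡)) (subst (λ t → first (last j y) ∼[ t ] last j y) t≡ q′∼l′)))

-- Finite sums, partitions and rotations

finSum : ∀ {n} → (Fin n → ℕ) → ℕ
finSum {zero}  f = 0
finSum {suc n} f = f zero + finSum (f ∘ suc)

finSum-cong : ∀ {n} {f g : Fin n → ℕ} → (∀ i → f i ≡ g i) → finSum f ≡ finSum g
finSum-cong {zero}  f≗g = refl
finSum-cong {suc n} f≗g = cong₂ _+_ (f≗g zero) (finSum-cong (f≗g ∘ suc))

finSum-zero : ∀ {n} {f : Fin n → ℕ} → (∀ i → f i ≡ 0) → finSum f ≡ 0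
finSum-zero {zero}  f≡0 = refl
finSum-zero {suc n} f≡0 rewrite f≡0 zero = finSum-zero (f≡0 ∘ suc)

finSum-+ : ∀ {n} (f g : Fin n → ℕ) → finSum (λ i → f i + g i) ≡ finSum f + finSum g
finSum-+ {zero}  f g = refl
finSum-+ {suc n} f g rewrite finSum-+ (f ∘ suc) (g ∘ suc) = interchange (f zero) (g zero) _ _

finSum-swap : ∀ {m n} (f : Fin m → Fin n → ℕ) → finSum (λ i → finSum (f i)) ≡ finSum (λ j → finSum (λ i → f i j))
finSum-swap {zero} {n} f = sym (finSum-zero {n} {λ _ → 0} λ _ → refl)
finSum-swap {suc m} f = trans (cong (finSum (f zero) +_) (finSum-swap (f ∘ suc)))
  (sym (finSum-+ (f zero) (λ j → finSum (λ i → f (suc i) j))))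

finSum-∣ : ∀ {n k} {f : Fin n → ℕ} → (∀ i → k ∣ f i) → k ∣ finSum f
finSum-∣ {zero}  k∣f = _ ∣0
finSum-∣ {suc n} k∣f = ∣m∣n⇒∣m+n (k∣f zero) (finSum-∣ (k∣f ∘ suc))

finSum-one : ∀ n → finSum {n} (λ _ → 1) ≡ n
finSum-one zero    = refl
finSum-one (suc n) = cong suc (finSum-one n)

finSum-toℕ : ∀ (g : ℕ → ℕ) lo n → finSum {n} (λ i → g (lo + toℕ i)) ≡ rangeSum g lo n
finSum-toℕ g lo zero    = refl
finSum-toℕ g lo (suc n) = cong₂ _+_ (cong g (+-identityʳ lo))
  (trans (finSum-cong {n} λ i → cong g (+-suc lo (toℕ i))) (finSum-toℕ g (suc lo) n))

𝟙-suc : ∀ {n} (i j : Fin n) → 𝟙 (suc i Fin.≟ suc j) ≡ 𝟙 (i Fin.≟ j)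
𝟙-suc i j = 𝟙-cong (suc i Fin.≟ suc j) (i Fin.≟ j) Fin.suc-injective (cong suc)

finSum-δ : ∀ {n} (i : Fin n) → finSum (λ j → 𝟙 (j Fin.≟ i)) ≡ 1
finSum-δ {suc n} zero    = cong suc (finSum-zero {n} λ j → 𝟙-no (suc j Fin.≟ zero) λ ())
finSum-δ {suc n} (suc i) = trans (finSum-cong λ j → 𝟙-suc j i) (finSum-δ i)

countFin≡finSum : ∀ {N} {P : Pred (Fin N) 0ℓ} (P? : Decidable P) → countFin P P? ≡ finSum (𝟙 ∘ P?)
countFin≡finSum P? = go id
  where
  go : ∀ {n} (f : Fin n → _) → List.length (List.filter P? (List.tabulate f)) ≡ finSum (𝟙 ∘ P? ∘ f)
  go {zero}  f = refl
  go {suc n} f with does (P? (f zero))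
  ... | true  = cong suc (go (f ∘ suc))
  ... | false = go (f ∘ suc)

finSum-unique : ∀ {n} {P : Pred (Fin n) 0ℓ} (P? : Decidable P) i → P i → (∀ j → P j → j ≡ i) → finSum (𝟙 ∘ P?) ≡ 1
finSum-unique P? i p unique = trans
  (finSum-cong λ j → 𝟙-cong (P? j) (j Fin.≟ i) (unique j) λ { refl → p }) (finSum-δ i)

finSum-exists : ∀ {n} {P : Pred (Fin n) 0ℓ} (P? : Decidable P) → 0 < finSum (𝟙 ∘ P?) → ∃ P
finSum-exists {suc n} P? pos with P? zero
... | yes p = zero , p
... | no _ with i , p ← finSum-exists (P? ∘ suc) pos = suc i , p

finSum-none : ∀ {n} {P : Pred (Fin n) 0ℓ} (P? : Decidable P) → finSum (𝟙 ∘ P?) ≡ 0 → ∀ i → ¬ P i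
finSum-none {suc n} P? eq zero p rewrite 𝟙-yes (P? zero) p with () ← eq
finSum-none {suc n} P? eq (suc i) p = finSum-none (P? ∘ suc) (m+n≡0⇒n≡0 (𝟙 (P? zero)) eq) i p

finSum-one-unique : ∀ {n} {P : Pred (Fin n) 0ℓ} (P? : Decidable P) → finSum (𝟙 ∘ P?) ≡ 1 → ∀ {i j} → P i → P j → i ≡ j
finSum-one-unique {suc n} P? eq {i} {j} pi pj with P? zero
finSum-one-unique {suc n} P? eq {zero} {zero} pi pj | _ = refl
finSum-one-unique {suc n} P? eq {zero} {suc j} pi pj | yes p = contradiction pj (finSum-none (P? ∘ suc) (suc-injective eq) j)
finSum-one-unique {suc n} P? eq {suc i} {_} pi pj | yes p = contradiction pi (finSum-none (P? ∘ suc) (suc-injective eq) i)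
finSum-one-unique {suc n} P? eq {zero} {suc j} pi pj | no ¬p = contradiction pi ¬p
finSum-one-unique {suc n} P? eq {suc i} {zero} pi pj | no ¬p = contradiction pj ¬p
finSum-one-unique {suc n} P? eq {suc i} {suc j} pi pj | no ¬p = cong suc (finSum-one-unique (P? ∘ suc) eq pi pj)

finSum-fibres : ∀ {m n} {P : Pred (Fin m) 0ℓ} (P? : Decidable P) (φ : Fin m → Fin n) →
  finSum (𝟙 ∘ P?) ≡ finSum (λ t → finSum (λ i → 𝟙 (P? i ×-dec (φ i Fin.≟ t))))
finSum-fibres {m} {n} P? φ = trans (finSum-cong fibre) (finSum-swap (λ i t → 𝟙 (P? i ×-dec (φ i Fin.≟ t))))
  where
  fibre : ∀ i → 𝟙 (P? i) ≡ finSum (λ t → 𝟙 (P? i ×-dec (φ i Fin.≟ t)))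
  fibre i with P? i
  ... | yes p = sym (finSum-unique (λ t → yes p ×-dec (φ i Fin.≟ t)) (φ i) (p , refl) λ { _ (_ , refl) → refl })
  ... | no ¬p = sym (finSum-zero {n} {λ _ → 0} λ t → refl)

finSum-bijection : ∀ {m n} {P : Pred (Fin m) 0ℓ} {Q : Pred (Fin n) 0ℓ} (P? : Decidable P) (Q? : Decidable Q)
  (φ : Fin m → Fin n) → (∀ {i} → P i → Q (φ i)) → (∀ {i j} → P i → P j → φ i ≡ φ j → i ≡ j) →
  (∀ {t} → Q t → ∃[ i ] P i × φ i ≡ t) → finSum (𝟙 ∘ P?) ≡ finSum (𝟙 ∘ Q?)
finSum-bijection P? Q? φ maps inj surj = trans (finSum-fibres P? φ) (finSum-cong fibre)
  where
  fibre : ∀ t → finSum (λ i → 𝟙 (P? i ×-dec (φ i Fin.≟ t))) ≡ 𝟙 (Q? t)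
  fibre t with Q? t
  ... | yes q with i , p , φi≡t ← surj q =
    finSum-unique (λ i → P? i ×-dec (φ i Fin.≟ t)) i (p , φi≡t) λ { j (pj , φj≡t) → inj pj p (trans φj≡t (sym φi≡t)) }
  ... | no ¬q = finSum-zero λ i → 𝟙-no (P? i ×-dec (φ i Fin.≟ t)) λ { (p , refl) → ¬q (maps p) }

leastFin : ∀ {n} {P : Pred (Fin n) 0ℓ} (P? : Decidable P) {i} → P i →
  ∃[ j ] P j × j Fin.≤ i × (∀ {j′} → P j′ → j Fin.≤ j′)
leastFin {suc n} P? {i} p with P? zero
leastFin {suc n} P? {i} p | yes p₀ = zero , p₀ , z≤n , λ _ → z≤n
leastFin {suc n} P? {zero} p | no ¬p₀ = contradiction p ¬p₀
leastFin {suc n} {P} P? {suc i} p | no ¬p₀ with j , pj , j≤i , min ← leastFin (P? ∘ suc) p =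
  suc j , pj , s≤s j≤i , min′
  where
  min′ : ∀ {j′} → P j′ → suc j Fin.≤ j′
  min′ {zero}   p₀  = contradiction p₀ ¬p₀
  min′ {suc j′} pj′ = s≤s (min pj′)

-- Partitions as kernels of colourings

module _ {n : ℕ} {X : Set} (_≟X_ : DecidableEquality X) (colour : Fin n → X) where

  private
    least : ∀ i → ∃[ j ] colour j ≡ colour i × j Fin.≤ i × (∀ {j′} → colour j′ ≡ colour i → j Fin.≤ j′)
    least i = leastFin (λ j → colour j ≟X colour i) refl

    least-cong : ∀ {i j} → colour i ≡ colour j → proj₁ (least i) ≡ proj₁ (least j)
    least-cong {i} {j} eq with i′ , ci′ , _ , min ← least i | j′ , cj′ , _ , min′ ← least j =
      Fin.≤-antisym (min (trans cj′ (sym eq))) (min′ (trans ci′ eq))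

  kernel : Partition n
  kernel = record
    { blk      = λ i → proj₁ (least i)
    ; blk≤     = λ i → proj₁ (proj₂ (proj₂ (least i)))
    ; blk-idem = λ i → least-cong (proj₁ (proj₂ (least i)))
    }

  kernel-same : ∀ {i j} → colour i ≡ colour j → SameBlock kernel i j
  kernel-same = least-cong

  same-kernel : ∀ {i j} → SameBlock kernel i j → colour i ≡ colour j
  same-kernel {i} {j} eq = trans (sym (proj₁ (proj₂ (least i)))) (trans (cong colour eq) (proj₁ (proj₂ (least j))))

module _ {n : ℕ} where

  same-blk : ∀ (π : Partition n) i → SameBlock π (blk π i) i
  same-blk = blk-idem

  -- Blocks are named by their minima, and the block of `i` in `σ` contains `blk π i`.
  ⊑⇒blk≤ : ∀ {π σ : Partition n} → π ⊑ σ → ∀ i → blk σ i Fin.≤ blk π i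
  ⊑⇒blk≤ {π} {σ} π⊑σ i = subst (Fin._≤ blk π i) (π⊑σ (blk π i) i (same-blk π i)) (blk≤ σ (blk π i))

  ⊑-antisym : ∀ {π σ : Partition n} → π ⊑ σ → σ ⊑ π → π ≈P σ
  ⊑-antisym {π} {σ} π⊑σ σ⊑π i = Fin.≤-antisym (⊑⇒blk≤ {σ} {π} σ⊑π i) (⊑⇒blk≤ {π} {σ} π⊑σ i)

  ≈P⇒same : ∀ {π σ : Partition n} → π ≈P σ → π ⊑ σ
  ≈P⇒same π≈σ i j eq = trans (sym (π≈σ i)) (trans eq (π≈σ j))

  ≈P-sym : ∀ {π σ : Partition n} → π ≈P σ → σ ≈P π
  ≈P-sym π≈σ i = sym (π≈σ i)

  blockSize≡ : ∀ (π : Partition n) m → blockSize π m ≡ finSum (λ i → 𝟙 (blk π i Fin.≟ m))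
  blockSize≡ π m = countFin≡finSum (λ i → blk π i Fin.≟ m)

  blockSize-cong : ∀ {π σ : Partition n} → π ≈P σ → ∀ m → blockSize π m ≡ blockSize σ m
  blockSize-cong {π} {σ} π≈σ m = trans (blockSize≡ π m) (trans (finSum-cong λ i →
    cong (λ b → 𝟙 (b Fin.≟ m)) (π≈σ i)) (sym (blockSize≡ σ m)))

  numBlocks≡ : ∀ (π : Partition n) {P : Pred ℕ 0ℓ} (P? : Decidable P) →
    numBlocks π P P? ≡ finSum (λ m → 𝟙 ((blk π m Fin.≟ m) ×-dec P? (blockSize π m)))
  numBlocks≡ π P? = countFin≡finSum (λ m → (blk π m Fin.≟ m) ×-dec P? (blockSize π m))

  numBlocks-cong : ∀ {π σ : Partition n} → π ≈P σ → ∀ {P : Pred ℕ 0ℓ} (P? : Decidable P) →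
    numBlocks π P P? ≡ numBlocks σ P P?
  numBlocks-cong {π} {σ} π≈σ P? = trans (numBlocks≡ π P?) (trans (finSum-cong λ m →
    cong₂ (λ b s → 𝟙 ((b Fin.≟ m) ×-dec P? s)) (π≈σ m) (blockSize-cong {π} {σ} π≈σ m)) (sym (numBlocks≡ σ P?)))

  -- The set is a union of blocks and is counted block by block.
  saturated-∣ : ∀ {k} (π : Partition n) {P : Pred (Fin n) 0ℓ} (P? : Decidable P) →
    (∀ {i j} → SameBlock π i j → P i → P j) → (∀ {m} → P m → blk π m ≡ m → k ∣ blockSize π m) →
    k ∣ finSum (𝟙 ∘ P?)
  saturated-∣ {k} π P? saturated k∣ = subst (k ∣_) (sym (finSum-fibres P? (blk π))) (finSum-∣ fibre)
    where
    fibre : ∀ m → k ∣ finSum (λ i → 𝟙 (P? i ×-dec (blk π i Fin.≟ m)))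
    fibre m with P? m ×-dec (blk π m Fin.≟ m)
    ... | yes (p , eq) = subst (k ∣_) (trans (blockSize≡ π m) (finSum-cong λ i →
            𝟙-cong (blk π i Fin.≟ m) (P? i ×-dec (blk π i Fin.≟ m)) (λ e → saturated (trans eq (sym e)) p , e) proj₂)) (k∣ p eq)
    ... | no ¬p = subst (k ∣_) (sym (finSum-zero λ i → 𝟙-no (P? i ×-dec (blk π i Fin.≟ m)) λ { (pi , refl) →
            ¬p (saturated (sym (same-blk π i)) pi , same-blk π i) })) (k ∣0)

-- Positions on a circle and the rotation of noncrossing colourings

%-apart : ∀ {n} .{{_ : NonZero n}} {lo a b} → lo ≤ a → a % n ≡ b % n → a / n < b / n → lo + n ≤ b
%-apart {n} {lo} {a} {b} lo≤a eq q< = begin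
  lo + n                    ≤⟨ +-monoˡ-≤ n lo≤a ⟩
  a + n                     ≡⟨ cong (_+ n) (m≡m%n+[m/n]*n a n) ⟩
  a % n + a / n * n + n     ≡⟨ +-assoc (a % n) _ n ⟩
  a % n + (a / n * n + n)   ≡⟨ cong₂ _+_ eq (+-comm (a / n * n) n) ⟩
  b % n + suc (a / n) * n   ≤⟨ +-monoʳ-≤ (b % n) (*-monoˡ-≤ n q<) ⟩
  b % n + b / n * n         ≡⟨ m≡m%n+[m/n]*n b n ⟨
  b ∎
  where open ≤-Reasoning

%-injective : ∀ {n} .{{_ : NonZero n}} lo {a b} → lo ≤ a → a < lo + n → lo ≤ b → b < lo + n → a % n ≡ b % n → a ≡ b
%-injective {n} lo {a} {b} lo≤a a< lo≤b b< eq with <-cmp (a / n) (b / n)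
... | tri≈ _ q≡ _ = trans (m≡m%n+[m/n]*n a n) (trans (cong₂ (λ r q → r + q * n) eq q≡) (sym (m≡m%n+[m/n]*n b n)))
... | tri< q< _ _ = contradiction b< (≤⇒≯ (%-apart lo≤a eq q<))
... | tri> _ _ q> = contradiction a< (≤⇒≯ (%-apart lo≤b (sym eq) q>))

module Cyclic (N : ℕ) .{{_ : NonZero N}} where

  mod-period : ∀ x → (x + N) mod N ≡ x mod N
  mod-period x = fromℕ<-cong ((x + N) % N) (x % N) ([m+n]%n≡m%n x N) (m%n<n (x + N) N) (m%n<n x N)

  mod-toℕ : ∀ i → toℕ i mod N ≡ i
  mod-toℕ i = toℕ-injective (trans (toℕ-fromℕ< (m%n<n (toℕ i) N)) (m<n⇒m%n≡m (toℕ<n i)))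

  finSum-cyclic : ∀ (f : Fin N → ℕ) A → finSum f ≡ rangeSum (λ x → f (x mod N)) A N
  finSum-cyclic f A = trans (finSum-cong λ i → cong f (sym (mod-toℕ i)))
    (trans (finSum-toℕ (λ x → f (x mod N)) 0 N) (sym (rangeSum-rotate (λ x → cong f (mod-period x)) A)))

  module _ {X : Set} (colour : Fin N → X) where

    infix 4 _∼_
    _∼_ : ℕ → ℕ → Set
    x ∼ y = colour (x mod N) ≡ colour (y mod N)

    NoncrossingFrom : ℕ → Set
    NoncrossingFrom A = ∀ {a b c d} → A ≤ a → a < b → b < c → c < d → d < A + N → a ∼ c → b ∼ d → a ∼ b

    -- Only a quadruple ending at the new position `A + N` needs an argument. That position is a
    -- copy of `A`, so the old condition applies to `A`, `a`, `b`, `c`.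
    noncrossing-suc : ∀ {A} → NoncrossingFrom A → NoncrossingFrom (suc A)
    noncrossing-suc {A} nc {a} {b} {c} {d} A<a a<b b<c c<d d<1+B ac bd with m<1+n⇒m<n∨m≡n d<1+B
    ... | inj₁ d<B  = nc (<⇒≤ A<a) a<b b<c c<d d<B ac bd
    ... | inj₂ refl = sym (trans (trans bd A+N∼A) (nc ≤-refl A<a a<b b<c c<d (trans (sym A+N∼A) (sym bd)) ac))
      where
      A+N∼A : A + N ∼ A
      A+N∼A = cong colour (mod-period A)

    noncrossing-+ : ∀ {A} d → NoncrossingFrom A → NoncrossingFrom (d + A)
    noncrossing-+ zero    nc = nc
    noncrossing-+ (suc d) nc = noncrossing-suc (noncrossing-+ d nc)

    -- Windows only move forwards, so the window is moved on to `N`, which is a copy of 0.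
    noncrossing-start : ∀ {A} → A ≤ N → NoncrossingFrom A → NoncrossingFrom 0
    noncrossing-start {A} A≤N nc {a} {b} {c} {d} _ a<b b<c c<d d<N ac bd =
      trans (sym (per a)) (trans (nc′ (m≤n+m N a) (+-monoˡ-< N a<b) (+-monoˡ-< N b<c) (+-monoˡ-< N c<d) (+-monoˡ-< N d<N)
        (trans (per a) (trans ac (sym (per c)))) (trans (per b) (trans bd (sym (per d))))) (per b))
      where
      per : ∀ x → x + N ∼ x
      per x = cong colour (mod-period x)
      nc′ : NoncrossingFrom N
      nc′ = subst NoncrossingFrom (m∸n+n≡m A≤N) (noncrossing-+ (N ∸ A) nc)

    noncrossing-fin : NoncrossingFrom 0 → ∀ {a b c d : Fin N} → a Fin.< b → b Fin.< c → c Fin.< d →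
      colour a ≡ colour c → colour b ≡ colour d → colour a ≡ colour b
    noncrossing-fin nc {a} {b} {c} {d} a<b b<c c<d ac bd =
      subst₂ (λ u v → colour u ≡ colour v) (mod-toℕ a) (mod-toℕ b) (nc z≤n a<b b<c c<d (toℕ<n d)
        (subst₂ (λ u v → colour u ≡ colour v) (sym (mod-toℕ a)) (sym (mod-toℕ c)) ac)
        (subst₂ (λ u v → colour u ≡ colour v) (sym (mod-toℕ b)) (sym (mod-toℕ d)) bd))

    fin-noncrossing : (∀ {a b c d : Fin N} → a Fin.< b → b Fin.< c → c Fin.< d →
      colour a ≡ colour c → colour b ≡ colour d → colour a ≡ colour b) → ∀ A → NoncrossingFrom A
    fin-noncrossing nc A = subst NoncrossingFrom (+-identityʳ A) (noncrossing-+ A λ _ a<b b<c c<d d<N ac bd →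
      nc (small a<b (<-trans b<c (<-trans c<d d<N))) (small b<c (<-trans c<d d<N)) (small c<d d<N) ac bd)
      where
      small : ∀ {x y} → x < y → y < N → (x mod N) Fin.< (y mod N)
      small {x} {y} x<y y<N = subst₂ _<_
        (sym (trans (toℕ-fromℕ< (m%n<n x N)) (m<n⇒m%n≡m (<-trans x<y y<N))))
        (sym (trans (toℕ-fromℕ< (m%n<n y N)) (m<n⇒m%n≡m y<N))) x<y

  module Window {A : ℕ} (A≤N : A ≤ N) where

    opaque
      rep : Fin N → ℕ
      rep i with A ≤? toℕ i
      ... | yes _ = toℕ i
      ... | no _  = toℕ i + N

      rep-in : ∀ i → A ≤ rep i × rep i < A + N
      rep-in i with A ≤? toℕ i
      ... | yes A≤i = A≤i , <-≤-trans (toℕ<n i) (m≤n+m N A)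
      ... | no A≰i  = ≤-trans A≤N (m≤n+m N (toℕ i)) , +-monoˡ-< N (≰⇒> A≰i)

      rep-mod : ∀ i → rep i mod N ≡ i
      rep-mod i with A ≤? toℕ i
      ... | yes _ = mod-toℕ i
      ... | no _  = trans (mod-period (toℕ i)) (mod-toℕ i)

      rep-cases : ∀ i → (A ≤ toℕ i × rep i ≡ toℕ i) ⊎ rep i ≡ toℕ i + N
      rep-cases i with A ≤? toℕ i
      ... | yes A≤i = inj₁ (A≤i , refl)
      ... | no _    = inj₂ refl

    rep-unique : ∀ {x} → A ≤ x → x < A + N → rep (x mod N) ≡ x
    rep-unique {x} A≤x x<B = %-injective A (proj₁ (rep-in (x mod N))) (proj₂ (rep-in (x mod N))) A≤x x<B
      (trans (sym (toℕ-fromℕ< (m%n<n (rep (x mod N)) N))) (trans (cong toℕ (rep-mod (x mod N))) (toℕ-fromℕ< (m%n<n x N))))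

-- The chain of a table of sizes

module ChainOf (V N′ k : ℕ) (size : ℕ → ℕ)
  (size-per : ∀ e → size (e + suc N′ * suc V) ≡ size e) where

  open Slots V public

  period : ℕ
  period = suc N′

  open Cyclic period public

  h : ℕ → ℕ
  h e = k * size e

  h-per : ∀ e → h (e + period * ℓ) ≡ h e
  h-per e = cong (k *_) (size-per e)

  lvl-per : ∀ e → lvl (e + period * ℓ) ≡ lvl e
  lvl-per e = cong (V ∸_) ([m+kn]%n≡m%n e period ℓ)

  open Machine ℓ lvl h public
  open Periodic period h-per lvl-per public

  -- Read in the second lap, which sees the blocks carried over from the first, and with slots
  -- reduced modulo one lap. No cut is involved, so the chain depends on the table alone.
  colour : ℕ → Fin period → Maybe ℕ
  colour j i = Maybe.map (_% M) (lab j (period + toℕ i))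

  chain : ℕ → Partition period
  chain j = kernel _≟ᴹ_ (colour j)

  size-slot : ∀ x t → size (slot (x % period) t) ≡ size (slot x t)
  size-slot x t = begin
    size (slot (x % period) t)                 ≡⟨ go (x / period) ⟨
    size (slot (x % period) t + x / period * M)     ≡⟨ cong size shift ⟩
    size (slot x t) ∎
    where
    open ≡-Reasoning
    go : ∀ c → size (slot (x % period) t + c * M) ≡ size (slot (x % period) t)
    go zero    = cong size (+-identityʳ _)
    go (suc c) = trans (cong size (trans (cong (slot (x % period) t +_) (+-comm M (c * M))) (sym (+-assoc _ (c * M) M))))
      (trans (size-per _) (go c))
    shift : slot (x % period) t + x / period * M ≡ slot x t
    shift = begin
      x % period * ℓ + (V ∸ t) + x / period * (period * ℓ)   ≡⟨ +-assoc (x % period * ℓ) _ _ ⟩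
      x % period * ℓ + (V ∸ t + x / period * (period * ℓ))   ≡⟨ cong (x % period * ℓ +_) (+-comm (V ∸ t) _) ⟩
      x % period * ℓ + (x / period * (period * ℓ) + (V ∸ t)) ≡⟨ +-assoc (x % period * ℓ) _ _ ⟨
      x % period * ℓ + x / period * (period * ℓ) + (V ∸ t)   ≡⟨ cong (λ z → x % period * ℓ + z + (V ∸ t)) (*-assoc (x / period) period ℓ) ⟨
      x % period * ℓ + x / period * period * ℓ + (V ∸ t)     ≡⟨ cong (_+ (V ∸ t)) (*-distribʳ-+ ℓ (x % period) (x / period * period)) ⟨
      (x % period + x / period * period) * ℓ + (V ∸ t)       ≡⟨ cong (λ z → slot z t) (m≡m%n+[m/n]*n x period) ⟨
      slot x t ∎

  -- z₀ + period is a position left over by the run, so the window of period positions after z₀ is self-contained.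
  module Cut (z₀ : ℕ) (z₀<N : z₀ < period) (nothing-z : lab 0 (z₀ + period) ≡ nothing) where

    A : ℕ
    A = suc z₀

    clean-B : Clean (A + period)
    clean-B = nothing⇒Clean nothing-z

    clean-A : Clean A
    clean-A = nothing⇒Clean (nothing-unshift nothing-z)

    open Window {A} z₀<N public

    label : ℕ → Fin period → Maybe ℕ
    label j i = lab j (rep i)

    label-mod : ∀ {j x} → A ≤ x → x < A + period → label j (x mod period) ≡ lab j x
    label-mod {j} A≤x x<B = cong (lab j) (rep-unique A≤x x<B)

    label-range : ∀ {j i e} → label j i ≡ just e → A * ℓ ≤ e × e < A * ℓ + M
    label-range {j} {i} {e} eq with A≤x , x<B ← rep-in i =
      Clean-lab clean-A A≤x eq ,
      <-≤-trans (proj₁ (lab-just eq)) (≤-trans (*-monoˡ-≤ ℓ x<B) (≤-reflexive (*-distribʳ-+ ℓ A period)))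

    -- A position of the window in the first lap is compared with its copy in the second; since the
    -- end of the window is clean, the two labels differ by exactly `M`. The other positions of the
    -- window are in the second lap already.
    colour-label : ∀ j i → colour j i ≡ Maybe.map (_% M) (label j i)
    colour-label j i with rep-cases i
    ... | inj₂ eq = cong (λ x → Maybe.map (_% M) (lab j x)) (trans (+-comm period (toℕ i)) (sym eq))
    ... | inj₁ (A≤i , eq) = begin
      Maybe.map (_% M) (lab j (period + toℕ i))              ≡⟨ cong (λ x → Maybe.map (_% M) (lab j x)) (+-comm period (toℕ i)) ⟩
      Maybe.map (_% M) (lab j (toℕ i + period))              ≡⟨ cong (Maybe.map (_% M)) (lab-shift-clean clean-B A≤i) ⟩
      Maybe.map (_% M) (Maybe.map (_+ M) (lab j (toℕ i)))    ≡⟨ reduce (lab j (toℕ i)) ⟩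
      Maybe.map (_% M) (lab j (toℕ i))                       ≡⟨ cong (λ x → Maybe.map (_% M) (lab j x)) eq ⟨
      Maybe.map (_% M) (label j i) ∎
      where
      open ≡-Reasoning
      reduce : ∀ m → Maybe.map (_% M) (Maybe.map (_+ M) m) ≡ Maybe.map (_% M) m
      reduce nothing  = refl
      reduce (just e) = cong just ([m+n]%n≡m%n e M)

    label⇒colour : ∀ {j i i′} → label j i ≡ label j i′ → colour j i ≡ colour j i′
    label⇒colour {j} {i} {i′} eq = trans (colour-label j i) (trans (cong (Maybe.map (_% M)) eq) (sym (colour-label j i′)))

    -- The labels of the window lie in a single period of slots, on which reduction modulo `M` is
    -- injective.
    colour⇒label : ∀ {j i i′} → colour j i ≡ colour j i′ → label j i ≡ label j i′
    colour⇒label {j} {i} {i′} eq = go (label j i) (label j i′) refl refl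
      (trans (sym (colour-label j i)) (trans eq (colour-label j i′)))
      where
      go : ∀ m m′ → label j i ≡ m → label j i′ ≡ m′ → Maybe.map (_% M) m ≡ Maybe.map (_% M) m′ → m ≡ m′
      go nothing  nothing   _ _ _ = refl
      go (just e) (just e′) l l′ eq with A≤e , e< ← label-range {j} {i} l | A≤e′ , e′< ← label-range {j} {i′} l′ =
        cong just (%-injective {M} (A * ℓ) A≤e e< A≤e′ e′< (just-injective eq))

    same⇒label : ∀ {j i i′} → SameBlock (chain j) i i′ → label j i ≡ label j i′
    same⇒label {j} eq = colour⇒label {j} (same-kernel _≟ᴹ_ (colour j) eq)

    label⇒same : ∀ {j i i′} → label j i ≡ label j i′ → SameBlock (chain j) i i′
    label⇒same {j} eq = kernel-same _≟ᴹ_ (colour j) (label⇒colour {j} eq)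

    label-blk : ∀ {j} i → label j (blk (chain j) i) ≡ label j i
    label-blk {j} i = same⇒label {j} (blk-idem (chain j) i)

    chain-noncrossing : ∀ j → Noncrossing (chain j)
    chain-noncrossing j a b c d a<b b<c c<d ac bd = label⇒same {j} (noncrossing-fin (label j)
      (noncrossing-start (label j) z₀<N from-A) a<b b<c c<d (same⇒label {j} ac) (same⇒label {j} bd))
      where
      from-A : NoncrossingFrom (label j) A
      from-A {a} {b} {c} {d} A≤a a<b b<c c<d d<B ac bd =
        trans (at A≤a a<B) (trans (lab-noncrossing j (<⇒≤ a<b) (<⇒≤ b<c) (<⇒≤ c<d)
          (trans (sym (at A≤a a<B)) (trans ac (at A≤c c<B))) (trans (sym (at A≤b b<B)) (trans bd (at (≤-trans A≤c (<⇒≤ c<d)) d<B))))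
          (sym (at A≤b b<B)))
        where
        at = label-mod {j}
        c<B = <-trans c<d d<B
        b<B = <-trans b<c c<B
        a<B = <-trans a<b b<B
        A≤b = ≤-trans A≤a (<⇒≤ a<b)
        A≤c = ≤-trans A≤b (<⇒≤ b<c)

    label-coarsen : ∀ {j j′ i i′} → j ≤ j′ → label j i ≡ label j i′ → label j′ i ≡ label j′ i′
    label-coarsen {j} {j′} {i} {i′} j≤j′ eq with ≤-total (rep i) (rep i′)
    ... | inj₁ le = lab-coarsen j≤j′ le eq
    ... | inj₂ le = sym (lab-coarsen j≤j′ le (sym eq))

    chain-⊑ : ∀ {j j′} → j ≤ j′ → chain j ⊑ chain j′
    chain-⊑ {j} {j′} j≤j′ i i′ eq = label⇒same {j′} (label-coarsen {j} {j′} j≤j′ (same⇒label {j} eq))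

    label-none : ∀ {j i} → label 0 i ≡ nothing → label j i ≡ nothing
    label-none = lab-none

    special : Fin period
    special = (z₀ + period) mod period

    label-special : ∀ j → label j special ≡ nothing
    label-special j = trans (label-mod {j} (≤-trans z₀<N (m≤n+m period z₀)) ≤-refl) (lab-none nothing-z)

    blockSize-label : ∀ j i → blockSize (chain j) (blk (chain j) i) ≡ finSum (λ i′ → 𝟙 (label j i′ ≟ᴹ label j i))
    blockSize-label j i = trans (blockSize≡ (chain j) _) (finSum-cong λ i′ →
      𝟙-cong (blk (chain j) i′ Fin.≟ blk (chain j) i) (label j i′ ≟ᴹ label j i) (same⇒label {j}) (label⇒same {j}))

    -- The slot is still full at `A` and is empty at the end of the window, so all its charges fall
    -- on positions of the window.
    finest-size : ∀ {i e} → label 0 i ≡ just e → blockSize (chain 0) (blk (chain 0) i) ≡ k * size e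
    finest-size {i} {e} eq with A≤e , e< ← label-range {0} {i} eq = begin
      blockSize (chain 0) (blk (chain 0) i)                     ≡⟨ blockSize-label 0 i ⟩
      finSum (λ i′ → 𝟙 (label 0 i′ ≟ᴹ label 0 i))               ≡⟨ cong (λ m → finSum (λ i′ → 𝟙 (label 0 i′ ≟ᴹ m))) eq ⟩
      finSum (λ i′ → 𝟙 (label 0 i′ ≟ᴹ just e))                  ≡⟨ finSum-cyclic (λ i′ → 𝟙 (label 0 i′ ≟ᴹ just e)) A ⟩
      rangeSum (λ x → 𝟙 (label 0 (x mod period) ≟ᴹ just e)) A period
        ≡⟨ rangeSum-cong A period (λ x A≤x x<B → cong (λ m → 𝟙 (m ≟ᴹ just e)) (label-mod A≤x x<B)) ⟩
      rangeSum (λ x → 𝟙 (lab 0 x ≟ᴹ just e)) A period                ≡⟨ +-identityʳ _ ⟨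
      rangeSum (λ x → 𝟙 (lab 0 x ≟ᴹ just e)) A period + 0
        ≡⟨ cong (rangeSum (λ x → 𝟙 (lab 0 x ≟ᴹ just e)) A period +_) (clean-B (subst (e <_) (sym (*-distribʳ-+ ℓ A period)) e<)) ⟨
      rangeSum (λ x → 𝟙 (lab 0 x ≟ᴹ just e)) A period + S (A + period) e  ≡⟨ S-count e A period ⟩
      S A e                                                     ≡⟨ S-untouched A A≤e ⟩
      k * size e ∎
      where open ≡-Reasoning

    finest-∣ : ∀ {m} → ¬ label 0 m ≡ nothing → blk (chain 0) m ≡ m → k ∣ blockSize (chain 0) m
    finest-∣ {m} ≢nothing eq = go (label 0 m) refl
      where
      go : ∀ l → label 0 m ≡ l → k ∣ blockSize (chain 0) m
      go nothing  l≡ = contradiction l≡ ≢nothing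
      go (just e) l≡ = subst (k ∣_) (sym (trans (cong (blockSize (chain 0)) (sym eq)) (finest-size l≡))) (m∣m*n (size e))

    -- A union of labelled blocks of level `j` is a union of finest blocks, and these are labelled
    -- too, since a position without label at level 0 has none at any level.
    labelled-∣ : ∀ j {P : Pred (Fin period) 0ℓ} (P? : Decidable P) → (∀ {i i′} → label j i ≡ label j i′ → P i → P i′) →
      (∀ {i} → P i → ¬ label j i ≡ nothing) → k ∣ finSum (𝟙 ∘ P?)
    labelled-∣ j P? resp nonspecial = saturated-∣ (chain 0) P?
      (λ same → resp (label-coarsen {0} {j} z≤n (same⇒label {0} same)))
      λ p → finest-∣ λ eq → nonspecial p (label-none {j} eq)

    module _ (k∤N : ¬ k ∣ period) where

      nonspecial⇒∣ : ∀ {j m} → ¬ label j m ≡ nothing → k ∣ blockSize (chain j) (blk (chain j) m)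
      nonspecial⇒∣ {j} {m} ≢nothing = subst (k ∣_) (sym (blockSize-label j m))
        (labelled-∣ j (λ i → label j i ≟ᴹ label j m) (λ eq p → trans (sym eq) p) λ p eq → ≢nothing (trans (sym p) eq))

      -- The complement of the special block has size divisible by `k`, and `period` is not
      -- divisible by `k`.
      special⇒∤ : ∀ {j m} → label j m ≡ nothing → ¬ k ∣ blockSize (chain j) (blk (chain j) m)
      special⇒∤ {j} {m} eq k∣ = k∤N (subst (k ∣_) total (∣m∣n⇒∣m+n
        (subst (k ∣_) (trans (blockSize-label j m) (cong (λ l → finSum (λ i → 𝟙 (label j i ≟ᴹ l))) eq)) k∣)
        (labelled-∣ j (λ i → ¬? (label j i ≟ᴹ nothing)) (λ eq ≢ → ≢ ∘ trans eq) id)))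
        where
        total : finSum (λ i → 𝟙 (label j i ≟ᴹ nothing)) + finSum (λ i → 𝟙 (¬? (label j i ≟ᴹ nothing))) ≡ period
        total = trans (sym (finSum-+ (λ i → 𝟙 (label j i ≟ᴹ nothing)) (λ i → 𝟙 (¬? (label j i ≟ᴹ nothing)))))
          (trans (finSum-cong (λ i → either (label j i ≟ᴹ nothing))) (finSum-one period))
          where
          either : ∀ {P : Set} (P? : Dec P) → 𝟙 P? + 𝟙 (¬? P?) ≡ 1
          either (yes _) = refl
          either (no _)  = refl

      chain-bkNot : ∀ j → bkNot k (chain j) ≡ 1
      chain-bkNot j = trans (numBlocks≡ π (λ x → ¬? (k ∣? x)))
        (finSum-unique (λ m → (blk π m Fin.≟ m) ×-dec ¬? (k ∣? blockSize π m)) (blk π special)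
          (blk-idem π special , special⇒∤ {j} (label-special j)) unique)
        where
        π = chain j
        unique : ∀ m → blk π m ≡ m × ¬ k ∣ blockSize π m → m ≡ blk π special
        unique m (eq , k∤) = trans (sym eq) (label⇒same {j} (trans nothing-m (sym (label-special j))))
          where
          nothing-m : label j m ≡ nothing
          nothing-m with label j m ≟ᴹ nothing
          ... | yes l≡ = l≡
          ... | no  l≢ = contradiction (subst (λ b → k ∣ blockSize π b) eq (nonspecial⇒∣ {j} l≢)) k∤

    module _ (0<k : 0 < k) where

      0<size⇒0<h : ∀ {e} → 0 < size e → 0 < h e
      0<size⇒0<h pos = *-mono-≤ 0<k pos

      labelled⇒0<size : ∀ {j i e} → label j i ≡ just e → 0 < size e
      labelled⇒0<size {j} {i} {e} eq with size e in s≡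
      ... | suc _ = z<s
      ... | zero  = contradiction (trans (cong (k *_) s≡) (*-zeroʳ k))
        (m<n⇒n≢0 (subst (0 <_) (S-untouched 0 z≤n) (S-pos {0} {rep i} z≤n (proj₁ (proj₂ (lab-just eq))))))

      module _ {Q : Pred ℕ 0ℓ} (Q? : Decidable Q) (¬Q0 : ¬ Q 0) (j : ℕ) where
        private
          π = chain j

          -- The size at the slot that names the block. For `j > 0` the block itself may be larger,
          -- having absorbed finer ones. The special block gets 0 and is excluded by `¬Q0`.
          value : Fin period → ℕ
          value m = maybe size 0 (label j m)

          R? : ∀ m → Dec (blk π m ≡ m × Q (value m))
          R? m = (blk π m Fin.≟ m) ×-dec Q? (value m)

          level : Fin period → Fin ℓ
          level m = fromℕ< (s≤s (lvl≤V (fromMaybe 0 (label j m))))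

          position : Fin period → Fin period
          position m = (fromMaybe 0 (label j m) / ℓ) mod period

          labelled : ∀ {m} → Q (value m) → ∃[ e ] label j m ≡ just e × Q (size e)
          labelled {m} q with label j m
          ... | nothing = contradiction q ¬Q0
          ... | just e  = e , refl , q

          toℕ-level : ∀ {m e} → label j m ≡ just e → toℕ (level m) ≡ lvl e
          toℕ-level {m} eq = trans (toℕ-fromℕ< _) (cong (lvl ∘ fromMaybe 0) eq)

          toℕ-position : ∀ {m e} → label j m ≡ just e → toℕ (position m) ≡ e / ℓ % period
          toℕ-position {m} eq = trans (toℕ-fromℕ< _) (cong (λ l → fromMaybe 0 l / ℓ % period) eq)

          pos-range : ∀ {m e} → label j m ≡ just e → A ≤ e / ℓ × e / ℓ < A + period
          pos-range {m} {e} eq with A≤e , e< ← label-range {j} {m} eq with q≤e , e<q ← proj₂ (pos-of e) =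
            ≮⇒≥ (λ q<A → <⇒≱ e<q (≤-trans (*-monoˡ-≤ ℓ q<A) A≤e)) ,
            ≰⇒> (λ B≤q → <⇒≱ e< (≤-trans (≤-reflexive (sym (*-distribʳ-+ ℓ A period))) (≤-trans (*-monoˡ-≤ ℓ B≤q) q≤e)))

        -- A block corresponds to the table entry at the level and the position of its slot. Entries
        -- on the right are indexed by positions of [0, period), those of slots in the window by
        -- residues, hence the reduction in `position`.
        count-blocks : finSum (𝟙 ∘ R?) ≡
          finSum {ℓ} (λ t → finSum {period} (λ q → 𝟙 ((j ≤? toℕ t) ×-dec Q? (size (slot (toℕ q) (toℕ t))))))
        count-blocks = trans (finSum-fibres R? level) (finSum-cong {ℓ} {g = λ t → finSum {period} (λ q → 𝟙 ((j ≤? toℕ t) ×-dec Q? (size (slot (toℕ q) (toℕ t)))))} at-level)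
          where
          at-level : ∀ t → finSum (λ m → 𝟙 (R? m ×-dec (level m Fin.≟ t))) ≡
            finSum {period} (λ q → 𝟙 ((j ≤? toℕ t) ×-dec Q? (size (slot (toℕ q) (toℕ t)))))
          at-level t = finSum-bijection (λ m → R? m ×-dec (level m Fin.≟ t))
            (λ q → (j ≤? toℕ t) ×-dec Q? (size (slot (toℕ q) (toℕ t)))) position maps inj surj
            where
            T = toℕ t
            T≤V : T ≤ V
            T≤V = ≤-pred (toℕ<n t)
            maps : ∀ {m} → (blk π m ≡ m × Q (value m)) × level m ≡ t → j ≤ T × Q (size (slot (toℕ (position m)) T))
            maps {m} ((_ , q) , lev) with e , eq , qe ← labelled {m} q =
              subst (j ≤_) lvl≡ (proj₂ (proj₂ (lab-just eq))) , subst Q (sym (begin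
                size (slot (toℕ (position m)) T) ≡⟨ cong (λ x → size (slot x T)) (toℕ-position {m} eq) ⟩
                size (slot (e / ℓ % period) T)        ≡⟨ size-slot (e / ℓ) T ⟩
                size (slot (e / ℓ) T)            ≡⟨ cong (λ x → size (slot (e / ℓ) x)) lvl≡ ⟨
                size (slot (e / ℓ) (lvl e))      ≡⟨ cong size (slot-pos-lvl e) ⟩
                size e ∎)) qe
              where
              open ≡-Reasoning
              lvl≡ : lvl e ≡ T
              lvl≡ = trans (sym (toℕ-level {m} eq)) (cong toℕ lev)
            inj : ∀ {m m′} → (blk π m ≡ m × Q (value m)) × level m ≡ t → (blk π m′ ≡ m′ × Q (value m′)) × level m′ ≡ t →
              position m ≡ position m′ → m ≡ m′
            inj {m} {m′} ((b , q) , lev) ((b′ , q′) , lev′) pos≡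
              with e , eq , _ ← labelled {m} q | e′ , eq′ , _ ← labelled {m′} q′
              with A≤p , p<B ← pos-range {m} eq | A≤p′ , p′<B ← pos-range {m′} eq′ =
              trans (sym b) (trans (label⇒same {j} (trans eq (trans (cong just e≡e′) (sym eq′)))) b′)
              where
              p≡ : e / ℓ ≡ e′ / ℓ
              p≡ = %-injective {period} A A≤p p<B A≤p′ p′<B
                (trans (sym (toℕ-position {m} eq)) (trans (cong toℕ pos≡) (toℕ-position {m′} eq′)))
              e≡e′ : e ≡ e′
              e≡e′ = trans (sym (slot-pos-lvl e)) (trans (cong₂ slot p≡
                (trans (sym (toℕ-level {m} eq)) (trans (cong toℕ (trans lev (sym lev′))) (toℕ-level {m′} eq′)))) (slot-pos-lvl e′))
            surj : ∀ {q} → j ≤ T × Q (size (slot (toℕ q) T)) →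
              ∃[ m ] ((blk π m ≡ m × Q (value m)) × level m ≡ t) × position m ≡ q
            surj {q} (j≤T , qq) with A≤x , x<B ← rep-in q =
              m , ((blk-idem π i , subst (Q ∘ maybe size 0) (sym label-m) qe) ,
                toℕ-injective (trans (toℕ-level {m} label-m) (lvl-slot x T≤V))) ,
              toℕ-injective (trans (toℕ-position {m} label-m) (trans (cong (_% period) pos≡) rep%))
              where
              x = rep q
              e = slot x T
              rep% : x % period ≡ toℕ q
              rep% = trans (sym (toℕ-fromℕ< (m%n<n x period))) (cong toℕ (rep-mod q))
              qe : Q (size e)
              qe = subst Q (trans (cong (λ y → size (slot y T)) (sym rep%)) (size-slot x T)) qq
              0<size : 0 < size e
              0<size = n≢0⇒n>0 λ eq → ¬Q0 (subst Q eq qe)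
              first : lab (lvl e) x ≡ just e
              first = lab-first lvl-anti h x (slot≥ x T) (slot< x T) (0<size⇒0<h 0<size)
              -- A nonempty slot does name a block of `chain j`: where it receives its final charge
              -- it is the label at every level up to its own.
              anc = anchor (<⇒≤ x<B) (proj₁ (proj₂ (lab-just first))) (clean-B (<-≤-trans (slot< x T) (*-monoˡ-≤ ℓ x<B)))
              l = proj₁ anc
              i = l mod period
              m = blk π i
              label-m : label j m ≡ just e
              label-m = trans (label-blk {j} i) (trans (label-mod {j} (≤-trans A≤x (proj₁ (proj₂ anc))) (proj₁ (proj₂ (proj₂ anc))))
                (anchor-lab (proj₂ (proj₂ (proj₂ (proj₂ anc)))) (subst (j ≤_) (sym (lvl-slot x T≤V)) j≤T)))
              pos≡ : e / ℓ ≡ x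
              pos≡ = proj₁ (slot-injective {e / ℓ} {lvl e} {x} {T} (lvl≤V e) T≤V (slot-pos-lvl e))

      module _ (k∤N : ¬ k ∣ period) where

        chain-bk′ : ∀ j → bk′ k (chain j) ≡
          finSum {ℓ} (λ t → finSum {period} (λ q → 𝟙 ((j ≤? toℕ t) ×-dec (0 <? size (slot (toℕ q) (toℕ t))))))
        chain-bk′ j = trans (numBlocks≡ (chain j) (k ∣?_)) (trans (finSum-cong λ m →
          𝟙-cong ((blk (chain j) m Fin.≟ m) ×-dec (k ∣? blockSize (chain j) m))
            ((blk (chain j) m Fin.≟ m) ×-dec (0 <? maybe size 0 (label j m))) to from)
          (count-blocks (0 <?_) (λ ()) j))
          where
          to : ∀ {m} → blk (chain j) m ≡ m × k ∣ blockSize (chain j) m → blk (chain j) m ≡ m × 0 < maybe size 0 (label j m)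
          to {m} (eq , k∣) = eq , go (label j m) refl
            where
            go : ∀ l → label j m ≡ l → 0 < maybe size 0 l
            go nothing  l≡ = contradiction (subst (λ b → k ∣ blockSize (chain j) b) (sym eq) k∣) (special⇒∤ k∤N {j} l≡)
            go (just e) l≡ = labelled⇒0<size {j} {m} l≡
          from : ∀ {m} → blk (chain j) m ≡ m × 0 < maybe size 0 (label j m) → blk (chain j) m ≡ m × k ∣ blockSize (chain j) m
          from {m} (eq , pos) = eq , subst (λ b → k ∣ blockSize (chain j) b) eq (nonspecial⇒∣ k∤N {j} {m} λ l≡ →
            contradiction (subst (λ l → 0 < maybe size 0 l) l≡ pos) λ ())

        chain-bkOfSize : ∀ s → bkOfSize k (chain 0) (suc s) ≡
          finSum {ℓ} (λ t → finSum {period} (λ q → 𝟙 ((0 ≤? toℕ t) ×-dec (size (slot (toℕ q) (toℕ t)) ≟ suc s))))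
        chain-bkOfSize s = trans (numBlocks≡ (chain 0) (_≟ k * suc s)) (trans (finSum-cong λ m →
          𝟙-cong ((blk (chain 0) m Fin.≟ m) ×-dec (blockSize (chain 0) m ≟ k * suc s))
            ((blk (chain 0) m Fin.≟ m) ×-dec (maybe size 0 (label 0 m) ≟ suc s)) to from)
          (count-blocks (_≟ suc s) (λ ()) 0))
          where
          to : ∀ {m} → blk (chain 0) m ≡ m × blockSize (chain 0) m ≡ k * suc s →
            blk (chain 0) m ≡ m × maybe size 0 (label 0 m) ≡ suc s
          to {m} (eq , bs≡) = eq , go (label 0 m) refl
            where
            go : ∀ l → label 0 m ≡ l → maybe size 0 l ≡ suc s
            go nothing  l≡ = contradiction (subst (k ∣_) (sym (trans (cong (blockSize (chain 0)) eq) bs≡)) (m∣m*n (suc s)))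
              (special⇒∤ k∤N {0} l≡)
            go (just e) l≡ = *-cancelˡ-≡ (size e) (suc s) k {{Data.Nat.>-nonZero 0<k}}
              (trans (sym (finest-size l≡)) (trans (cong (blockSize (chain 0)) eq) bs≡))
          from : ∀ {m} → blk (chain 0) m ≡ m × maybe size 0 (label 0 m) ≡ suc s →
            blk (chain 0) m ≡ m × blockSize (chain 0) m ≡ k * suc s
          from {m} (eq , v≡) = eq , go (label 0 m) refl v≡
            where
            go : ∀ l → label 0 m ≡ l → maybe size 0 l ≡ suc s → blockSize (chain 0) m ≡ k * suc s
            go (just e) l≡ v≡ = trans (cong (blockSize (chain 0)) (sym eq)) (trans (finest-size l≡) (cong (k *_) v≡))

-- Total demand and row sums of a table

sum≡finSum : ∀ {m} (v : Vec ℕ m) → sum v ≡ finSum (lookup v)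
sum≡finSum []      = refl
sum≡finSum (x ∷ v) = cong (x +_) (sum≡finSum v)

count≡finSum : ∀ {A : Set} {P : Pred A 0ℓ} (P? : Decidable P) {m} (v : Vec A m) →
  count P? v ≡ finSum (λ i → 𝟙 (P? (lookup v i)))
count≡finSum P? []      = refl
count≡finSum P? (x ∷ v) with does (P? x)
... | true  = cong suc (count≡finSum P? v)
... | false = count≡finSum P? v

tableCount≡finSum : ∀ {n l N} {Q : Pred ℕ 0ℓ} (Q? : Decidable Q) (f : Table n l N) →
  tableCount Q? f ≡ finSum (λ t → finSum (λ q → 𝟙 (Q? (val (lookup (lookup f t) q)))))
tableCount≡finSum Q? f = trans (sum≡finSum (map (count (Q? ∘ val)) f))
  (finSum-cong λ t → trans (lookup-map t (count (Q? ∘ val)) f) (count≡finSum (Q? ∘ val) (lookup f t)))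

finSum-* : ∀ {n} c (f : Fin n → ℕ) → finSum (λ i → c * f i) ≡ c * finSum f
finSum-* {zero}  c f = sym (*-zeroʳ c)
finSum-* {suc n} c f = trans (cong (c * f zero +_) (finSum-* c (f ∘ suc))) (sym (*-distribˡ-+ c (f zero) _))

-- Splits an entry into indicators of its possible sizes, so that the total over a table depends
-- only on the counts bᵢ.
val-bits : ∀ {n} (y : Maybe (Fin n)) → val y ≡ finSum {n} (λ i → suc (toℕ i) * 𝟙 (val y ≟ suc (toℕ i)))
val-bits {n} nothing  = sym (finSum-zero {n} λ i → *-zeroʳ (suc (toℕ i)))
val-bits {n} (just j) = sym (begin
  finSum {n} (λ i → suc (toℕ i) * 𝟙 (suc (toℕ j) ≟ suc (toℕ i)))  ≡⟨ finSum-cong (λ i → weight i (i Fin.≟ j)) ⟩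
  finSum {n} (λ i → suc (toℕ j) * 𝟙 (i Fin.≟ j))                  ≡⟨ finSum-* (suc (toℕ j)) (λ i → 𝟙 (i Fin.≟ j)) ⟩
  suc (toℕ j) * finSum {n} (λ i → 𝟙 (i Fin.≟ j))                  ≡⟨ cong (suc (toℕ j) *_) (finSum-δ j) ⟩
  suc (toℕ j) * 1                                                 ≡⟨ *-identityʳ _ ⟩
  suc (toℕ j) ∎)
  where
  open ≡-Reasoning
  weight : ∀ i (d : Dec (i ≡ j)) → suc (toℕ i) * 𝟙 (suc (toℕ j) ≟ suc (toℕ i)) ≡ suc (toℕ j) * 𝟙 d
  weight i (yes refl) = cong (suc (toℕ i) *_) (𝟙-yes (suc (toℕ j) ≟ suc (toℕ i)) refl)
  weight i (no i≢j)   = trans (cong (suc (toℕ i) *_) (𝟙-no (suc (toℕ j) ≟ suc (toℕ i))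
    λ eq → i≢j (sym (toℕ-injective (suc-injective eq))))) (trans (*-zeroʳ (suc (toℕ i))) (sym (*-zeroʳ (suc (toℕ j)))))

weight : ∀ {n} → Vec ℕ n → ℕ
weight bs = sum (zipWith _*_ (tabulate (λ i → suc (toℕ i))) bs)

weight≡finSum : ∀ {n} (bs : Vec ℕ n) → weight bs ≡ finSum (λ i → suc (toℕ i) * lookup bs i)
weight≡finSum bs = trans (sum≡finSum (zipWith _*_ (tabulate (λ i → suc (toℕ i))) bs)) (finSum-cong λ i →
  trans (lookup-zipWith _*_ i (tabulate (λ i → suc (toℕ i))) bs) (cong (_* lookup bs i) (lookup∘tabulate (λ i → suc (toℕ i)) i)))

finSum-mono : ∀ {n} {f g : Fin n → ℕ} → (∀ i → f i ≤ g i) → finSum f ≤ finSum g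
finSum-mono {zero}  f≤g = z≤n
finSum-mono {suc n} f≤g = +-mono-≤ (f≤g zero) (finSum-mono (f≤g ∘ suc))

sum≤weight : ∀ {n} (bs : Vec ℕ n) → sum bs ≤ weight bs
sum≤weight bs = ≤-trans (≤-reflexive (sum≡finSum bs)) (≤-trans (finSum-mono λ i → m≤m+n (lookup bs i) _)
  (≤-reflexive (sym (weight≡finSum bs))))

total-val : ∀ {n l N} (f : Table n l N) (bs : Vec ℕ n) → (∀ i → tableCount (_≟ suc (toℕ i)) f ≡ lookup bs i) →
  finSum (λ t → finSum (λ q → val (lookup (lookup f t) q))) ≡ weight bs
total-val {n} {l} {N} f bs occ = begin
  finSum {l} (λ t → finSum {N} (λ q → v t q))
    ≡⟨ finSum-cong (λ t → trans (finSum-cong (λ q → val-bits (lookup (lookup f t) q))) (finSum-swap (bit t))) ⟩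
  finSum {l} (λ t → finSum {n} (λ i → finSum {N} (λ q → bit t q i)))
    ≡⟨ finSum-swap (λ t i → finSum (λ q → bit t q i)) ⟩
  finSum {n} (λ i → finSum {l} (λ t → finSum {N} (λ q → bit t q i)))
    ≡⟨ finSum-cong (λ i → trans (finSum-cong (λ t → finSum-* (suc (toℕ i)) (λ q → 𝟙 (v t q ≟ suc (toℕ i)))))
         (trans (finSum-* (suc (toℕ i)) (λ t → finSum (λ q → 𝟙 (v t q ≟ suc (toℕ i)))))
           (cong (suc (toℕ i) *_) (trans (sym (tableCount≡finSum (_≟ suc (toℕ i)) f)) (occ i))))) ⟩
  finSum {n} (λ i → suc (toℕ i) * lookup bs i)
    ≡⟨ weight≡finSum bs ⟨
  weight bs ∎
  where
  open ≡-Reasoning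
  v : Fin l → Fin N → ℕ
  v t q = val (lookup (lookup f t) q)
  bit : Fin l → Fin N → Fin n → ℕ
  bit t q i = suc (toℕ i) * 𝟙 (v t q ≟ suc (toℕ i))

-- Slots of one position run from the coarsest level down, rows of a table from level 0 up.
rangeSum-reverse : ∀ (g : ℕ → ℕ) V → finSum {suc V} (λ t → g (V ∸ toℕ t)) ≡ rangeSum g 0 (suc V)
rangeSum-reverse g zero    = refl
rangeSum-reverse g (suc V) = trans (cong (g (suc V) +_) (rangeSum-reverse g V))
  (trans (+-comm (g (suc V)) _) (sym (rangeSum-∷ʳ g 0 (suc V))))

rangeSum-++ : ∀ g lo a b → rangeSum g lo (a + b) ≡ rangeSum g lo a + rangeSum g (lo + a) b
rangeSum-++ g lo zero    b = cong (λ x → rangeSum g x b) (sym (+-identityʳ lo))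
rangeSum-++ g lo (suc a) b = trans (cong (g lo +_) (trans (rangeSum-++ g (suc lo) a b)
  (cong (λ x → rangeSum g (suc lo) a + rangeSum g x b) (sym (+-suc lo a))))) (sym (+-assoc (g lo) _ _))

rangeSum-shift : ∀ g lo n → rangeSum g lo n ≡ rangeSum (λ x → g (lo + x)) 0 n
rangeSum-shift g lo n = trans (sym (finSum-toℕ g lo n)) (finSum-toℕ (λ x → g (lo + x)) 0 n)

rangeSum-slots : ∀ V (g : ℕ → ℕ) N → rangeSum g 0 (N * suc V) ≡
  finSum {N} (λ q → finSum {suc V} (λ t → g (Slots.slot V (toℕ q) (toℕ t))))
rangeSum-slots V g N = trans (blocks g N) (finSum-cong {N} λ q →
  trans (rangeSum-shift g (toℕ q * suc V) (suc V)) (sym (rangeSum-reverse (λ x → g (toℕ q * suc V + x)) V)))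
  where
  blocks : ∀ g N → rangeSum g 0 (N * suc V) ≡ finSum {N} (λ q → rangeSum g (toℕ q * suc V) (suc V))
  blocks g zero    = refl
  blocks g (suc N) = begin
    rangeSum g 0 (suc V + N * suc V)
      ≡⟨ rangeSum-++ g 0 (suc V) (N * suc V) ⟩
    rangeSum g 0 (suc V) + rangeSum g (suc V) (N * suc V)
      ≡⟨ cong (rangeSum g 0 (suc V) +_) (trans (rangeSum-shift g (suc V) (N * suc V)) (blocks (λ x → g (suc V + x)) N)) ⟩
    rangeSum g 0 (suc V) + finSum {N} (λ q → rangeSum (λ x → g (suc V + x)) (toℕ q * suc V) (suc V))
      ≡⟨ cong (rangeSum g 0 (suc V) +_) (finSum-cong {N} λ q → trans (rangeSum-shift (λ x → g (suc V + x)) (toℕ q * suc V) (suc V))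
           (trans (rangeSum-cong 0 (suc V) (λ x _ _ → cong g (sym (+-assoc (suc V) (toℕ q * suc V) x))))
             (sym (rangeSum-shift g (suc V + toℕ q * suc V) (suc V))))) ⟩
    finSum {suc N} (λ q → rangeSum g (toℕ q * suc V) (suc V)) ∎
    where open ≡-Reasoning

-- The number of nonempty entries in the rows from `j` on when `cs` lists the row counts: these are
-- the blocks of size divisible by k at level `j`.
tailSum : ∀ {m} → Vec ℕ m → ℕ → ℕ
tailSum cs       zero    = sum cs
tailSum []       (suc j) = 0
tailSum (c ∷ cs) (suc j) = tailSum cs j

gate : ∀ {P : Set} → Dec P → ℕ → ℕ
gate P? x = if does P? then x else 0

gate-cong : ∀ {P Q : Set} (P? : Dec P) (Q? : Dec Q) → (P → Q) → (Q → P) → ∀ x → gate P? x ≡ gate Q? x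
gate-cong (yes p) (yes q) _ _ x = refl
gate-cong (yes p) (no ¬q) f _ x = contradiction (f p) ¬q
gate-cong (no ¬p) (yes q) _ g x = contradiction (g q) ¬p
gate-cong (no ¬p) (no ¬q) _ _ x = refl

gate-count : ∀ {P : Set} (P? : Dec P) {n} {R : Pred (Fin n) 0ℓ} (R? : Decidable R) →
  finSum (λ q → 𝟙 (P? ×-dec R? q)) ≡ gate P? (finSum (𝟙 ∘ R?))
gate-count (yes _) R? = refl
gate-count (no _) {n} R? = finSum-zero {n} {λ _ → 0} λ _ → refl

tailSum≡finSum : ∀ {m} (cs : Vec ℕ m) j → finSum {m} (λ t → gate (j ≤? toℕ t) (lookup cs t)) ≡ tailSum cs j
tailSum≡finSum cs       zero    = sym (sum≡finSum cs)
tailSum≡finSum []       (suc j) = refl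
tailSum≡finSum {suc m} (c ∷ cs) (suc j) = trans
  (finSum-cong {m} λ t → gate-cong (suc j ≤? suc (toℕ t)) (j ≤? toℕ t) ≤-pred s≤s (lookup cs t)) (tailSum≡finSum cs j)

-- Rank jumps from row counts

module _ (n k r : ℕ) where

  ranks : ∀ {m} → Vec ℕ m → Vec ℕ (suc m)
  ranks cs = tabulate (λ i → n ∸ tailSum cs (toℕ i)) ∷ʳ n

  -- `diffs` compares two entries at a time, so the head has to be exposed before it computes. For
  -- empty `cs` it is the closing entry `n`, the rank of the maximum.
  ranks-head : ∀ {m} (cs : Vec ℕ m) → ∃[ xs ] ranks cs ≡ (n ∸ sum cs) ∷ xs
  ranks-head []       = [] , refl
  ranks-head (c ∷ cs) = _ , refl

  ∸-step : ∀ c d → c + d ≤ n → (n ∸ d) ∸ (n ∸ (c + d)) ≡ c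
  ∸-step c d c+d≤n = begin
    (n ∸ d) ∸ (n ∸ (c + d))  ≡⟨ cong (λ z → (n ∸ d) ∸ (n ∸ z)) (+-comm c d) ⟩
    (n ∸ d) ∸ (n ∸ (d + c))  ≡⟨ cong ((n ∸ d) ∸_) (∸-+-assoc n d c) ⟨
    (n ∸ d) ∸ ((n ∸ d) ∸ c)  ≡⟨ m∸[m∸n]≡n (m+n≤o⇒m≤o∸n c c+d≤n) ⟩
    c ∎
    where open ≡-Reasoning

  diffs-ranks : ∀ {m} (cs : Vec ℕ m) → sum cs ≤ n → diffs n k r (ranks cs) ≡ cs
  diffs-ranks []       _   = refl
  diffs-ranks (c ∷ cs) le with ranks cs | ranks-head cs | diffs-ranks cs (m+n≤o⇒n≤o c le)
  ... | _ | xs , refl | ih = cong₂ _∷_ (∸-step c (sum cs) le) ih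

  rankJump-ranks : ∀ {m} (cs : Vec ℕ m) → sum cs ≤ n → diffs n k r (0 ∷ ranks cs) ≡ (n ∸ sum cs) ∷ cs
  rankJump-ranks cs le with ranks cs | ranks-head cs | diffs-ranks cs le
  ... | _ | xs , refl | ih = cong ((n ∸ sum cs) ∷_) ih

lookup-ext : ∀ {A : Set} {m} {v w : Vec A m} → (∀ i → lookup v i ≡ lookup w i) → v ≡ w
lookup-ext {v = []}    {[]}    eq = refl
lookup-ext {v = x ∷ v} {y ∷ w} eq = cong₂ _∷_ (eq zero) (lookup-ext (eq ∘ suc))

val-injective : ∀ {n} {x y : Maybe (Fin n)} → val x ≡ val y → x ≡ y
val-injective {x = nothing} {nothing} _  = refl
val-injective {x = just i}  {just j}  eq = cong just (toℕ-injective (suc-injective eq))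

unval : ∀ {n} v → v ≤ n → Maybe (Fin n)
unval zero    _   = nothing
unval (suc v) v<n = just (fromℕ< v<n)

val-unval : ∀ {n} v (v≤n : v ≤ n) → val (unval v v≤n) ≡ v
val-unval zero    _   = refl
val-unval (suc v) v<n = cong suc (toℕ-fromℕ< v<n)

-- The chain of a table and its block counts

module TableChain {n : ℕ} (V N′ k : ℕ) (f : Table n (suc V) (suc N′)) where

  entry : Fin (suc V) → Fin (suc N′) → ℕ
  entry t q = val (lookup (lookup f t) q)

  size : ℕ → ℕ
  size e = entry (fromℕ< (s≤s (Slots.lvl≤V V e))) ((e / suc V) mod (suc N′))

  size-per : ∀ e → size (e + suc N′ * suc V) ≡ size e
  size-per e = cong₂ entry (fromℕ<-cong _ _ (cong (V ∸_) ([m+kn]%n≡m%n e (suc N′) (suc V))) _ _)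
    (trans (cong (_mod suc N′) shift) (Cyclic.mod-period (suc N′) (e / suc V)))
    where
    shift : (e + suc N′ * suc V) / suc V ≡ e / suc V + suc N′
    shift = trans (+-distrib-/-∣ʳ e (n∣m*n (suc N′))) (cong (e / suc V +_) (m*n/n≡m (suc N′) (suc V)))

  open ChainOf V N′ k size size-per public

  size-at : ∀ x (t : Fin ℓ) → size (slot x (toℕ t)) ≡ entry t (x mod period)
  size-at x t = cong₂ entry (toℕ-injective (trans (toℕ-fromℕ< _) (lvl-slot x (≤-pred (toℕ<n t))))) (cong (_mod period) pos≡)
    where
    pos≡ : slot x (toℕ t) / ℓ ≡ x
    pos≡ = proj₁ (slot-injective {slot x (toℕ t) / ℓ} {lvl (slot x (toℕ t))} {x} {toℕ t}
      (lvl≤V (slot x (toℕ t))) (≤-pred (toℕ<n t)) (slot-pos-lvl (slot x (toℕ t))))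

  size-entry : ∀ q t → size (slot (toℕ q) (toℕ t)) ≡ entry t q
  size-entry q t = trans (size-at (toℕ q) t) (cong (entry t) (mod-toℕ q))

  demand : ∀ (bs : Vec ℕ n) → (∀ i → tableCount (_≟ suc (toℕ i)) f ≡ lookup bs i) → rangeSum h 0 M ≡ k * weight bs
  demand bs occ = begin
    rangeSum h 0 M                                                          ≡⟨ rangeSum-slots V h period ⟩
    finSum {period} (λ q → finSum {ℓ} (λ t → k * size (slot (toℕ q) (toℕ t))))
      ≡⟨ finSum-swap {period} {ℓ} (λ q t → k * size (slot (toℕ q) (toℕ t))) ⟩
    finSum {ℓ} (λ t → finSum {period} (λ q → k * size (slot (toℕ q) (toℕ t))))
      ≡⟨ finSum-cong {ℓ} (λ t → trans (finSum-cong {period} (λ q → cong (k *_) (size-entry q t))) (finSum-* k (entry t))) ⟩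
    finSum {ℓ} (λ t → k * finSum {period} (entry t))                         ≡⟨ finSum-* k (λ t → finSum (entry t)) ⟩
    k * finSum {ℓ} (λ t → finSum {period} (entry t))                         ≡⟨ cong (k *_) (total-val f bs occ) ⟩
    k * weight bs ∎
    where open ≡-Reasoning

  level-count : ∀ {Q : Pred ℕ 0ℓ} (Q? : Decidable Q) j →
    finSum {ℓ} (λ t → finSum {period} (λ q → 𝟙 ((j ≤? toℕ t) ×-dec Q? (size (slot (toℕ q) (toℕ t)))))) ≡
    tailSum (map (count (Q? ∘ val)) f) j
  level-count Q? j = trans (finSum-cong {ℓ} at-level) (tailSum≡finSum (map (count (Q? ∘ val)) f) j)
    where
    at-level : ∀ t → finSum {period} (λ q → 𝟙 ((j ≤? toℕ t) ×-dec Q? (size (slot (toℕ q) (toℕ t))))) ≡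
      gate (j ≤? toℕ t) (lookup (map (count (Q? ∘ val)) f) t)
    at-level t = trans (gate-count (j ≤? toℕ t) {period} (λ q → Q? (size (slot (toℕ q) (toℕ t))))) (cong (gate (j ≤? toℕ t))
      (trans (finSum-cong {period} λ q → cong (𝟙 ∘ Q?) (size-entry q t))
        (trans (sym (count≡finSum (Q? ∘ val) (lookup f t))) (sym (lookup-map t (count (Q? ∘ val)) f)))))

  module CutCounts {z₀ : ℕ} (z₀<N : z₀ < period) (nothing-z : lab 0 (z₀ + period) ≡ nothing)
    (0<k : 0 < k) (k∤N : ¬ k ∣ period) where
    open Cut z₀ z₀<N nothing-z public

    bk′-chain : ∀ j → bk′ k (chain j) ≡ tailSum (positives f) j
    bk′-chain j = trans (chain-bk′ 0<k k∤N j) (level-count (0 <?_) j)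

    bkOfSize-chain : ∀ s → bkOfSize k (chain 0) (suc s) ≡ tableCount (_≟ suc s) f
    bkOfSize-chain s = trans (chain-bkOfSize 0<k k∤N s) (level-count (_≟ suc s) 0)

-- Injectivity

module _ (V N′ k : ℕ) {n : ℕ} where

  private
    module T (f : Table n (suc V) (suc N′)) = TableChain V N′ k f

  open Slots V

  SameChains : Table n (suc V) (suc N′) → Table n (suc V) (suc N′) → Set
  SameChains f g = ∀ t → T.chain f (toℕ {suc V} t) ≈P T.chain g (toℕ t)

  same-level : ∀ {f g} → SameChains f g → ∀ {j} → j ≤ V → T.chain f j ≈P T.chain g j
  same-level {f} {g} same {j} j≤V = subst (λ j → T.chain f j ≈P T.chain g j) (toℕ-fromℕ< (s≤s j≤V)) (same (fromℕ< (s≤s j≤V)))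

  module _ {z₀ : ℕ} (z₀<N : z₀ < suc N′) where
    private
      A = suc z₀

      HasCut : Table n (suc V) (suc N′) → Set
      HasCut f = T.lab f 0 (z₀ + suc N′) ≡ nothing

    transfer : ∀ f g → HasCut f → HasCut g → SameChains f g → ∀ {j x y} → j ≤ V →
      A ≤ x → x < A + suc N′ → A ≤ y → y < A + suc N′ → T.lab f j x ≡ T.lab f j y → T.lab g j x ≡ T.lab g j y
    transfer f g cutf cutg same {j} {x} {y} j≤V A≤x x<B A≤y y<B eq =
      trans (sym (GC.label-mod A≤x x<B)) (trans (GC.same⇒label {j} same-g) (GC.label-mod A≤y y<B))
      where
      module FC = T.Cut f z₀ z₀<N cutf
      module GC = T.Cut g z₀ z₀<N cutg
      same-g : SameBlock (T.chain g j) (x mod suc N′) (y mod suc N′)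
      same-g = ≈P⇒same {π = T.chain f j} {T.chain g j} (same-level {f} {g} same j≤V) _ _
        (FC.label⇒same {j} (trans (FC.label-mod A≤x x<B) (trans eq (sym (FC.label-mod A≤y y<B)))))

    demand-determined : ∀ f g → HasCut f → HasCut g → SameChains f g → SameChains g f →
      ∀ {e} → A * ℓ ≤ e → e < (A + suc N′) * ℓ → 0 < T.h f e → T.h g e ≡ T.h f e
    demand-determined f g cutf cutg same same′ = demand-unique {ℓ} {lvl} lvl-anti pos-of lvl≤V (T.h f) (T.h g)
      FC.clean-A GC.clean-A FC.clean-B GC.clean-B (at-end f cutf) (at-end g cutg)
      (transfer f g cutf cutg same) (transfer g f cutg cutf same′)
      where
      module FC = T.Cut f z₀ z₀<N cutf
      module GC = T.Cut g z₀ z₀<N cutg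
      at-end : ∀ f → HasCut f → T.lab f 0 (A + N′) ≡ nothing
      at-end f cut = trans (cong (T.lab f 0) (sym (+-suc z₀ N′))) cut

    table-determined : 0 < k → ∀ f g → HasCut f → HasCut g → SameChains f g → f ≡ g
    table-determined 0<k f g cutf cutg same = lookup-ext λ t → lookup-ext λ q → val-injective (entries t q)
      where
      module FC = T.Cut f z₀ z₀<N cutf
      same′ : SameChains g f
      same′ t = ≈P-sym {π = T.chain f (toℕ t)} {T.chain g (toℕ t)} (same t)
      -- The comparison of runs speaks only of slots with nonzero content, so it is applied from
      -- whichever side is nonzero.
      demands : ∀ {e} → A * ℓ ≤ e → e < (A + suc N′) * ℓ → T.h f e ≡ T.h g e
      demands {e} A≤e e<B with T.h f e in hf | T.h g e in hg
      ... | zero  | zero  = refl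
      ... | suc _ | _     = trans (sym hf) (trans (sym (demand-determined f g cutf cutg same same′ A≤e e<B (subst (0 <_) (sym hf) z<s))) hg)
      ... | zero  | suc _ = trans (sym hf) (trans (demand-determined g f cutg cutf same′ same A≤e e<B (subst (0 <_) (sym hg) z<s)) hg)
      entries : ∀ t q → T.entry f t q ≡ T.entry g t q
      entries t q with A≤x , x<B ← FC.rep-in q = begin
        T.entry f t q                                                 ≡⟨ cong (T.entry f t) (FC.rep-mod q) ⟨
        T.entry f t (FC.rep q mod suc N′)             ≡⟨ T.size-at f (FC.rep q) t ⟨
        T.size f e                                                    ≡⟨ *-cancelˡ-≡ (T.size f e) (T.size g e) k {{>-nonZero 0<k}}
                                                                           (demands (≤⇒slot≥ {t = toℕ t} A≤x) e<B) ⟩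
        T.size g e                                                    ≡⟨ T.size-at g (FC.rep q) t ⟩
        T.entry g t (FC.rep q mod suc N′)             ≡⟨ cong (T.entry g t) (FC.rep-mod q) ⟩
        T.entry g t q ∎
        where
        open ≡-Reasoning
        e = slot (FC.rep q) (toℕ t)
        e<B : e < (A + suc N′) * ℓ
        e<B = <-≤-trans (slot< (FC.rep q) (toℕ t)) (*-monoˡ-≤ ℓ (proj₂ (FC.rep-in q)))

  -- A leftover position is recognised in the chain: its block in the finest partition is the one whose size k does not divide.
  cut-transfer : ¬ k ∣ suc N′ → ∀ f g {z₀ z₁} → z₀ < suc N′ → z₁ < suc N′ →
    T.lab f 0 (z₀ + suc N′) ≡ nothing → T.lab g 0 (z₁ + suc N′) ≡ nothing → SameChains f g →
    T.lab g 0 (z₀ + suc N′) ≡ nothing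
  cut-transfer k∤N f g {z₀} {z₁} z₀<N z₁<N cutf cutg same =
    map-nothing (T.lab g 0 (z₀ + suc N′)) (trans (cong (λ x → Maybe.map (_% (suc N′ * ℓ)) (T.lab g 0 x)) position)
      (trans (GC.colour-label 0 FC.special) (cong (Maybe.map (_% (suc N′ * ℓ))) label-g)))
    where
    module FC = T.Cut f z₀ z₀<N cutf
    module GC = T.Cut g z₁ z₁<N cutg
    map-nothing : ∀ {h : ℕ → ℕ} (m : Maybe ℕ) → Maybe.map h m ≡ nothing → m ≡ nothing
    map-nothing nothing _ = refl
    π = T.chain f 0
    σ = T.chain g 0
    π≈σ : π ≈P σ
    π≈σ = same zero
    label-g : GC.label 0 FC.special ≡ nothing
    label-g = decidable-stable (GC.label 0 FC.special ≟ᴹ nothing) λ ≢nothing →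
      FC.special⇒∤ k∤N {0} {FC.special} (FC.label-special 0)
        (subst (k ∣_) (sym (trans (blockSize-cong {π = π} {σ} π≈σ (blk π FC.special)) (cong (blockSize σ) (π≈σ FC.special))))
          (GC.nonspecial⇒∣ k∤N {0} {FC.special} ≢nothing))
    position : z₀ + suc N′ ≡ suc N′ + toℕ FC.special
    position = trans (+-comm z₀ (suc N′)) (cong (suc N′ +_) (sym (trans (toℕ-fromℕ< (m%n<n (z₀ + suc N′) (suc N′)))
      (trans ([m+n]%n≡m%n z₀ (suc N′)) (m<n⇒m%n≡m z₀<N)))))

-- Surjectivity

rangeSum-𝟙-≤ : ∀ {P : Pred ℕ 0ℓ} (P? : Decidable P) lo n → rangeSum (𝟙 ∘ P?) lo n ≤ n
rangeSum-𝟙-≤ P? lo zero    = z≤n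
rangeSum-𝟙-≤ P? lo (suc n) with P? lo
... | yes _ = s≤s (rangeSum-𝟙-≤ P? (suc lo) n)
... | no _  = m≤n⇒m≤1+n (rangeSum-𝟙-≤ P? (suc lo) n)

just≢nothing : ∀ {e : ℕ} → ¬ just e ≡ nothing
just≢nothing ()

module Reconstruct (V N′ n k : ℕ) (0<k : 0 < k) (N<k+kn : suc N′ < suc n * k)
  (c : Fin (suc V) → Partition (suc N′)) (c-noncrossing : ∀ i → Noncrossing (c i))
  (c-bkNot : bkNot k (c zero) ≡ 1) (c-mono : ∀ i j → i Fin.≤ j → c i ⊑ c j) where

  open Slots V
  open Cyclic (suc N′)

  private
    instance
      k≢0 : NonZero k
      k≢0 = >-nonZero 0<k

    π : Partition (suc N′)
    π = c zero

    isSpecial? : ∀ m → Dec (blk π m ≡ m × ¬ k ∣ blockSize π m)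
    isSpecial? m = (blk π m Fin.≟ m) ×-dec ¬? (k ∣? blockSize π m)

    one-special : finSum (𝟙 ∘ isSpecial?) ≡ 1
    one-special = trans (sym (numBlocks≡ π (λ x → ¬? (k ∣? x)))) c-bkNot

    found : ∃[ m ] (blk π m ≡ m × ¬ k ∣ blockSize π m)
    found = finSum-exists isSpecial? (subst (0 <_) (sym one-special) z<s)

    m₀ : Fin (suc N′)
    m₀ = proj₁ found

  -- The cut is the minimum of the special block of the finest partition, so that the special block
  -- is the block of the last position of the window.
  z₀ : ℕ
  z₀ = toℕ m₀

  z₀<N : z₀ < suc N′
  z₀<N = toℕ<n m₀

  private
    A : ℕ
    A = suc z₀
    C : ℕ → Partition (suc N′)
    C j = c (j mod ℓ)

    opaque
      κ : ℕ → ℕ → ℕ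
      κ j x = toℕ (blk (C j) (x mod suc N′))

      κ⇒same : ∀ {j x y} → κ j x ≡ κ j y → SameBlock (C j) (x mod suc N′) (y mod suc N′)
      κ⇒same = toℕ-injective

      same⇒κ : ∀ {j x y} → SameBlock (C j) (x mod suc N′) (y mod suc N′) → κ j x ≡ κ j y
      same⇒κ = cong toℕ

    toℕ-level : ∀ {j} → j ≤ V → toℕ (j mod ℓ) ≡ j
    toℕ-level {j} j≤V = trans (toℕ-fromℕ< (m%n<n j ℓ)) (m<n⇒m%n≡m (s≤s j≤V))

    module CL = ChainLabels V A N′ κ
    open Window {A} z₀<N

    coarsen : ∀ {j j′ x y} → j ≤ j′ → j′ ≤ V → κ j x ≡ κ j y → κ j′ x ≡ κ j′ y
    coarsen {j} {j′} {x} {y} j≤j′ j′≤V eq = same⇒κ {j′} {x} {y} (c-mono (j mod ℓ) (j′ mod ℓ)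
      (subst₂ _≤_ (sym (toℕ-level (≤-trans j≤j′ j′≤V))) (sym (toℕ-level j′≤V)) j≤j′) (x mod suc N′) (y mod suc N′) (κ⇒same {j} {x} {y} eq))

    noncrossing : ∀ {j a b c d} → j ≤ V → A ≤ a → a < b → b < c → c < d → d < A + suc N′ → κ j a ≡ κ j c → κ j b ≡ κ j d → κ j a ≡ κ j b
    noncrossing {j} {a} {b} {c} {d} _ A≤a a<b b<c c<d d<B ac bd = same⇒κ {j} {a} {b} (fin-noncrossing (blk (C j))
      (λ {a} {b} {c} {d} → c-noncrossing (j mod ℓ) a b c d) A A≤a a<b b<c c<d d<B (κ⇒same {j} {a} {c} ac) (κ⇒same {j} {b} {d} bd))

    open CL.Labels (λ {j} {j′} {x} {y} → coarsen {j} {j′} {x} {y}) (λ {j} {a} {b} {c} {d} → noncrossing {j} {a} {b} {c} {d})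

    amount : ℕ → ℕ
    amount e = rangeSum (occurs e) A (suc N′)

    -- A slot occurs at most `suc N′` times, which is less than `(n + 1) * k`; so the quotient is a
    -- legal entry of the table.
    amount-bound : ∀ e → amount e / k ≤ n
    amount-bound e = ≤-pred (m<n*o⇒m/o<n {amount e} {suc n} {k}
      (≤-<-trans (rangeSum-𝟙-≤ (λ y → ident 0 y ≟ᴹ just e) A (suc N′)) N<k+kn))

    end : ℕ
    end = z₀ + suc N′

    end≡ : A + N′ ≡ end
    end≡ = sym (+-suc z₀ N′)

    end-mod : end mod suc N′ ≡ m₀
    end-mod = trans (mod-period z₀) (mod-toℕ m₀)

    nonspecial-∣ : ∀ {i} → ¬ blk π i ≡ m₀ → k ∣ blockSize π (blk π i)
    nonspecial-∣ {i} ≢m₀ = decidable-stable (k ∣? blockSize π (blk π i)) λ k∤ →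
      ≢m₀ (finSum-one-unique isSpecial? one-special (blk-idem π i , k∤) (proj₂ found))

    module _ {e y} (A≤y : A ≤ y) (y<B : y < A + suc N′) (ident-y : ident 0 y ≡ just e) where

      private
        i = y mod suc N′

      not-special : ¬ blk π i ≡ m₀
      not-special blk≡ = just≢nothing (trans (sym ident-y) (trans (ident-cong y<B z<B (same⇒κ {0} {y} {A + N′}
        (trans blk≡ (sym (trans (cong (λ x → blk π (x mod suc N′)) end≡) (trans (cong (blk π) end-mod) (proj₁ (proj₂ found)))))))) (ident-z 0)))

      blockSize≡amount : blockSize π (blk π i) ≡ amount e
      blockSize≡amount = trans (blockSize≡ π (blk π i)) (trans (finSum-cyclic (λ i′ → 𝟙 (blk π i′ Fin.≟ blk π i)) A)
        (rangeSum-cong A (suc N′) λ x A≤x x<B → 𝟙-cong (blk π (x mod suc N′) Fin.≟ blk π i) (ident 0 x ≟ᴹ just e)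
          (λ same → trans (ident-cong x<B y<B (same⇒κ {0} {x} {y} same)) ident-y)
          (λ ident-x → κ⇒same {0} {x} {y} (ident-reflects {0} z≤n (A≤x , x<B) (A≤y , y<B) (trans ident-x (sym ident-y))))))

      occupied-∣ : k ∣ amount e
      occupied-∣ = subst (k ∣_) blockSize≡amount (nonspecial-∣ not-special)

    -- A slot that occurs is the label of a finest block other than the special one, and its
    -- occurrences are the elements of that block.
    amount-∣ : ∀ e → k ∣ amount e
    amount-∣ e = by-cases (amount e) refl
      where
      occupied : Alive A e → k ∣ amount e
      occupied (y , A≤y , y<B , ident-y) = occupied-∣ A≤y y<B ident-y
      by-cases : ∀ a → amount e ≡ a → k ∣ amount e
      by-cases zero    eq = subst (k ∣_) (sym eq) (k ∣0)
      by-cases (suc a) eq = occupied (rangeSum-pos (λ y → ident 0 y ≟ᴹ just e) A (suc N′) (subst (0 <_) (sym eq) z<s))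

  private
    cell : Fin (suc V) → Fin (suc N′) → Maybe (Fin n)
    cell t q = unval (amount (slot (rep q) (toℕ t)) / k) (amount-bound (slot (rep q) (toℕ t)))

  table-of : Table n (suc V) (suc N′)
  table-of = tabulate λ t → tabulate (cell t)

  open TableChain V N′ k table-of using (entry; size-at; h; lab; chain; lab-shift; nothing⇒Clean; module Cut)

  private
    entry-amount : ∀ t q → k * entry t q ≡ amount (slot (rep q) (toℕ t))
    entry-amount t q = trans (cong (k *_) (trans (cong val lookups) (val-unval _ (amount-bound e))))
      (trans (*-comm k (amount e / k)) (m/n*n≡m (amount-∣ e)))
      where
      e = slot (rep q) (toℕ t)
      lookups : lookup (lookup table-of t) q ≡ cell t q
      lookups = trans (cong (λ v → lookup v q) (lookup∘tabulate (λ t → tabulate (cell t)) t)) (lookup∘tabulate (cell t) q)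

    h-amount : ∀ {e} → A * ℓ ≤ e → e < (A + suc N′) * ℓ → h e ≡ amount e
    h-amount {e} A≤e e<B = begin
      h e                                           ≡⟨ cong h slot≡ ⟨
      h (slot x (toℕ t))                            ≡⟨ cong (k *_) (size-at x t) ⟩
      k * entry t (x mod suc N′)                    ≡⟨ entry-amount t (x mod suc N′) ⟩
      amount (slot (rep (x mod suc N′)) (toℕ t))    ≡⟨ cong (λ x → amount (slot x (toℕ t))) (rep-unique A≤x x<B) ⟩
      amount (slot x (toℕ t))                       ≡⟨ cong amount slot≡ ⟩
      amount e ∎
      where
      open ≡-Reasoning
      x = e / ℓ
      t : Fin ℓ
      t = fromℕ< (s≤s (lvl≤V e))
      slot≡ : slot x (toℕ t) ≡ e
      slot≡ = trans (cong (slot x) (toℕ-fromℕ< (s≤s (lvl≤V e)))) (slot-pos-lvl e)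
      A≤x : A ≤ x
      A≤x = ≮⇒≥ λ x<A → <⇒≱ (proj₂ (proj₂ (pos-of e))) (≤-trans (*-monoˡ-≤ ℓ x<A) A≤e)
      x<B : x < A + suc N′
      x<B = ≰⇒> λ B≤x → <⇒≱ e<B (≤-trans (*-monoˡ-≤ ℓ B≤x) (proj₁ (proj₂ (pos-of e))))

    spec : ∀ {j x} → j ≤ V → A ≤ x → x < A + suc N′ → GreatestAlive j x
    spec j≤V A≤x x<B = ident-greatest j≤V (A≤x , x<B)

    A≤end : A ≤ end
    A≤end = subst (A ≤_) end≡ (m≤m+n A N′)

    end<B : end < A + suc N′
    end<B = ≤-refl

    ident-end : ident 0 end ≡ nothing
    ident-end = subst (λ x → ident 0 x ≡ nothing) end≡ (ident-z 0)

    start-nothing : lab 0 z₀ ≡ nothing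
    start-nothing = by-cases (lab 0 z₀) refl
      where
      by-cases : ∀ l → lab 0 z₀ ≡ l → l ≡ nothing
      by-cases nothing  _  = refl
      -- A slot open at `z₀` would have its copy open one lap later at `end`. That copy belongs to
      -- the window or lies beyond it, where labels are known to agree with `ident`, and `ident`
      -- leaves `end` unlabelled.
      by-cases (just e) eq = contradiction (trans (sym (label≥⇒ident spec h h-amount A≤end end<B z≤n
        (≤-trans (*-monoˡ-≤ ℓ z₀<N) (m≤n+m (suc N′ * ℓ) e)) (lab-shift eq))) ident-end) just≢nothing

    reproduced : ∀ {j x} → j ≤ V → A ≤ x → x < A + suc N′ → lab j x ≡ ident j x
    reproduced j≤V A≤x x<B = label≡ident spec h h-amount A≤x x<B (nothing⇒Clean start-nothing) j≤V

  cut : lab 0 (z₀ + suc N′) ≡ nothing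
  cut = trans (reproduced z≤n A≤end end<B) ident-end

  private
    module K = Cut z₀ z₀<N cut

    agree : ∀ {j} → j ≤ V → chain j ≈P C j
    agree {j} j≤V = ⊑-antisym {π = chain j} {C j} to from
      where
      label≡ : ∀ i → K.label j i ≡ ident j (rep i)
      label≡ i = reproduced j≤V (proj₁ (rep-in i)) (proj₂ (rep-in i))
      rep-blk : ∀ i → blk (C j) (rep i mod suc N′) ≡ blk (C j) i
      rep-blk i = cong (blk (C j)) (rep-mod i)
      to : chain j ⊑ C j
      to i i′ same = trans (sym (rep-blk i)) (trans (κ⇒same {j} {rep i} {rep i′} (ident-reflects {j} j≤V (rep-in i) (rep-in i′)
        (trans (sym (label≡ i)) (trans (K.same⇒label {j} same) (label≡ i′))))) (rep-blk i′))
      from : C j ⊑ chain j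
      from i i′ same = K.label⇒same {j} (trans (label≡ i) (trans (ident-cong (proj₂ (rep-in i)) (proj₂ (rep-in i′))
        (same⇒κ {j} {rep i} {rep i′} (trans (rep-blk i) (trans same (sym (rep-blk i′)))))) (sym (label≡ i′))))

  reconstructed : ∀ t → chain (toℕ t) ≈P c t
  reconstructed t = subst (λ u → chain (toℕ t) ≈P c u) (Cyclic.mod-toℕ ℓ t) (agree (≤-pred (toℕ<n t)))

-- Tables correspond to chains, and the count

∣-remainder : ∀ {n k r} → 0 < r → r < k → ¬ k ∣ k * n + r
∣-remainder {n} 0<r r<k k∣ = <⇒≱ r<k (∣⇒≤ {{>-nonZero 0<r}} (∣m+n∣m⇒∣n k∣ (m∣m*n n)))

sum≤ : ∀ {n b} {bs : Vec ℕ n} → sum bs ≡ b → weight bs ≤ n → b ≤ n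
sum≤ {bs = bs} sum-bs weight≤n = ≤-trans (≤-reflexive (sym sum-bs)) (≤-trans (sum≤weight bs) weight≤n)

module _ {m n b : ℕ} (b≤n : b ≤ n) where

  sum-tail : (s : Vec ℕ (suc m)) → sum s ≡ n → head s ≡ n ∸ b → sum (tail s) ≡ b
  sum-tail (x ∷ cs) sum-s refl = +-cancelˡ-≡ (n ∸ b) _ _ (trans sum-s (sym (m∸n+n≡m b≤n)))

  rankJump-s : ∀ k r (s : Vec ℕ (suc m)) → sum s ≡ n → head s ≡ n ∸ b → diffs n k r (0 ∷ ranks n k r (tail s)) ≡ s
  rankJump-s k r s@(x ∷ cs) sum-s head-s = trans
    (rankJump-ranks n k r cs (≤-trans (≤-reflexive (sum-tail s sum-s head-s)) b≤n))
    (cong (_∷ cs) (trans (cong (n ∸_) (sum-tail s sum-s head-s)) (sym head-s)))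

module Enumeration (n k r V : ℕ) (0<r : 0 < r) (r<k : r < k) (b : ℕ) (bs : Vec ℕ n) (s : Vec ℕ (suc (suc V)))
  (sum-bs : sum bs ≡ b) (weight≤n : weight bs ≤ n) (sum-s : sum s ≡ n) (head-s : head s ≡ n ∸ b) where

  -- The set of chains with N in place of k * n + r, so that N can be matched against suc.
  Valid : ∀ N → (Fin (suc V) → Partition N) → Set
  Valid N c = ((∀ i → Noncrossing (c i) × bkNot k (c i) ≡ 1) × (∀ i j → i Fin.≤ j → c i ⊑ c j)) ×
    diffs n k r (0 ∷ (tabulate (λ i → n ∸ bk′ k (c i)) ∷ʳ n)) ≡ s ×
    bk′ k (c zero) ≡ b × (∀ (j : Fin n) → bkOfSize k (c zero) (suc (toℕ j)) ≡ lookup bs j)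

  Chains : ℕ → Set
  Chains N = Σ (Fin (suc V) → Partition N) (Valid N)

  private
    cs : Vec ℕ (suc V)
    cs = tail s

    0<k : 0 < k
    0<k = <-trans 0<r r<k

    b≤n : b ≤ n
    b≤n = sum≤ {bs = bs} sum-bs weight≤n

    sums : sum bs ≡ sum cs
    sums = trans sum-bs (sym (sum-tail b≤n s sum-s head-s))

  module _ (N′ : ℕ) (N≡ : suc N′ ≡ k * n + r) where

    private
      module T (f : Table n (suc V) (suc N′)) = TableChain V N′ k f

      k∤N : ¬ k ∣ suc N′
      k∤N k∣ = ∣-remainder {n} 0<r r<k (subst (k ∣_) N≡ k∣)

      Counts : Table n (suc V) (suc N′) → Set
      Counts = HasCounts {N = suc N′} bs cs sums

      Cut : Table n (suc V) (suc N′) → Set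
      Cut f = ∃[ z₀ ] z₀ < suc N′ × T.lab f 0 (z₀ + suc N′) ≡ nothing

      has-cut : ∀ f → Counts f → Cut f
      -- A cut needs a leftover position of the second lap, so the search starts at `suc N′`.
      has-cut f (_ , occ) = shift-back (T.nothing-from f demand< (suc N′))
        where
        demand< : rangeSum (T.h f) 0 (suc N′ * suc V) < suc N′
        demand< = subst₂ _<_ (sym (T.demand f bs occ)) (sym N≡)
          (≤-<-trans (*-monoʳ-≤ k weight≤n) (m<m+n (k * n) 0<r))
        shift-back : (∃[ z ] suc N′ ≤ z × z < suc N′ + suc N′ × T.lab f 0 z ≡ nothing) → Cut f
        shift-back (z , N≤z , z<2N , eq) =
          z ∸ suc N′ , +-cancelʳ-< (suc N′) _ _ (subst (_< suc N′ + suc N′) (sym (m∸n+n≡m N≤z)) z<2N) ,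
          trans (cong (T.lab f 0) (m∸n+n≡m N≤z)) eq

    table-valid : ∀ f → Counts f → Cut f → Valid (suc N′) (λ t → T.chain f (toℕ t))
    table-valid f (pos , occ) (z₀ , z₀<N , eq) =
      ((λ t → C.chain-noncrossing (toℕ t) , C.chain-bkNot k∤N (toℕ t)) , (λ i j i≤j → C.chain-⊑ i≤j)) , jumps ,
      trans (C.bk′-chain 0) (trans (cong sum pos) (trans (sym sums) sum-bs)) ,
      λ j → trans (C.bkOfSize-chain (toℕ j)) (occ j)
      where
      module C = T.CutCounts f z₀<N eq 0<k k∤N
      jumps : diffs n k r (0 ∷ (tabulate (λ t → n ∸ bk′ k (T.chain f (toℕ {suc V} t))) ∷ʳ n)) ≡ s
      jumps = trans (cong (λ v → diffs n k r (0 ∷ (v ∷ʳ n))) (tabulate-cong λ t →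
        cong (n ∸_) (trans (C.bk′-chain (toℕ t)) (cong (λ v → tailSum v (toℕ t)) pos))))
        (rankJump-s b≤n k r s sum-s head-s)

    to-chain : ∀ f → Counts f → Chains (suc N′)
    to-chain f counts = (λ t → T.chain f (toℕ t)) , table-valid f counts (has-cut f counts)

    to-chain-injective : ∀ f g cf cg → (∀ t → proj₁ (to-chain f cf) t ≈P proj₁ (to-chain g cg) t) → f ≡ g
    to-chain-injective f g cf cg same = with-cuts (has-cut f cf) (has-cut g cg)
      where
      with-cuts : Cut f → Cut g → f ≡ g
      with-cuts (z₀ , z₀<N , cutf) (z₁ , z₁<N , cutg) = table-determined V N′ k z₀<N 0<k f g cutf
        (cut-transfer V N′ k k∤N f g z₀<N z₁<N cutf cutg same) same

    to-chain-surjective : (x : Chains (suc N′)) → Σ (Table n (suc V) (suc N′)) λ f → Σ (Counts f) λ counts →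
      ∀ t → proj₁ x t ≈P proj₁ (to-chain f counts) t
    to-chain-surjective (c , (c-in , c-mono) , c-jumps , c-bk′ , c-sizes) = f , counts , λ t →
      ≈P-sym {π = T.chain f (toℕ t)} {c t} (R.reconstructed t)
      where
      module R = Reconstruct V N′ n k 0<k
        (subst₂ _<_ (sym N≡) (trans (+-comm (k * n) k) (trans (sym (*-suc k n)) (*-comm k (suc n)))) (+-monoʳ-< (k * n) r<k))
        c (λ i → proj₁ (c-in i)) (proj₂ (c-in zero)) c-mono
      f = R.table-of
      module C = T.CutCounts f R.z₀<N R.cut 0<k k∤N
      bk′-c : ∀ t → bk′ k (c t) ≡ tailSum (positives f) (toℕ t)
      bk′-c t = trans (sym (numBlocks-cong {π = T.chain f (toℕ t)} {c t} (R.reconstructed t) (k ∣?_))) (C.bk′-chain (toℕ t))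
      sum-pos≤n : sum (positives f) ≤ n
      sum-pos≤n = ≤-trans (≤-reflexive (trans (sym (bk′-c zero)) c-bk′)) b≤n
      counts : Counts f
      -- The rank jumps after the first are the row counts, so the given jump vector prescribes the
      -- number of nonempty entries in every row.
      counts = cong tail (trans (sym (rankJump-ranks n k r (positives f) sum-pos≤n))
          (trans (cong (λ v → diffs n k r (0 ∷ (v ∷ʳ n))) (tabulate-cong λ t → cong (n ∸_) (sym (bk′-c t)))) c-jumps)) ,
        λ i → trans (sym (C.bkOfSize-chain (toℕ i)))
          (trans (numBlocks-cong {π = T.chain f 0} {c zero} (R.reconstructed zero) (_≟ k * suc (toℕ i))) (c-sizes i))

  enumerate : ∀ N → N ≡ k * n + r → HasCount (Chains N) (λ x y → ∀ t → proj₁ x t ≈P proj₁ y t)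
    (multinomial b bs * prod (map (N C_) cs))
  enumerate zero N≡ = contradiction (m+n≡0⇒n≡0 (k * n) (sym N≡)) (m<n⇒n≢0 0<r)
  enumerate (suc N′) N≡ = subst (λ b → HasCount (Chains (suc N′)) (λ x y → ∀ t → proj₁ x t ≈P proj₁ y t)
    (multinomial b bs * prod (map (suc N′ C_) cs))) sum-bs (chainAt , injective , surjective)
    where
    module I = Inverse (Code-enum {n} {suc V} {suc N′} bs cs sums)
    tableAt : Fin _ → Table n (suc V) (suc N′)
    tableAt i = table bs cs sums (I.to i)
    chainAt : Fin _ → Chains (suc N′)
    chainAt i = to-chain N′ N≡ (tableAt i) (table-counts bs cs sums (I.to i))
    injective : ∀ i j → (∀ t → proj₁ (chainAt i) t ≈P proj₁ (chainAt j) t) → i ≡ j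
    injective i j same = trans (sym (I.strictlyInverseʳ i)) (trans (cong I.from (table-injective bs cs sums (I.to i) (I.to j)
      (to-chain-injective N′ N≡ (tableAt i) (tableAt j)
        (table-counts bs cs sums (I.to i)) (table-counts bs cs sums (I.to j)) same))) (I.strictlyInverseʳ j))
    surjective : ∀ x → ∃[ i ] (∀ t → proj₁ x t ≈P proj₁ (chainAt i) t)
    surjective x = from-table (to-chain-surjective N′ N≡ x)
      where
      from-table : (Σ (Table n (suc V) (suc N′)) λ f → Σ (HasCounts bs cs sums f) λ counts →
        ∀ t → proj₁ x t ≈P proj₁ (to-chain N′ N≡ f counts) t) → ∃[ i ] (∀ t → proj₁ x t ≈P proj₁ (chainAt i) t)
      from-table (f , counts , same) with code , refl ← table-surjective bs cs sums f counts = I.from code , λ t →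
        subst (λ y → proj₁ x t ≈P TableChain.chain V N′ k (table bs cs sums y) (toℕ t)) (sym (I.strictlyInverseˡ code)) (same t)

theorem4p5 : (n k ℓ r : ℕ) → 0 < n → 0 < k → (0<ℓ : 0 < ℓ) → 0 < r → r < k →
    (b : ℕ) (bs : Vec ℕ n) (s : Vec ℕ (suc ℓ)) →
    sum bs ≡ b →
    sum (zipWith _*_ (tabulate (λ i → suc (toℕ i))) bs) ≤ n →
    sum s ≡ n →
    head s ≡ n ∸ b →
    HasCount (CountedChains n k r ℓ 0<ℓ b bs s) (SameChain n k r ℓ 0<ℓ b bs s)
    (multinomial b bs * prod (map (λ si → (k * n + r) C si) (tail s)))
theorem4p5 n k (suc V) r _ _ (s≤s z≤n) 0<r r<k b bs s sum-bs weight≤n sum-s head-s =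
  Enumeration.enumerate n k r V 0<r r<k b bs s sum-bs weight≤n sum-s head-s (k * n + r) refl
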